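{- Let $G$ be a finite connected graph with edge set $E$, and fix an acyclic cycle signature $\sigma$ and an acyclic cocycle signature $\sigma^*$ of $G$. Let $\varphi_{\sigma,\sigma^*}$ be the map from orientations of $G$ to spanning subgraphs (subsets of $E$) defined by $$\varphi_{\sigma,\sigma^*}(\overrightarrow{O})=g_{\sigma,\sigma^*}^{ -1}(\overrightarrow{O^{cp}})\cup\Big(\biguplus_{i\in I}C_i\Big)\setminus\Big(\biguplus_{j\in J}C_j^*\Big),$$ where $\overrightarrow{O}$ is obtained by reversing pairwise disjoint directed cycles $\{\overrightarrow{C_i}\}_{i\in I}$ and directed cocycles $\{\overrightarrow{C_j^*}\}_{j\in J}$ in the $(\sigma,\sigma^*)$-compatible orientation $\overrightarrow{O^{cp}}$. Then: (1) $\varphi_{\sigma,\sigma^*}$ is a bijection from the set of all (discrete) orientations of $G$ to the set of all spanning subgraphs of $G$. (2) $\varphi_{\sigma,\sigma^*}$ restricts to a bijection from the set of $\sigma$-compatible orientations to the set of spanning forests of $G$, given by $\overrightarrow{O}\mapsto g_{\sigma,\sigma^*}^{ -1}(\overrightarrow{O^{cp}})\setminus(\biguplus_{j\in J}C_j^*)$. (3) $\varphi_{\sigma,\sigma^*}$ restricts to a bijection from the set of $\sigma^*$-compatible orientations to the set of connected spanning subgraphs of $G$, given by $\overrightarrow{O}\mapsto g_{\sigma,\sigma^*}^{ -1}(\overrightarrow{O^{cp}})\cup(\biguplus_{i\in I}C_i)$.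
   Context: $G$ is a finite connected graph; loops and multiple edges are allowed. Fix a reference orientation of $G$; an orientation is identified with a vector in $\{0,1\}^E$ (coordinate $1$ at $e$ iff $e$ is oriented as in the reference orientation). A cycle is the edge set of a simple closed walk (a loop counts); a directed cycle is a cycle with one of its two cyclic directions. A cocycle is an inclusion-minimal nonempty cut (set of edges between a vertex set $W$ and its complement); a directed cocycle is a cocycle with all edges directed from $W$ to its complement or all in the other way. Directed cycles/cocycles are identified with $\{0,\pm1\}$-vectors in $\mathbb{R}^E$ (entry $+1$ on edges directed as in the reference orientation, $-1$ on edges directed oppositely, $0$ elsewhere). A directed cycle or cocycle is "in" an orientation if all its arcs are arcs of the orientation; reversing it means reversing those arcs. A cycle signature $\sigma$ chooses one direction $\sigma(C)$ for each cycle $C$; it is acyclic if whenever reals $a_C\ge 0$ satisfy $\sum_C a_C\sigma(C)=0$ in $\mathbb{R}^E$, all $a_C=0$. An orientation is $\sigma$-compatible if every directed cycle in it equals $\sigma(C)$ for its underlying cycle $C$. Acyclic cocycle signatures $\sigma^*$ and $\sigma^*$-compatible orientations are defined analogously with cocycles; $(\sigma,\sigma^*)$-compatible means both. For a spanning tree $T$: for $e\notin T$, $C(T,e)$ is the unique cycle in $T\cup\{e\}$; for $e\in T$, $C^*(T,e)$ is the unique cocycle contained in $(E\setminus T)\cup\{e\}$. $g_{\sigma,\sigma^*}(T)$ is the orientation in which each $e\notin T$ is oriented as in $\sigma(C(T,e))$ and each $e\in T$ as in $\sigma^*(C^*(T,e))$; $g_{\sigma,\sigma^*}$ is a bijection from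 spanning trees onto $(\sigma,\sigma^*)$-compatible orientations. Two orientations are in the same cycle–cocycle reversal class if one is obtained from the other by a sequence of reversals of directed cycles and directed cocycles. Every orientation $\overrightarrow{O}$ lies in the class of a unique $(\sigma,\sigma^*)$-compatible orientation $\overrightarrow{O^{cp}}$, and $\overrightarrow{O}$ is obtained from $\overrightarrow{O^{cp}}$ by reversing pairwise disjoint directed cycles and directed cocycles as in the claim (the unions $\biguplus C_i$ and $\biguplus C^*_j$ are determined by $\overrightarrow{O}$). A spanning subgraph is identified with its edge set $S\subseteq E$. -}

module Defs where

open import Data.Nat using (ℕ)
open import Data.Fin using (Fin; _≟_)
open import Data.Bool using (Bool; true; false; not; _∧_; _∨_; _xor_; if_then_else_)
open import Data.Integer using (ℤ; +_; -_; _+_)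
open import Data.Vec using (Vec; lookup; tabulate; zipWith; replicate; map)
open import Data.List using (List; []; _∷_; foldr; _++_)
open import Data.List.Relation.Unary.All using (All)
open import Data.List.Relation.Unary.AllPairs using (AllPairs)
open import Data.List.Relation.Unary.Unique.Propositional using (Unique)
import Data.List as L
open import Data.Product using (Σ; ∃; _×_; _,_; proj₁; proj₂)
open import Relation.Binary.PropositionalEquality using (_≡_; _≢_)
open import Relation.Nullary using (¬_)
open import Relation.Nullary.Decidable using (⌊_⌋)

-- A finite graph (loops and multiple edges allowed) with a fixed
-- reference orientation: vertices Fin nV, edges Fin nE, and edge e goes
-- from src e to tgt e in the reference orientation.

record Graph : Set where
  field
    nV nE : ℕ
    src tgt : Fin nE → Fin nV

module _ (G : Graph) where
  open Graph G

  EdgeSet : Set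
  EdgeSet = Vec Bool nE

  VertexSet : Set
  VertexSet = Vec Bool nV

  -- orientation: coordinate true at e iff e oriented as in reference
  Orientation : Set
  Orientation = Vec Bool nE

  -- {0,±1}-vectors in ℤ^E (directed cycles / cocycles)
  DVec : Set
  DVec = Vec ℤ nE

  _∪ₛ_ : EdgeSet → EdgeSet → EdgeSet
  A ∪ₛ B = zipWith _∨_ A B

  _∖ₛ_ : EdgeSet → EdgeSet → EdgeSet
  A ∖ₛ B = zipWith (λ a b → a ∧ not b) A B

  compl : EdgeSet → EdgeSet
  compl A = map not A

  single : Fin nE → EdgeSet
  single e = tabulate (λ f → ⌊ f ≟ e ⌋)

  emptySet : EdgeSet
  emptySet = replicate nE false

  _⊆ₛ_ : EdgeSet → EdgeSet → Set
  A ⊆ₛ B = ∀ e → lookup A e ≡ true → lookup B e ≡ true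

  support : DVec → EdgeSet
  support D = map (λ z → not ⌊ z Data.Integer.≟ + 0 ⌋) D

  unionSupp : List DVec → EdgeSet
  unionSupp = foldr (λ D acc → support D ∪ₛ acc) emptySet

  zeroV : DVec
  zeroV = replicate nE (+ 0)

  sumV : List DVec → DVec
  sumV = foldr (zipWith _+_) zeroV

  Dart : Set
  Dart = Fin nE × Bool

  start : Dart → Fin nV
  start (e , b) = if b then src e else tgt e

  end : Dart → Fin nV
  end (e , b) = if b then tgt e else src e

  IsWalk : Fin nV → List Dart → Fin nV → Set
  IsWalk u [] v = u ≡ v
  IsWalk u (d ∷ ds) v = (start d ≡ u) × IsWalk (end d) ds v

  SimpleClosedWalk : List Dart → Set
  SimpleClosedWalk ds =
    (ds ≢ []) × (Σ (Fin nV) λ v → IsWalk v ds v)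
    × Unique (L.map start ds) × Unique (L.map proj₁ ds)

  dvecOf : List Dart → DVec
  dvecOf ds = tabulate (λ e →
    foldr (λ d acc → if ⌊ proj₁ d ≟ e ⌋
                       then ((if proj₂ d then + 1 else - (+ 1)) + acc)
                       else acc) (+ 0) ds)

  IsDirCycle : DVec → Set
  IsDirCycle D = Σ (List Dart) λ ds → SimpleClosedWalk ds × dvecOf ds ≡ D

  IsCycle : EdgeSet → Set
  IsCycle C = Σ DVec λ D → IsDirCycle D × support D ≡ C

  cut : VertexSet → EdgeSet
  cut W = tabulate (λ e → lookup W (src e) xor lookup W (tgt e))

  dcut : VertexSet → DVec
  dcut W = tabulate (λ e →
    if lookup W (src e) ∧ not (lookup W (tgt e)) then + 1
    else if lookup W (tgt e) ∧ not (lookup W (src e)) then - (+ 1)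
    else + 0)

  NonEmpty : EdgeSet → Set
  NonEmpty A = Σ (Fin nE) λ e → lookup A e ≡ true

  IsCocycle : EdgeSet → Set
  IsCocycle C = Σ VertexSet λ W → (C ≡ cut W) × NonEmpty C
    × (∀ W' → NonEmpty (cut W') → cut W' ⊆ₛ C → cut W' ≡ C)

  -- directed cocycle: the cut of W, whose underlying cut is a cocycle,
  -- directed from W to its complement (the other direction is obtained
  -- by taking the complement of W)
  IsDirCocycle : DVec → Set
  IsDirCocycle D = Σ VertexSet λ W → IsCocycle (cut W) × dcut W ≡ D

  negV : DVec → DVec
  negV = map -_

  IsCycleSignature : (EdgeSet → DVec) → Set
  IsCycleSignature σ = ∀ D → IsDirCycle D →
    (σ (support D) ≡ D) Data.Sum.⊎ (σ (support D) ≡ negV D)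
    where import Data.Sum

  IsCocycleSignature : (EdgeSet → DVec) → Set
  IsCocycleSignature σ = ∀ D → IsDirCocycle D →
    (σ (support D) ≡ D) Data.Sum.⊎ (σ (support D) ≡ negV D)
    where import Data.Sum

  AcyclicCycleSig : (EdgeSet → DVec) → Set
  AcyclicCycleSig σ = ∀ (Cs : List EdgeSet) → All IsCycle Cs →
    sumV (L.map σ Cs) ≡ zeroV → Cs ≡ []

  AcyclicCocycleSig : (EdgeSet → DVec) → Set
  AcyclicCocycleSig σ = ∀ (Cs : List EdgeSet) → All IsCocycle Cs →
    sumV (L.map σ Cs) ≡ zeroV → Cs ≡ []

  AgreesAt : Orientation → DVec → Fin nE → Set
  AgreesAt O D e = (lookup D e ≡ + 1 → lookup O e ≡ true)
                 × (lookup D e ≡ - (+ 1) → lookup O e ≡ false)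

  InOrient : Orientation → DVec → Set
  InOrient O D = ∀ e → AgreesAt O D e

  CycleCompatible : (EdgeSet → DVec) → Orientation → Set
  CycleCompatible σ O = ∀ D → IsDirCycle D → InOrient O D → D ≡ σ (support D)

  CocycleCompatible : (EdgeSet → DVec) → Orientation → Set
  CocycleCompatible σ* O = ∀ D → IsDirCocycle D → InOrient O D → D ≡ σ* (support D)

  reverseOn : EdgeSet → Orientation → Orientation
  reverseOn A O = zipWith _xor_ A O

  Forest : EdgeSet → Set
  Forest S = ∀ C → IsCycle C → ¬ (C ⊆ₛ S)

  ConnectedSub : EdgeSet → Set
  ConnectedSub S = ∀ u v → Σ (List Dart) λ ds →
    IsWalk u ds v × All (λ d → lookup S (proj₁ d) ≡ true) ds

  SpanningTree : EdgeSet → Set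
  SpanningTree T = Forest T × ConnectedSub T

  fullSet : EdgeSet
  fullSet = replicate nE true

  -- g_{σ,σ*}(T) = O, stated relationally: for e ∉ T, e is oriented as
  -- in σ(C(T,e)) where C(T,e) is the (unique) cycle in T ∪ {e}; for
  -- e ∈ T, as in σ*(C*(T,e)) where C*(T,e) is the (unique) cocycle
  -- contained in (E ∖ T) ∪ {e}.
  IsG : (σ σ* : EdgeSet → DVec) → EdgeSet → Orientation → Set
  IsG σ σ* T O = ∀ e →
    (lookup T e ≡ false → ∀ C → IsCycle C → C ⊆ₛ (T ∪ₛ single e) →
       AgreesAt O (σ C) e)
    × (lookup T e ≡ true → ∀ C → IsCocycle C → C ⊆ₛ (compl T ∪ₛ single e) →
       lookup C e ≡ true → AgreesAt O (σ* C) e)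

  record Decomp (σ σ* : EdgeSet → DVec) (O : Orientation) : Set where
    field
      Ocp      : Orientation
      cpCyc    : CycleCompatible σ Ocp
      cpCoc    : CocycleCompatible σ* Ocp
      T        : EdgeSet
      isTree   : SpanningTree T
      gT       : IsG σ σ* T Ocp
      cyc      : List DVec
      cycOK    : All (λ D → IsDirCycle D × InOrient Ocp D) cyc
      coc      : List DVec
      cocOK    : All (λ D → IsDirCocycle D × InOrient Ocp D) coc
      disjoint : AllPairs (λ D D' → ∀ e → lookup (support D) e ≡ true →
                                          lookup (support D') e ≡ false)
                          (cyc ++ coc)
      reversal : O ≡ reverseOn (unionSupp (cyc ++ coc)) Ocp

  phiOf : ∀ {σ σ* O} → Decomp σ σ* O → EdgeSet
  phiOf d = (Decomp.T d ∪ₛ unionSupp (Decomp.cyc d)) ∖ₛ unionSupp (Decomp.coc d)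

  -- Φ σ σ* O S : "φ_{σ,σ*}(O) = S" (as a relation; its functionality,
  -- i.e. well-definedness of φ, is part of the theorem statement)
  Phi : (σ σ* : EdgeSet → DVec) → Orientation → EdgeSet → Set
  Phi σ σ* O S = Σ (Decomp σ σ* O) λ d → phiOf d ≡ S

  IsBijectionRel : (Orientation → Set) → (EdgeSet → Set) →
                   (Orientation → EdgeSet → Set) → Set
  IsBijectionRel A B R =
      (∀ O → A O → Σ EdgeSet λ S → R O S)
    × (∀ O S S' → A O → R O S → R O S' → S ≡ S')
    × (∀ O S → A O → R O S → B S)
    × (∀ O O' S → A O → A O' → R O S → R O' S → O ≡ O')
    × (∀ S → B S → Σ Orientation λ O → A O × R O S)

{-# OPTIONS --safe #-}

-- Directed cycles and cocycles are the signed circuits and cocircuits of a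
-- pair of dual oriented matroids: they are orthogonal, and by Minty's painting
-- property every arc lies either in a circuit or in a cocircuit using only
-- permitted arcs.  An integer vector orthogonal to all cocircuits is therefore
-- a conformal sum of circuits.  If a circuit C agrees with g(T₁) off T₁ and
-- -C agrees with g(T₂) off T₂, then C and -C are both sums of chosen
-- fundamental circuits, contradicting acyclicity; hence no such C exists.
-- By painting this yields T₁ = T₂ as soon as g(T₁) and g(T₂) agree on the
-- symmetric difference of T₁ and T₂.  Applied to the difference of the sets of
-- reversed cycles of two orientations with the same image, and dually, it shows
-- that φ is injective.  For two representations of the same orientation, a
-- circuit in that difference would occur in one compatible orientation and
-- reversed in the other, so φ is well defined.  Every compatible orientation is some g(T), by deletion and
-- contraction of one edge, and every orientation reaches a compatible one by
-- reversing badly directed circuits, a process that acyclicity forces to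
-- stop.  As orientations and edge sets are equinumerous, φ is bijective.
-- Finally φ(O) contains a cycle iff some cycle is reversed iff O is not
-- σ-compatible, and dually for cocycles and connectivity.

module Submission where

open import Defs
open import Data.Bool using (Bool; true; false; not; _∧_; _∨_; _xor_; if_then_else_)
import Data.Bool.Properties as Bool
open import Data.Empty using (⊥; ⊥-elim)
open import Data.Fin using (Fin; zero; suc; _≟_; combine)
import Data.Fin.Properties as Fin
open import Data.Integer as ℤ using (ℤ; -_; _+_; _*_; _≤_; _<_; 0ℤ; 1ℤ; -1ℤ)
import Data.Integer.Properties as ℤ
open import Data.List as L using (List; []; _∷_; _++_; foldr)
import Data.List.Properties as L
open import Data.List.Membership.DecPropositional using () renaming (_∈?_ to mem?)
open import Data.List.Membership.Propositional using (_∈_; _∉_)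
open import Data.List.Membership.Propositional.Properties using (∈-allFin; ∈-lookup; ∈-map⁺; ∈-map⁻)
open import Data.List.Relation.Binary.Permutation.Propositional as Perm using (_↭_; ↭-sym; ↭-trans; ↭-reflexive)
open import Data.List.Relation.Binary.Permutation.Propositional.Properties using (All-resp-↭; ↭-reverse; drop-∷; ++-comm)
open import Data.List.Relation.Unary.All as All using (All; []; _∷_)
import Data.List.Relation.Unary.All.Properties as All
open import Data.List.Relation.Unary.AllPairs as AllPairs using (AllPairs; []; _∷_)
import Data.List.Relation.Unary.AllPairs.Properties as AllPairs
open import Data.List.Relation.Unary.Any using (here; there)
import Data.List.Relation.Unary.Unique.DecPropositional as DecUnique
open import Data.List.Relation.Unary.Unique.Propositional using (Unique)
import Data.List.Relation.Unary.Unique.Propositional.Properties as Unique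
open import Data.Nat as ℕ using (ℕ; zero; suc)
import Data.Nat.Properties as ℕ
open import Data.Product using (Σ; ∃; _×_; _,_; proj₁; proj₂)
open import Data.Sum using (_⊎_; inj₁; inj₂)
open import Data.Unit using (⊤; tt)
open import Data.Vec using (Vec; []; _∷_; lookup; tabulate; zipWith; replicate; map; _[_]≔_)
import Data.Vec.Properties as Vec
open import Data.Vec.Properties using (lookup-zipWith; lookup-map; lookup-replicate; lookup∘tabulate; tabulate∘lookup; tabulate-cong; zipWith-assoc)
open import Relation.Binary.PropositionalEquality
open import Relation.Nullary using (¬_; Dec; yes; no)
open import Relation.Nullary.Decidable using (⌊_⌋; _×-dec_; _⊎-dec_; map′; ¬?)

-- The induction on the number of elements runs over abstract pairs `Dual A B`, so that minors of
-- graphs need no treatment of their own and every statement yields its dual through `swap`.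
-- `Signed` and `Dual` ask neither for minimal supports nor for an elimination axiom. This matters
-- when an element is deleted: the traces of cocircuits on the remaining elements may have
-- non-minimal support (delete one edge of a triangle: the two remaining edges, each now a bridge,
-- are together still the trace of a cocycle), yet orthogonality and painting pass to all these
-- traces directly. Families of disjoint circuits are not compared as lists, because φ depends only
-- on their unions. A union `P` of disjoint directed circuits of `K` is encoded by the vector
-- `on K P`; the difference of two such vectors is again orthogonal to all cocircuits, and painting
-- extracts circuits from it. Acyclicity speaks of lists, so each contradiction exhibits a nonempty
-- list of chosen circuits with sum zero.

-- Signs, integer vectors and their inner product.

sg : Bool → ℤ
sg true  = 1ℤ
sg false = -1ℤ

sg-inj : ∀ {a b} → sg a ≡ sg b → a ≡ b
sg-inj {true}  {true}  _ = refl
sg-inj {false} {false} _ = refl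

sg≢0 : ∀ {b} → sg b ≢ 0ℤ
sg≢0 {true}  ()
sg≢0 {false} ()

-sg : ∀ b → - sg b ≡ sg (not b)
-sg true  = refl
-sg false = refl

sg*sg : ∀ b → sg b * sg b ≡ 1ℤ
sg*sg true  = refl
sg*sg false = refl

data Trit : ℤ → Set where
  nil : Trit 0ℤ
  sgn : ∀ b → Trit (sg b)

≢⇒not : ∀ {a b : Bool} → a ≢ b → a ≡ not b
≢⇒not {a} {b} = Bool.¬-not

not⇒≢ : ∀ {a b : Bool} → a ≡ not b → a ≢ b
not⇒≢ p q = Bool.not-¬ q p

sgn-of : ∀ z → z ≢ 0ℤ → Σ Bool λ b → 0ℤ < sg b * z
sgn-of (ℤ.+ zero)     z≢0 = ⊥-elim (z≢0 refl)
sgn-of (ℤ.+[1+ n ]) _   = true , subst (0ℤ <_) (sym (ℤ.*-identityˡ ℤ.+[1+ n ])) (ℤ.+<+ (ℕ.s≤s ℕ.z≤n))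
sgn-of (ℤ.-[1+ n ]) _   = false , subst (0ℤ <_) (sym (ℤ.-1*i≡-i ℤ.-[1+ n ])) (ℤ.+<+ (ℕ.s≤s ℕ.z≤n))

≮-flip : ∀ c z → ¬ (0ℤ < sg (not c) * z) → 0ℤ ≤ z * sg c
≮-flip c z p = subst (0ℤ ≤_) eq (ℤ.neg-mono-≤ (ℤ.≮⇒≥ p))
  where
  eq : - (sg (not c) * z) ≡ z * sg c
  eq = trans (ℤ.neg-distribˡ-* (sg (not c)) z)
         (trans (cong (_* z) (trans (-sg (not c)) (cong sg (Bool.not-involutive c)))) (ℤ.*-comm (sg c) z))

+-nonneg-zero : ∀ {a b} → 0ℤ ≤ a → 0ℤ ≤ b → a + b ≡ 0ℤ → a ≡ 0ℤ × b ≡ 0ℤ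
+-nonneg-zero {ℤ.+ zero} {ℤ.+ m} _ _ eq = refl , eq
+-nonneg-zero {ℤ.+ suc n} {ℤ.+ m} _ _ ()

module _ {a} {X : Set a} where
  ext : ∀ {n} {x y : Vec X n} → (∀ e → lookup x e ≡ lookup y e) → x ≡ y
  ext {x = x} {y} p = trans (sym (tabulate∘lookup x)) (trans (tabulate-cong p) (tabulate∘lookup y))

module _ {n : ℕ} where
  infixl 6 _⊕_
  _⊕_ : Vec ℤ n → Vec ℤ n → Vec ℤ n
  _⊕_ = zipWith _+_

  neg : Vec ℤ n → Vec ℤ n
  neg = map -_

  zeros : Vec ℤ n
  zeros = replicate n 0ℤ

  Σv : List (Vec ℤ n) → Vec ℤ n
  Σv = foldr _⊕_ zeros

  ⊕-at : ∀ x y e → lookup (x ⊕ y) e ≡ lookup x e + lookup y e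
  ⊕-at x y e = lookup-zipWith _+_ e x y

  neg-at : ∀ x e → lookup (neg x) e ≡ - lookup x e
  neg-at x e = lookup-map e -_ x

  zeros-at : ∀ e → lookup zeros e ≡ 0ℤ
  zeros-at e = lookup-replicate e 0ℤ

  neg-neg : ∀ x → neg (neg x) ≡ x
  neg-neg x = ext λ e → trans (neg-at (neg x) e) (trans (cong -_ (neg-at x e)) (ℤ.neg-involutive _))

  ⊕-assoc : ∀ x y z → (x ⊕ y) ⊕ z ≡ x ⊕ (y ⊕ z)
  ⊕-assoc x y z = ext λ e → trans (⊕-at (x ⊕ y) z e) (trans (cong (_+ lookup z e) (⊕-at x y e))
    (trans (ℤ.+-assoc (lookup x e) _ _) (sym (trans (⊕-at x (y ⊕ z) e) (cong (lookup x e +_) (⊕-at y z e))))))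

  ⊕-idˡ : ∀ x → zeros ⊕ x ≡ x
  ⊕-idˡ x = ext λ e → trans (⊕-at zeros x e) (trans (cong (_+ lookup x e) (zeros-at e)) (ℤ.+-identityˡ _))

  ⊕-idʳ : ∀ x → x ⊕ zeros ≡ x
  ⊕-idʳ x = ext λ e → trans (⊕-at x zeros e) (trans (cong (lookup x e +_) (zeros-at e)) (ℤ.+-identityʳ _))

  ⊕-inv : ∀ x → x ⊕ neg x ≡ zeros
  ⊕-inv x = ext λ e → trans (⊕-at x (neg x) e) (trans (cong (lookup x e +_) (neg-at x e))
    (trans (ℤ.+-inverseʳ (lookup x e)) (sym (zeros-at e))))

  ⊕-cancel : ∀ x y → x ⊕ (y ⊕ neg x) ≡ y
  ⊕-cancel x y = ext λ e → trans (⊕-at x (y ⊕ neg x) e)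
    (trans (cong (lookup x e +_) (trans (⊕-at y (neg x) e) (cong (lookup y e +_) (neg-at x e)))) (lem (lookup x e) (lookup y e)))
    where
    lem : ∀ a b → a + (b + - a) ≡ b
    lem a b = trans (cong (a +_) (ℤ.+-comm b (- a))) (trans (sym (ℤ.+-assoc a (- a) b))
      (trans (cong (_+ b) (ℤ.+-inverseʳ a)) (ℤ.+-identityˡ b)))

  Σv-++ : ∀ xs ys → Σv (xs ++ ys) ≡ Σv xs ⊕ Σv ys
  Σv-++ []       ys = sym (⊕-idˡ (Σv ys))
  Σv-++ (x ∷ xs) ys = trans (cong (x ⊕_) (Σv-++ xs ys)) (sym (⊕-assoc x (Σv xs) (Σv ys)))

dot : ∀ {n} → Vec ℤ n → Vec ℤ n → ℤ
dot []       []       = 0ℤ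
dot (x ∷ xs) (y ∷ ys) = x * y + dot xs ys

dot-comm : ∀ {n} (x y : Vec ℤ n) → dot x y ≡ dot y x
dot-comm []       []       = refl
dot-comm (x ∷ xs) (y ∷ ys) = cong₂ _+_ (ℤ.*-comm x y) (dot-comm xs ys)

+-interchange : ∀ a b c d → (a + b) + (c + d) ≡ (a + c) + (b + d)
+-interchange a b c d = trans (ℤ.+-assoc a b (c + d)) (trans (cong (a +_) (trans (sym (ℤ.+-assoc b c d))
  (trans (cong (_+ d) (ℤ.+-comm b c)) (ℤ.+-assoc c b d)))) (sym (ℤ.+-assoc a c (b + d))))

dot-⊕ : ∀ {n} (x y z : Vec ℤ n) → dot (x ⊕ y) z ≡ dot x z + dot y z
dot-⊕ []       []       []       = refl
dot-⊕ (x ∷ xs) (y ∷ ys) (z ∷ zs) =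
  trans (cong₂ _+_ (ℤ.*-distribʳ-+ z x y) (dot-⊕ xs ys zs)) (+-interchange (x * z) (y * z) _ _)

dot-neg : ∀ {n} (x z : Vec ℤ n) → dot (neg x) z ≡ - dot x z
dot-neg []       []       = refl
dot-neg (x ∷ xs) (z ∷ zs) =
  trans (cong₂ _+_ (sym (ℤ.neg-distribˡ-* x z)) (dot-neg xs zs)) (sym (ℤ.neg-distrib-+ (x * z) _))

dot-zeros : ∀ {n} (z : Vec ℤ n) → dot zeros z ≡ 0ℤ
dot-zeros []       = refl
dot-zeros (z ∷ zs) = trans (cong₂ _+_ (ℤ.*-zeroˡ z) (dot-zeros zs)) refl

dot-nonneg : ∀ {n} (x y : Vec ℤ n) → (∀ e → 0ℤ ≤ lookup x e * lookup y e) → 0ℤ ≤ dot x y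
dot-nonneg []       []       _ = ℤ.≤-refl
dot-nonneg (x ∷ xs) (y ∷ ys) p = ℤ.+-mono-≤ (p zero) (dot-nonneg xs ys (λ e → p (suc e)))

dot-nonneg-zero : ∀ {n} (x y : Vec ℤ n) → (∀ e → 0ℤ ≤ lookup x e * lookup y e) →
  dot x y ≡ 0ℤ → ∀ e → lookup x e * lookup y e ≡ 0ℤ
dot-nonneg-zero (x ∷ xs) (y ∷ ys) p eq e
  with +-nonneg-zero (p zero) (dot-nonneg xs ys (λ e → p (suc e))) eq
dot-nonneg-zero (x ∷ xs) (y ∷ ys) p eq zero    | a , _ = a
dot-nonneg-zero (x ∷ xs) (y ∷ ys) p eq (suc e) | _ , b = dot-nonneg-zero xs ys (λ e → p (suc e)) b e

-- Signed vectors in an orientation, and dual pairs with their bases.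

Arc : ∀ {n} → Vec ℤ n → Fin n → Bool → Set
Arc x e b = lookup x e ≡ sg b

InO : ∀ {n} → Vec Bool n → Vec ℤ n → Set
InO O x = ∀ e b → Arc x e b → lookup O e ≡ b

module _ {n : ℕ} where
  Arc-neg : ∀ (x : Vec ℤ n) e b → Arc x e b → Arc (neg x) e (not b)
  Arc-neg x e b p = trans (neg-at x e) (trans (cong -_ p) (-sg b))

  Arc-neg⁻ : ∀ (x : Vec ℤ n) e b → Arc (neg x) e b → Arc x e (not b)
  Arc-neg⁻ x e b p = subst (λ y → Arc y e (not b)) (neg-neg x) (Arc-neg (neg x) e b p)

  AllTrit : Vec ℤ n → Set
  AllTrit x = ∀ e → Trit (lookup x e)

  neg-trit : ∀ x → AllTrit x → AllTrit (neg x)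
  neg-trit x t e = subst Trit (sym (neg-at x e)) (lem (t e))
    where
    lem : ∀ {z} → Trit z → Trit (- z)
    lem nil     = nil
    lem (sgn b) = subst Trit (sym (-sg b)) (sgn (not b))

  noArc⇒0 : ∀ (x : Vec ℤ n) e → Trit (lookup x e) → (∀ b → ¬ Arc x e b) → lookup x e ≡ 0ℤ
  noArc⇒0 x e t na with lookup x e
  noArc⇒0 x e nil     na | _ = refl
  noArc⇒0 x e (sgn b) na | _ = ⊥-elim (na b refl)

  *-nonneg-arc : ∀ (x y : Vec ℤ n) → AllTrit y →
    (∀ f c → Arc y f c → 0ℤ ≤ lookup x f * sg c) → ∀ f → 0ℤ ≤ lookup x f * lookup y f
  *-nonneg-arc x y t h f with lookup y f in eq | t f
  ... | _ | nil   = ℤ.≤-reflexive (sym (ℤ.*-zeroʳ (lookup x f)))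
  ... | _ | sgn c = h f c eq

  -- Inside one orientation the two vectors have equal signs wherever both are nonzero, so every
  -- term of `dot x y` is nonnegative. A zero sum leaves no common arc.
  conformal-disjoint : ∀ {O x y} → AllTrit x → AllTrit y → InO O x → InO O y → dot x y ≡ 0ℤ →
    ∀ {e b c} → Arc x e b → Arc y e c → ⊥
  conformal-disjoint {O} {x} {y} tx ty ix iy d {e} {b} {c} ax ay =
    contra (trans (sym (cong₂ _*_ ax (trans ay (cong sg (trans (sym (iy e c ay)) (ix e b ax))))))
      (dot-nonneg-zero x y (*-nonneg-arc x y ty nn) d e))
    where
    contra : sg b * sg b ≡ 0ℤ → ⊥
    contra p with trans (sym (sg*sg b)) p
    ... | ()
    nn : ∀ f c → Arc y f c → 0ℤ ≤ lookup x f * sg c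
    nn f c a with lookup x f in eq | tx f
    ... | _ | nil    = ℤ.≤-reflexive (sym (ℤ.*-zeroˡ (sg c)))
    ... | _ | sgn b' with trans (sym (ix f b' eq)) (iy f c a)
    ... | refl = subst (0ℤ ≤_) (sym (sg*sg c)) (ℤ.+≤+ ℕ.z≤n)

-- A set of directed circuits together with an acyclic signature; Pos
-- singles out the chosen directions.
record Signed (n : ℕ) : Set₁ where
  field
    Cir Pos : Vec ℤ n → Set
    cir?    : ∀ x → Dec (Cir x)
    trit    : ∀ {x} → Cir x → AllTrit x
    nonzero : ∀ {x} → Cir x → Σ (Fin n) λ e → Σ Bool λ b → Arc x e b
    neg-cir : ∀ {x} → Cir x → Cir (neg x)
    pos-cir : ∀ {x} → Pos x → Cir x
    total   : ∀ {x} → Cir x → Pos x ⊎ Pos (neg x)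
    acyclic : ∀ {xs} → All Pos xs → Σv xs ≡ zeros → xs ≡ []

  pos-neg : ∀ {x} → Pos x → ¬ Pos (neg x)
  pos-neg {x} p q with acyclic {x ∷ neg x ∷ []} (p ∷ q ∷ [])
                         (trans (cong (x ⊕_) (⊕-idʳ (neg x))) (⊕-inv x))
  ... | ()

  Compat : Vec Bool n → Set
  Compat O = ∀ x → Cir x → InO O x → Pos x

open Signed

-- Circuits and cocircuits of an oriented matroid, with Minty's
-- painting property as the only link besides orthogonality.
record Dual {n} (A B : Signed n) : Set where
  field
    orth  : ∀ {x y} → Cir A x → Cir B y → dot x y ≡ 0ℤ
    paint : ∀ (ok : Fin n → Bool → Bool) e b →
      (Σ (Vec ℤ n) λ x → Cir A x × Arc x e b × (∀ f c → f ≢ e → Arc x f c → ok f c ≡ true)) ⊎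
      (Σ (Vec ℤ n) λ y → Cir B y × Arc y e b × (∀ f c → f ≢ e → Arc y f c → ok f (not c) ≡ false))

open Dual

-- Painting is self-dual: the colouring `not (ok f (not c))` exchanges permitted arcs with reversed
-- forbidden ones, and the two alternatives trade places.
swap : ∀ {n} {A B : Signed n} → Dual A B → Dual B A
swap M .orth {x} {y} cx cy = trans (dot-comm x y) (orth M cy cx)
swap M .paint ok e b with paint M (λ f c → not (ok f (not c))) e b
... | inj₁ (x , cx , a , h) = inj₂ (x , cx , a , λ f c ne af → Bool.not-injective (h f c ne af))
... | inj₂ (y , cy , a , h) = inj₁ (y , cy , a , λ f c ne af →
        trans (cong (ok f) (sym (Bool.not-involutive c))) (Bool.not-injective (h f c ne af)))

⌊⌋-true : ∀ {p} {P : Set p} (d : Dec P) → ⌊ d ⌋ ≡ true → P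
⌊⌋-true (yes p) _ = p

⌊⌋-false : ∀ {p} {P : Set p} (d : Dec P) → ⌊ d ⌋ ≡ false → ¬ P
⌊⌋-false (no p) _ = p

-- A spanning set or basis T is described by its indicator vector and
-- the value v taken on it, so that complementation under duality is
-- the replacement of v by not v.
module _ {n : ℕ} where
  Indep : Signed n → Vec Bool n → Bool → Set
  Indep A T v = ∀ x → Cir A x → ¬ (∀ e b → Arc x e b → lookup T e ≡ v)

  Fund : Vec Bool n → Bool → Fin n → Vec ℤ n → Set
  Fund T v e x = ∀ f c → f ≢ e → Arc x f c → lookup T f ≡ v

  Outer : Signed n → Vec Bool n → Bool → Vec Bool n → Set
  Outer A T v O = ∀ e x b → lookup T e ≡ not v → Pos A x → Fund T v e x → Arc x e b → lookup O e ≡ b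

-- With `v = true`, `indepA` says that `T` contains no circuit and `indepB` that its complement
-- contains no cocircuit, that is, `T` is spanning. The two `Outer` fields say that `O` is the
-- orientation g(T).
record Tree {n} (A B : Signed n) (v : Bool) (T O : Vec Bool n) : Set where
  constructor tree
  field
    indepA : Indep A T v
    indepB : Indep B T (not v)
    outerA : Outer A T v O
    outerB : Outer B T (not v) O

open Tree

swapTree : ∀ {n} {A B : Signed n} {v T O} → Tree A B v T O → Tree B A (not v) T O
swapTree {v = true}  t = tree (indepB t) (indepA t) (outerB t) (outerA t)
swapTree {v = false} t = tree (indepB t) (indepA t) (outerB t) (outerA t)

-- Flows, fundamental circuits and uniqueness of trees.

-- For cocycles these are the integer circulations of the graph; for cycles, its integer tensions.
Flow : ∀ {n} → Signed n → Vec ℤ n → Set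
Flow B p = ∀ y → Cir B y → dot p y ≡ 0ℤ

module _ {n : ℕ} {B : Signed n} where
  flow-⊕ : ∀ {p q} → Flow B p → Flow B q → Flow B (p ⊕ q)
  flow-⊕ {p} {q} fp fq y cy = trans (dot-⊕ p q y) (cong₂ _+_ (fp y cy) (fq y cy))

  flow-neg : ∀ {p} → Flow B p → Flow B (neg p)
  flow-neg {p} fp y cy = trans (dot-neg p y) (cong -_ (fp y cy))

  flow-zeros : Flow B zeros
  flow-zeros y _ = dot-zeros y

module _ {n : ℕ} {A B : Signed n} (M : Dual A B) where
  cir-flow : ∀ {x} → Cir A x → Flow B x
  cir-flow cx y cy = orth M cx cy

  -- Paint with the arcs along which `p` is positive. The alternative is a cocircuit through `e`
  -- whose products with `p` are all nonnegative and positive at `e`, which orthogonality excludes.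
  conformal-circuit : ∀ p → Flow B p → ∀ e → lookup p e ≢ 0ℤ →
    Σ (Vec ℤ n) λ x → Cir A x × (Σ Bool λ b → Arc x e b) × (∀ f c → Arc x f c → 0ℤ < sg c * lookup p f)
  conformal-circuit p fp e ne with sgn-of (lookup p e) ne
  ... | b , pos with paint M (λ f c → ⌊ 0ℤ ℤ.<? sg c * lookup p f ⌋) e b
  ... | inj₁ (x , cx , a , h) = x , cx , (b , a) , ok
    where
    ok : ∀ f c → Arc x f c → 0ℤ < sg c * lookup p f
    ok f c af with f ≟ e
    ... | no f≢e = ⌊⌋-true (0ℤ ℤ.<? _) (h f c f≢e af)
    ... | yes refl = subst (λ s → 0ℤ < s * lookup p e) (trans (sym a) af) pos
  ... | inj₂ (y , cy , a , h) = ⊥-elim (ℤ.<-irrefl (sym zero-at) pos)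
    where
    nn : ∀ f c → Arc y f c → 0ℤ ≤ lookup p f * sg c
    nn f c af with f ≟ e
    ... | no f≢e = ≮-flip c (lookup p f) (⌊⌋-false (0ℤ ℤ.<? _) (h f c f≢e af))
    ... | yes refl = ℤ.<⇒≤ (subst (0ℤ <_) (trans (ℤ.*-comm (sg b) _) (cong (lookup p e *_) (trans (sym a) af))) pos)
    zero-at : sg b * lookup p e ≡ 0ℤ
    zero-at = trans (trans (ℤ.*-comm (sg b) _) (cong (lookup p e *_) (sym a)))
      (dot-nonneg-zero p y (*-nonneg-arc p y (trit B cy) nn) (fp y cy) e)

  flow-zero : ∀ p → Flow B p → (∀ x → Cir A x → (∀ f c → Arc x f c → 0ℤ < sg c * lookup p f) → ⊥) →
    ∀ e → lookup p e ≡ 0ℤ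
  flow-zero p fp h e with lookup p e ℤ.≟ 0ℤ
  ... | yes z = z
  ... | no nz with conformal-circuit p fp e nz
  ... | x , cx , _ , cf = ⊥-elim (h x cx cf)

  -- A circuit conformal to `p` would lie inside `T`.
  flow-zero-off : ∀ T v p → Indep A T v → Flow B p →
    (∀ e → lookup T e ≡ not v → lookup p e ≡ 0ℤ) → ∀ e → lookup p e ≡ 0ℤ
  flow-zero-off T v p ind fp off = flow-zero p fp λ x cx cf → ind x cx λ f c af → inT f c (cf f c af)
    where
    inT : ∀ f c → 0ℤ < sg c * lookup p f → lookup T f ≡ v
    inT f c lt with lookup T f Bool.≟ v
    ... | yes q = q
    ... | no q = ⊥-elim (ℤ.<-irrefl (sym (trans (cong (sg c *_) (off f (≢⇒not q))) (ℤ.*-zeroʳ (sg c)))) lt)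

  -- Paint with the elements of `T` permitted. The cocircuit alternative would avoid `T` entirely,
  -- against the independence of the complement in `B`.
  fundamental : ∀ T v → Indep B T (not v) → ∀ e → lookup T e ≡ not v →
    Σ (Vec ℤ n) λ x → Σ Bool λ b → Pos A x × Arc x e b × Fund T v e x
  fundamental T v ind e eT with paint M (λ f _ → ⌊ lookup T f Bool.≟ v ⌋) e true
  ... | inj₂ (y , cy , a , h) = ⊥-elim (ind y cy out)
    where
    out : ∀ f c → Arc y f c → lookup T f ≡ not v
    out f c af with f ≟ e
    ... | yes refl = eT
    ... | no f≢e = ≢⇒not (⌊⌋-false (lookup T f Bool.≟ v) (h f c f≢e af))
  ... | inj₁ (x , cx , a , h) = orient (total A cx)
    where
    fx : Fund T v e x
    fx f c f≢e af = ⌊⌋-true (lookup T f Bool.≟ v) (h f c f≢e af)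
    orient : Pos A x ⊎ Pos A (neg x) → Σ (Vec ℤ n) λ x → Σ Bool λ b → Pos A x × Arc x e b × Fund T v e x
    orient (inj₁ px) = x , true , px , a , fx
    orient (inj₂ px) = neg x , false , px , Arc-neg x e true a , λ f c f≢e af → fx f (not c) f≢e (Arc-neg⁻ x f c af)

  -- With opposite signs at `e`, `x ⊕ y` would vanish off `T`, hence everywhere, and two chosen
  -- circuits would sum to zero.
  fund-sign-unique : ∀ {T v e x y b c} → Indep A T v → Pos A x → Pos A y → Fund T v e x → Fund T v e y →
    Arc x e b → Arc y e c → b ≡ c
  fund-sign-unique {T} {v} {e} {x} {y} {b} {c} ind px py fx fy ax ay with b Bool.≟ c
  ... | yes q = q
  ... | no q with acyclic A {x ∷ y ∷ []} (px ∷ py ∷ [])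
                    (trans (cong (x ⊕_) (⊕-idʳ y)) (ext λ f → trans (sum0 f) (sym (zeros-at f))))
    where
    off0 : ∀ z f → Pos A z → Fund T v e z → lookup T f ≡ not v → f ≢ e → lookup z f ≡ 0ℤ
    off0 z f pz fz nT f≢e = noArc⇒0 z f (trit A (pos-cir A pz) f) λ b af → not⇒≢ nT (fz f b f≢e af)
    off : ∀ f → lookup T f ≡ not v → lookup (x ⊕ y) f ≡ 0ℤ
    off f nT with f ≟ e
    ... | no f≢e = trans (⊕-at x y f) (cong₂ _+_ (off0 x f px fx nT f≢e) (off0 y f py fy nT f≢e))
    ... | yes refl = trans (⊕-at x y f) (trans (cong₂ _+_ (trans ax (trans (cong sg (≢⇒not q)) (sym (-sg c)))) ay) (ℤ.+-inverseˡ (sg c)))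
    sum0 : ∀ f → lookup (x ⊕ y) f ≡ 0ℤ
    sum0 = flow-zero-off T v (x ⊕ y) ind (flow-⊕ {B = B} {x} {y} (cir-flow (pos-cir A px)) (cir-flow (pos-cir A py))) off
  ... | ()

  -- For each element off `T` where `p` is nonzero, subtract its chosen fundamental circuit. By
  -- `Outer` its sign there is that of `O`, which is that of `p`, so the entry is cleared by a
  -- subtraction with coefficient +1, and the other entries off `T` do not change. What remains
  -- vanishes off `T`, hence is zero.
  expand : ∀ T v O → Indep A T v → Indep B T (not v) → Outer A T v O → ∀ p → Flow B p →
    (∀ e → lookup T e ≡ not v → lookup p e ≡ 0ℤ ⊎ Arc p e (lookup O e)) →
    Σ (List (Vec ℤ n)) λ xs → All (Pos A) xs × Σv xs ≡ p
  expand T v O iA iB out p fp off = go (L.allFin n) p fp (λ e _ ne → ⊥-elim (ne (∈-allFin e))) off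
    where
    -- `es` holds the elements still to be treated; off `T` and outside `es`, `p` is already zero.
    go : ∀ es p → Flow B p → (∀ e → lookup T e ≡ not v → e ∉ es → lookup p e ≡ 0ℤ) →
      (∀ e → lookup T e ≡ not v → lookup p e ≡ 0ℤ ⊎ Arc p e (lookup O e)) →
      Σ (List (Vec ℤ n)) λ xs → All (Pos A) xs × Σv xs ≡ p
    go [] p fp van off = [] , [] ,
      ext λ e → trans (zeros-at e) (sym (flow-zero-off T v p iA fp (λ e nT → van e nT (λ ())) e))
    go (e ∷ es) p fp van off with lookup T e Bool.≟ v
    ... | yes q = go es p fp (λ f nT f∉ → van f nT λ { (here refl) → not⇒≢ nT q ; (there f∈) → f∉ f∈ }) off
    ... | no q with off e (≢⇒not q)
    ... | inj₁ z = go es p fp van' off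
      where
      van' : ∀ f → lookup T f ≡ not v → f ∉ es → lookup p f ≡ 0ℤ
      van' f nT f∉ with f ≟ e
      ... | yes refl = z
      ... | no f≢e = van f nT λ { (here r) → f≢e r ; (there f∈) → f∉ f∈ }
    ... | inj₂ pe with fundamental T v iB e (≢⇒not q)
    ... | x , b , px , ax , fx = step (go es p' fp' van' off')
      where
      p' = p ⊕ neg x
      fp' : Flow B p'
      fp' = flow-⊕ {B = B} {p} {neg x} fp (flow-neg {B = B} {x} (cir-flow (pos-cir A px)))
      p'-at : ∀ f → lookup p' f ≡ lookup p f + - lookup x f
      p'-at f = trans (⊕-at p (neg x) f) (cong (lookup p f +_) (neg-at x f))
      at-e : lookup p' e ≡ 0ℤ
      at-e = trans (p'-at e) (trans (cong₂ (λ a c → a + - c) pe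
               (trans ax (cong sg (sym (out e x b (≢⇒not q) px fx ax))))) (ℤ.+-inverseʳ (sg (lookup O e))))
      at-f : ∀ f → lookup T f ≡ not v → f ≢ e → lookup p' f ≡ lookup p f
      at-f f nT f≢e = trans (p'-at f) (trans (cong (λ a → lookup p f + - a)
        (noArc⇒0 x f (trit A (pos-cir A px) f) λ c af → not⇒≢ nT (fx f c f≢e af))) (ℤ.+-identityʳ _))
      van' : ∀ f → lookup T f ≡ not v → f ∉ es → lookup p' f ≡ 0ℤ
      van' f nT f∉ with f ≟ e
      ... | yes refl = at-e
      ... | no f≢e = trans (at-f f nT f≢e) (van f nT λ { (here r) → f≢e r ; (there f∈) → f∉ f∈ })
      off' : ∀ f → lookup T f ≡ not v → lookup p' f ≡ 0ℤ ⊎ Arc p' f (lookup O f)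
      off' f nT with f ≟ e
      ... | yes refl = inj₁ at-e
      ... | no f≢e rewrite at-f f nT f≢e = off f nT
      step : (Σ (List (Vec ℤ n)) λ xs → All (Pos A) xs × Σv xs ≡ p') → Σ (List (Vec ℤ n)) λ xs → All (Pos A) xs × Σv xs ≡ p
      step (xs , pxs , sm) = x ∷ xs , px ∷ pxs , trans (cong (x ⊕_) sm) (⊕-cancel x p)

  expand-circuit : ∀ T v O → Indep A T v → Indep B T (not v) → Outer A T v O → ∀ {x} → Cir A x →
    (∀ e b → lookup T e ≡ not v → Arc x e b → lookup O e ≡ b) →
    Σ (List (Vec ℤ n)) λ xs → All (Pos A) xs × Σv xs ≡ x
  expand-circuit T v O iA iB out {x} cx h = expand T v O iA iB out x (cir-flow cx) off
    where
    off : ∀ e → lookup T e ≡ not v → lookup x e ≡ 0ℤ ⊎ Arc x e (lookup O e)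
    off e nT with lookup x e in eq | trit A cx e
    ... | _ | nil   = inj₁ refl
    ... | _ | sgn b = inj₂ (cong sg (sym (h e b nT eq)))

  cir≢0 : ∀ {x} → Cir A x → x ≢ zeros
  cir≢0 cx refl with nonzero A cx
  ... | e , b , a = sg≢0 {b} (trans (sym a) (zeros-at e))

  no-separating-circuit : ∀ {v T₁ O₁ T₂ O₂} → Tree A B v T₁ O₁ → Tree A B v T₂ O₂ → ∀ {x} → Cir A x →
    (∀ e b → lookup T₁ e ≡ not v → Arc x e b → lookup O₁ e ≡ b) →
    (∀ e b → lookup T₂ e ≡ not v → Arc x e b → lookup O₂ e ≡ not b) → ⊥
  no-separating-circuit {v} {T₁} {O₁} {T₂} {O₂} t₁ t₂ {x} cx h₁ h₂
    with expand-circuit T₁ v O₁ (indepA t₁) (indepB t₁) (outerA t₁) cx h₁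
       | expand-circuit T₂ v O₂ (indepA t₂) (indepB t₂) (outerA t₂) (neg-cir A cx)
           (λ e b nT a → trans (h₂ e (not b) nT (Arc-neg⁻ x e b a)) (Bool.not-involutive b))
  ... | xs , pxs , sx | ys , pys , sy
    with L.++-conicalˡ xs ys (acyclic A (All.++⁺ pxs pys) (trans (Σv-++ xs ys) (trans (cong₂ _⊕_ sx sy) (⊕-inv x))))
  ... | refl = cir≢0 cx (sym sx)

  -- If a circuit `x` in `O` had `neg x` chosen, then `neg x` together with the expansion of `x`
  -- into chosen fundamental circuits would sum to zero.
  tree-compat : ∀ {v T O} → Tree A B v T O → Compat A O
  tree-compat {v} {T} {O} t x cx inO with total A cx
  ... | inj₁ px = px
  ... | inj₂ nx with expand-circuit T v O (indepA t) (indepB t) (outerA t) cx (λ e b _ a → inO e b a)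
  ... | xs , pxs , sx with acyclic A {neg x ∷ xs} (nx ∷ pxs)
          (trans (cong (neg x ⊕_) sx) (trans (cong (neg x ⊕_) (sym (neg-neg x))) (⊕-inv (neg x))))
  ... | ()

module _ {n : ℕ} {A B : Signed n} (M : Dual A B) where
  private
    -- An arc is permitted when it follows `O₁` unless it is in `T₁`, and opposes `O₂` unless it is
    -- in `T₂`. A permitted circuit through `e` is a separating circuit. In the other case no arc of
    -- the negated cocircuit off `e` is permitted, and since `O₁` and `O₂` agree where the trees
    -- differ, this makes it separating for the dual trees.
    no-exchange : ∀ {v T₁ O₁ T₂ O₂} → Tree A B v T₁ O₁ → Tree A B v T₂ O₂ →
      (∀ e → lookup T₁ e ≢ lookup T₂ e → lookup O₁ e ≡ lookup O₂ e) →
      ∀ e → lookup T₁ e ≡ not v → lookup T₂ e ≡ v → ⊥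
    no-exchange {v} {T₁} {O₁} {T₂} {O₂} t₁ t₂ same e e∉T₁ e∈T₂ = result (paint M (λ f c → ⌊ ok? f c ⌋) e (lookup O₁ e))
      where
      Ok : Fin n → Bool → Set
      Ok f c = (lookup T₁ f ≡ v ⊎ lookup O₁ f ≡ c) × (lookup T₂ f ≡ v ⊎ lookup O₂ f ≡ not c)
      ok? : ∀ f c → Dec (Ok f c)
      ok? f c = ((lookup T₁ f Bool.≟ v) ⊎-dec (lookup O₁ f Bool.≟ c))
          ×-dec ((lookup T₂ f Bool.≟ v) ⊎-dec (lookup O₂ f Bool.≟ not c))
      second : ∀ {p q} {P : Set p} {Q : Set q} → ¬ P → P ⊎ Q → Q
      second np (inj₁ p) = ⊥-elim (np p)
      second np (inj₂ q) = q
      result : _ → ⊥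
      result (inj₁ (x , cx , ax , h)) = no-separating-circuit M t₁ t₂ cx h₁ h₂
        where
        h₁ : ∀ f c → lookup T₁ f ≡ not v → Arc x f c → lookup O₁ f ≡ c
        h₁ f c nT a with f ≟ e
        ... | yes refl = sg-inj (trans (sym ax) a)
        ... | no f≢e = second (not⇒≢ nT) (proj₁ (⌊⌋-true (ok? f c) (h f c f≢e a)))
        h₂ : ∀ f c → lookup T₂ f ≡ not v → Arc x f c → lookup O₂ f ≡ not c
        h₂ f c nT a with f ≟ e
        ... | yes refl = ⊥-elim (not⇒≢ nT e∈T₂)
        ... | no f≢e = second (not⇒≢ nT) (proj₂ (⌊⌋-true (ok? f c) (h f c f≢e a)))
      result (inj₂ (y , cy , ay , h)) =
        no-separating-circuit (swap M) (swapTree t₁) (swapTree t₂) (neg-cir B cy) g₁ g₂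
        where
        h' : ∀ f c → f ≢ e → Arc (neg y) f c → ¬ Ok f c
        h' f c f≢e a = subst (λ d → ¬ Ok f d) (Bool.not-involutive c)
          (⌊⌋-false (ok? f (not (not c))) (h f (not c) f≢e (Arc-neg⁻ y f c a)))
        -- An element of `T₁` can fail the test only through its second half: it lies off `T₂`, with
        -- direction `c` in `O₂`. So the trees differ there, and `same` carries the direction over
        -- to `O₁`.
        g₁ : ∀ f c → lookup T₁ f ≡ not (not v) → Arc (neg y) f c → lookup O₁ f ≡ c
        g₁ f c nn a with f ≟ e
        ... | yes refl = ⊥-elim (not⇒≢ nn e∉T₁)
        ... | no f≢e with lookup T₂ f Bool.≟ v | lookup O₂ f Bool.≟ c
        ... | yes p | _     = ⊥-elim (h' f c f≢e a (inj₁ (trans nn (Bool.not-involutive v)) , inj₁ p))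
        ... | no p  | yes q = trans (same f λ r → p (trans (sym r) (trans nn (Bool.not-involutive v)))) q
        ... | no p  | no q  = ⊥-elim (h' f c f≢e a (inj₁ (trans nn (Bool.not-involutive v)) , inj₂ (≢⇒not q)))
        g₂ : ∀ f c → lookup T₂ f ≡ not (not v) → Arc (neg y) f c → lookup O₂ f ≡ not c
        g₂ f c nn a with f ≟ e
        ... | yes refl = trans (sym (same e λ r → not⇒≢ e∉T₁ (trans r e∈T₂))) (sg-inj (trans (sym ay) (Arc-neg⁻ y e c a)))
        ... | no f≢e with lookup T₁ f Bool.≟ v | lookup O₁ f Bool.≟ c
        ... | yes p | _     = ⊥-elim (h' f c f≢e a (inj₁ p , inj₁ (trans nn (Bool.not-involutive v))))
        ... | no p  | yes q = ⊥-elim (h' f c f≢e a (inj₂ q , inj₁ (trans nn (Bool.not-involutive v))))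
        ... | no p  | no q  = trans (sym (same f λ r → p (trans r (trans nn (Bool.not-involutive v))))) (≢⇒not q)

  tree-unique : ∀ {v T₁ O₁ T₂ O₂} → Tree A B v T₁ O₁ → Tree A B v T₂ O₂ →
    (∀ e → lookup T₁ e ≢ lookup T₂ e → lookup O₁ e ≡ lookup O₂ e) → T₁ ≡ T₂
  tree-unique {v} {T₁} {O₁} {T₂} {O₂} t₁ t₂ same = ext at
    where
    at : ∀ e → lookup T₁ e ≡ lookup T₂ e
    at e with lookup T₁ e Bool.≟ v | lookup T₂ e Bool.≟ v
    ... | yes p | yes q = trans p (sym q)
    ... | no p  | no q  = trans (≢⇒not p) (sym (≢⇒not q))
    ... | no p  | yes q = ⊥-elim (no-exchange t₁ t₂ same e (≢⇒not p) q)
    ... | yes p | no q  = ⊥-elim (no-exchange t₂ t₁ (λ f ne → sym (same f λ r → ne (sym r))) e (≢⇒not q) p)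

  private
    indep-not : ∀ {v} {A : Signed n} {T} → Indep A T v → Indep A T (not (not v))
    indep-not {v} ind x cx h = ind x cx λ e b a → trans (h e b a) (Bool.not-involutive v)

  -- Each direction is read off one fundamental circuit found by painting, of `A` off `T` and of `B`
  -- on `T`; `fund-sign-unique` extends the agreement to all others.
  orient-tree : ∀ T v → Indep A T v → Indep B T (not v) → Σ (Vec Bool n) (Tree A B v T)
  orient-tree T v iA iB = tabulate dir , tree iA iB outA outB
    where
    iA' = indep-not {A = A} {T} iA
    dir : Fin n → Bool
    dir e with lookup T e Bool.≟ v
    ... | no q  = proj₁ (proj₂ (fundamental M T v iB e (≢⇒not q)))
    ... | yes q = proj₁ (proj₂ (fundamental (swap M) T (not v) iA' e (trans q (sym (Bool.not-involutive v)))))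
    dirA : ∀ e x b → lookup T e ≡ not v → Pos A x → Fund T v e x → Arc x e b → dir e ≡ b
    dirA e x b nT px fx ax with lookup T e Bool.≟ v
    ... | yes q = ⊥-elim (not⇒≢ nT q)
    ... | no q with fundamental M T v iB e (≢⇒not q)
    ... | y , c , py , ay , fy = fund-sign-unique M {T} {v} iA py px fy fx ay ax
    dirB : ∀ e x b → lookup T e ≡ not (not v) → Pos B x → Fund T (not v) e x → Arc x e b → dir e ≡ b
    dirB e x b nT px fx ax with lookup T e Bool.≟ v
    ... | no q = ⊥-elim (q (trans nT (Bool.not-involutive v)))
    ... | yes q with fundamental (swap M) T (not v) iA' e (trans q (sym (Bool.not-involutive v)))
    ... | y , c , py , ay , fy = fund-sign-unique (swap M) {T} {not v} iB py px fy fx ay ax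
    outA : Outer A T v (tabulate dir)
    outA e x b nT px fx ax = trans (lookup∘tabulate dir e) (dirA e x b nT px fx ax)
    outB : Outer B T (not v) (tabulate dir)
    outB e x b nT px fx ax = trans (lookup∘tabulate dir e) (dirB e x b nT px fx ax)

-- Exhaustive search, and vectors carried by part of an orientation.

search : ∀ {n} {P : Vec Bool n → Set} → (∀ X → Dec (P X)) → Dec (∃ P)
search {zero} {P} d with d []
... | yes p = yes ([] , p)
... | no np = no λ { ([] , p) → np p }
search {suc n} {P} d with search (λ X → d (true ∷ X)) | search (λ X → d (false ∷ X))
... | yes (X , p) | _           = yes (true ∷ X , p)
... | no _        | yes (X , p) = yes (false ∷ X , p)
... | no p        | no q        = no λ { (true ∷ X , r) → p (X , r) ; (false ∷ X , r) → q (X , r) }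

module _ {n : ℕ} where
  -- The arcs of `O` on the set `P` as a signed vector. Disjoint unions turn into sums, so a family
  -- of disjoint circuits can be handled as one flow.
  on : Vec Bool n → Vec Bool n → Vec ℤ n
  on O P = zipWith (λ o a → if a then sg o else 0ℤ) O P

  supp : Vec ℤ n → Vec Bool n
  supp x = map (λ z → not ⌊ z ℤ.≟ 0ℤ ⌋) x

  on-at : ∀ O P e → lookup (on O P) e ≡ (if lookup P e then sg (lookup O e) else 0ℤ)
  on-at O P e = lookup-zipWith (λ o a → if a then sg o else 0ℤ) e O P

  on-in : ∀ O P e → lookup P e ≡ true → Arc (on O P) e (lookup O e)
  on-in O P e p = trans (on-at O P e) (cong (λ a → if a then sg (lookup O e) else 0ℤ) p)

  on-out : ∀ O P e → lookup P e ≡ false → lookup (on O P) e ≡ 0ℤ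
  on-out O P e p = trans (on-at O P e) (cong (λ a → if a then sg (lookup O e) else 0ℤ) p)

  on-trit : ∀ O P → AllTrit (on O P)
  on-trit O P e rewrite on-at O P e with lookup P e
  ... | true  = sgn (lookup O e)
  ... | false = nil

  on-arc : ∀ O P e b → Arc (on O P) e b → lookup P e ≡ true × lookup O e ≡ b
  on-arc O P e b a with lookup P e in eq
  ... | true  = refl , sg-inj (trans (sym (on-in O P e eq)) a)
  ... | false = ⊥-elim (sg≢0 {b} (trans (sym a) (on-out O P e eq)))

  on-InO : ∀ O P → InO O (on O P)
  on-InO O P e b a = proj₂ (on-arc O P e b a)

  supp-arc : ∀ x e b → Arc x e b → lookup (supp x) e ≡ true
  supp-arc x e b a = trans (lookup-map e _ x) (trans (cong (λ z → not ⌊ z ℤ.≟ 0ℤ ⌋) a) (lem b))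
    where
    lem : ∀ b → not ⌊ sg b ℤ.≟ 0ℤ ⌋ ≡ true
    lem true  = refl
    lem false = refl

  supp-0 : ∀ x e → lookup x e ≡ 0ℤ → lookup (supp x) e ≡ false
  supp-0 x e p = trans (lookup-map e _ x) (cong (λ z → not ⌊ z ℤ.≟ 0ℤ ⌋) p)

  supp-arc⁻ : ∀ x → AllTrit x → ∀ e → lookup (supp x) e ≡ true → Σ Bool λ b → Arc x e b
  supp-arc⁻ x t e p with lookup x e in eq | t e
  ... | _ | sgn b = b , refl
  ... | _ | nil with trans (sym p) (supp-0 x e eq)
  ... | ()

  supp-0⁻ : ∀ x → AllTrit x → ∀ e → lookup (supp x) e ≡ false → lookup x e ≡ 0ℤ
  supp-0⁻ x t e p = noArc⇒0 x e (t e) λ b a → Bool.not-¬ (supp-arc x e b a) p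

  on-supp : ∀ O x → AllTrit x → InO O x → on O (supp x) ≡ x
  on-supp O x t i = ext λ e → at e
    where
    at : ∀ e → lookup (on O (supp x)) e ≡ lookup x e
    at e with lookup (supp x) e in eq
    ... | false = trans (on-out O (supp x) e eq) (sym (supp-0⁻ x t e eq))
    ... | true with supp-arc⁻ x t e eq
    ... | b , a = trans (on-in O (supp x) e eq) (trans (cong sg (i e b a)) (sym a))

pos? : ∀ {n} (A : Signed n) {x} → Cir A x → Dec (Pos A (neg x))
pos? A cx with total A cx
... | inj₁ p = no (pos-neg A p)
... | inj₂ q = yes q

-- A signed vector lying in `O` is `on O X` for its support `X`, so a search over subsets meets
-- every circuit of `O`.
compat? : ∀ {n} (A : Signed n) O → Compat A O ⊎ Σ (Vec ℤ n) λ x → Cir A x × InO O x × Pos A (neg x)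
compat? A O with search bad?
  where
  bad? : ∀ X → Dec (Σ (Cir A (on O X)) λ _ → Pos A (neg (on O X)))
  bad? X with cir? A (on O X)
  ... | no nc = no λ (c , _) → nc c
  ... | yes c with pos? A c
  ... | yes p = yes (c , p)
  ... | no np = no λ (_ , p) → np p
... | yes (X , c , p) = inj₂ (on O X , c , on-InO O X , p)
... | no none = inj₁ compat
  where
  compat : Compat A O
  compat x cx i with total A cx
  ... | inj₁ p = p
  ... | inj₂ q = ⊥-elim (none (supp x , subst (λ y → Σ (Cir A y) λ _ → Pos A (neg y)) (sym (on-supp O x (trit A cx) i)) (cx , q)))

-- Removing one element, and the existence of trees.

module _ {n : ℕ} where
  -- Deletion of the element `zero`, seen on circuits; on the dual side this is contraction.
  restr : Signed (suc n) → Signed n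
  restr A .Cir x = Cir A (0ℤ ∷ x)
  restr A .Pos x = Pos A (0ℤ ∷ x)
  restr A .cir? x = cir? A (0ℤ ∷ x)
  restr A .trit c e = trit A c (suc e)
  restr A .nonzero c with nonzero A c
  ... | zero  , b , a = ⊥-elim (sg≢0 {b} (sym a))
  ... | suc e , b , a = e , b , a
  restr A .neg-cir = neg-cir A
  restr A .pos-cir = pos-cir A
  restr A .total = total A
  restr A .acyclic {xs} ps eq = map-[] (acyclic A (All.map⁺ ps) (trans (Σ0 xs) (cong (0ℤ ∷_) eq)))
    where
    Σ0 : ∀ xs → Σv (L.map (0ℤ ∷_) xs) ≡ 0ℤ ∷ Σv xs
    Σ0 []       = refl
    Σ0 (x ∷ xs) = cong ((0ℤ ∷ x) ⊕_) (Σ0 xs)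
    map-[] : ∀ {xs : List (Vec ℤ n)} → L.map (0ℤ ∷_) xs ≡ [] → xs ≡ []
    map-[] {[]} _ = refl

  NonZ : Vec ℤ n → Set
  NonZ x = Σ (Fin n) λ e → Σ Bool λ b → Arc x e b

  nonZ? : ∀ x → Dec (NonZ x)
  nonZ? x = map′ (λ { (e , inj₁ a) → e , true , a ; (e , inj₂ a) → e , false , a })
                 (λ { (e , true , a) → e , inj₁ a ; (e , false , a) → e , inj₂ a })
                 (Fin.any? λ e → (lookup x e ℤ.≟ 1ℤ) ⊎-dec (lookup x e ℤ.≟ -1ℤ))

  nonZ-neg : ∀ {x} → NonZ x → NonZ (neg x)
  nonZ-neg {x} (e , b , a) = e , not b , Arc-neg x e b a

  module _ {A B : Signed (suc n)} (M : Dual A B) {w} (cw : Cir A w) {b} (aw : Arc w zero b) where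
    -- Distinct cocircuits through a nonloop have distinct projections,
    -- which is what makes the projected signature acyclic.
    private
      zero-head : ∀ z → dot w (z ∷ zeros) ≡ 0ℤ → z ≡ 0ℤ
      zero-head z eq = lem w aw eq
        where
        lem : ∀ w → Arc w zero b → dot w (z ∷ zeros) ≡ 0ℤ → z ≡ 0ℤ
        lem (c ∷ cs) refl eq = unsg b (trans (sym (ℤ.+-identityʳ (sg b * z)))
          (trans (cong (sg b * z +_) (sym (trans (dot-comm cs zeros) (dot-zeros cs)))) eq))
          where
          unsg : ∀ b → sg b * z ≡ 0ℤ → z ≡ 0ℤ
          unsg true  p = trans (sym (ℤ.*-identityˡ z)) p
          unsg false p = trans (sym (ℤ.neg-involutive z)) (cong -_ (trans (sym (ℤ.-1*i≡-i z)) p))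

    -- The cocircuits of the deletion, as traces of cocircuits of the whole. Every trace is kept, of
    -- minimal support or not.
    proj : Signed n
    proj .Cir y = (Σ ℤ λ z → Cir B (z ∷ y)) × NonZ y
    proj .Pos y = (Σ ℤ λ z → Pos B (z ∷ y)) × NonZ y
    proj .cir? y = head? ×-dec nonZ? y
      where
      head? : Dec (Σ ℤ λ z → Cir B (z ∷ y))
      head? with cir? B (0ℤ ∷ y) | cir? B (1ℤ ∷ y) | cir? B (-1ℤ ∷ y)
      ... | yes c | _     | _     = yes (_ , c)
      ... | no _  | yes c | _     = yes (_ , c)
      ... | no _  | no _  | yes c = yes (_ , c)
      ... | no n₀ | no n₁ | no n₂ = no λ (z , c) → none z c (trit B c zero)
        where
        none : ∀ z → Cir B (z ∷ y) → Trit z → ⊥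
        none _ c nil         = n₀ c
        none _ c (sgn true)  = n₁ c
        none _ c (sgn false) = n₂ c
    proj .trit ((_ , c) , _) e = trit B c (suc e)
    proj .nonzero (_ , nz) = nz
    proj .neg-cir {y} ((_ , c) , nz) = (_ , neg-cir B c) , nonZ-neg {y} nz
    proj .pos-cir ((_ , p) , nz) = (_ , pos-cir B p) , nz
    proj .total {y} ((_ , c) , nz) with total B c
    ... | inj₁ p = inj₁ ((_ , p) , nz)
    ... | inj₂ p = inj₂ ((_ , p) , nonZ-neg {y} nz)
    proj .acyclic {xs} ps eq with lift xs ps
      where
      lift : ∀ xs → All (proj .Pos) xs → Σ (List (Vec ℤ (suc n))) λ ys → All (Pos B) ys × (Σ ℤ λ z → Σv ys ≡ z ∷ Σv xs) × (ys ≡ [] → xs ≡ [])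
      lift [] [] = [] , [] , (0ℤ , refl) , λ _ → refl
      lift (x ∷ xs) (((z , p) , _) ∷ ps) with lift xs ps
      ... | ys , qs , (s , sm) , _ = (z ∷ x) ∷ ys , p ∷ qs , (z + s , cong ((z ∷ x) ⊕_) sm) , λ ()
    -- The lifted cocircuits sum to `s ∷ zeros`. This is orthogonal to `w`, which is nonzero at
    -- `zero`, so `s` is zero and acyclicity of `B` applies.
    ... | ys , qs , (s , sm) , conv = conv (acyclic B qs
            (trans sm (cong₂ _∷_ (zero-head s (trans (cong (dot w) (sym (trans sm (cong (s ∷_) eq)))) (dotΣ ys qs))) eq)))
      where
      dotΣ : ∀ ys → All (Pos B) ys → dot w (Σv ys) ≡ 0ℤ
      dotΣ ys qs = trans (dot-comm w (Σv ys)) (go ys qs)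
        where
        go : ∀ ys → All (Pos B) ys → dot (Σv ys) w ≡ 0ℤ
        go [] [] = dot-zeros w
        go (y ∷ ys) (q ∷ qs) = trans (dot-⊕ y (Σv ys) w) (cong₂ _+_ (orth (swap M) (pos-cir B q) cw) (go ys qs))

    delete : Dual (restr A) proj
    delete .orth {x} {y} cx ((z , cy) , _) = trans (sym (ℤ.+-identityˡ (dot x y)))
      (trans (cong (_+ dot x y) (sym (ℤ.*-zeroˡ z))) (orth M cx cy))
    delete .paint ok e c with paint M ok' (suc e) c
      where
      ok' : Fin (suc n) → Bool → Bool
      -- Both directions of `zero` are forbidden: a circuit must avoid it, while a cocircuit may use
      -- it freely.
      ok' zero    _ = false
      ok' (suc f) d = ok f d
    ... | inj₂ (z ∷ y , cy , a , h) = inj₂ (y , ((z , cy) , (e , c , a)) , a , λ f d f≢e → h (suc f) d λ { refl → f≢e refl })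
    ... | inj₁ (z ∷ x , cx , a , h) = inj₁ (x , subst (λ s → Cir A (s ∷ x)) z≡0 cx , a , λ f d f≢e → h (suc f) d λ { refl → f≢e refl })
      where
      z≡0 : z ≡ 0ℤ
      z≡0 = noArc⇒0 (z ∷ x) zero (trit A cx zero) λ d a₀ → Bool.not-¬ (h zero d (λ ()) a₀) refl

    -- A tree of the deletion still spans: a cocircuit in the complement either has a trace there or
    -- is supported on `zero` alone, and the latter is not orthogonal to `w`. Chosen fundamental
    -- circuits and cocircuits of the deletion lift to the whole, so the new orientation agrees with
    -- `O` except possibly at `zero`.
    undelete : ∀ {v T O} → Tree (restr A) proj v T O → Σ Bool λ c → Tree A B v (not v ∷ T) (c ∷ O)
    undelete {v} {T} {O} t = finish (orient-tree M (not v ∷ T) v iA iB)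
      where
      iA : Indep A (not v ∷ T) v
      iA (z ∷ x) cx h = indepA t x (subst (λ s → Cir A (s ∷ x)) z≡0 cx) λ e c → h (suc e) c
        where
        z≡0 : z ≡ 0ℤ
        z≡0 = noArc⇒0 (z ∷ x) zero (trit A cx zero) λ d a₀ → Bool.not-¬ refl (sym (h zero d a₀))
      iB : Indep B (not v ∷ T) (not v)
      iB (z ∷ y) cy h with nonZ? y
      ... | yes nz = indepB t y ((z , cy) , nz) λ e c → h (suc e) c
      ... | no nn with ext {x = y} {zeros} (λ e → trans (noArc⇒0 y e (trit B cy (suc e)) λ c a → nn (e , c , a)) (sym (zeros-at e)))
      ... | refl = cir≢0 (swap M) cy (cong (_∷ zeros) (zero-head z (orth M cw cy)))
      finish : Σ (Vec Bool (suc n)) (Tree A B v (not v ∷ T)) → Σ Bool λ c → Tree A B v (not v ∷ T) (c ∷ O)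
      finish (c ∷ O' , t') = c , subst (λ o → Tree A B v (not v ∷ T) (c ∷ o)) (ext same) t'
        where
        same : ∀ e → lookup O' e ≡ lookup O e
        same e with lookup T e Bool.≟ v
        ... | no q with fundamental delete T v (indepB t) e (≢⇒not q)
        ... | x , d , px , ax , fx = trans
            (outerA t' (suc e) (0ℤ ∷ x) d (≢⇒not q) px
              (λ { zero d' _ a → ⊥-elim (sg≢0 {d'} (sym a)) ; (suc f) d' f≢e a → fx f d' (λ { refl → f≢e refl }) a }) ax)
            (sym (outerA t e x d (≢⇒not q) px fx ax))
        same e | yes q with fundamental (swap delete) T (not v)
            (λ x cx h → indepA t x cx λ f d a → trans (h f d a) (Bool.not-involutive v)) e (trans q (sym (Bool.not-involutive v)))
        ... | y , d , py@((z , py') , _) , ay , fy = trans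
            (outerB t' (suc e) (z ∷ y) d (trans q (sym (Bool.not-involutive v))) py'
              (λ { zero _ _ _ → refl ; (suc f) d' f≢e a → fy f d' (λ { refl → f≢e refl }) a }) ay)
            (sym (outerB t e y d (trans q (sym (Bool.not-involutive v))) py fy ay))

-- Quantified over `v` and all dual pairs so that the hypothesis can be used for a deletion and,
-- after `swap`, for a contraction.
HasTree : ℕ → Set₁
HasTree n = ∀ {A B : Signed n} → Dual A B → ∀ v O → Compat A O → Compat B O → Σ (Vec Bool n) λ T → Tree A B v T O

module _ {n : ℕ} (ih : HasTree n) where
  -- Deleting `zero` fails only for a reason that survives: a badly directed cocircuit passing
  -- through `zero` once the arc at `zero` is reversed.
  tree-or-obstruction : ∀ {A B : Signed (suc n)} → Dual A B → ∀ v o O → Compat A (o ∷ O) → Compat B (o ∷ O) →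
    (Σ (Vec Bool n) λ T → Σ Bool λ c → Tree A B v (not v ∷ T) (c ∷ O)) ⊎
    (Σ (Vec ℤ (suc n)) λ y → Cir B y × InO (not o ∷ O) y × Pos B (neg y) × Arc y zero (not o))
  tree-or-obstruction {A} {B} M v o O kA kB with paint M (λ _ _ → true) zero (not o)
  -- All arcs were permitted, so this cocircuit consists of `zero` alone. Its negative lies in
  -- `o ∷ O` and is chosen.
  ... | inj₂ (y , cy , ay , h) = inj₂ (y , cy , inO , kB (neg y) (neg-cir B cy) inO' , ay)
    where
    inO : InO (not o ∷ O) y
    inO zero    c a = sg-inj (trans (sym ay) a)
    inO (suc f) c a with h (suc f) c (λ ()) a
    ... | ()
    inO' : InO (o ∷ O) (neg y)
    inO' zero    c a = Bool.not-injective (sg-inj (trans (sym ay) (Arc-neg⁻ y zero c a)))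
    inO' (suc f) c a with h (suc f) (not c) (λ ()) (Arc-neg⁻ y (suc f) c a)
    ... | ()
  ... | inj₁ (w , cw , aw , _) with compat? (proj M cw aw) O
  ... | inj₁ kB' with ih (delete M cw aw) v O kA' kB'
    where
    kA' : Compat (restr A) O
    kA' x cx i = kA (0ℤ ∷ x) cx λ { zero c a → ⊥-elim (sg≢0 {c} (sym a)) ; (suc f) c a → i f c a }
  ... | T , t = inj₁ (T , undelete M cw aw t)
  tree-or-obstruction {A} {B} M v o O kA kB | inj₁ (w , cw , aw , _) | inj₂ (y , _ , i , ((z' , p) , _)) =
    inj₂ (- z' ∷ y , cy , inO , subst (Pos B) (sym eq) p , ay)
    where
    eq : neg (- z' ∷ y) ≡ z' ∷ neg y
    eq = cong (_∷ neg y) (ℤ.neg-involutive z')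
    cy : Cir B (- z' ∷ y)
    cy = subst (λ u → Cir B (- z' ∷ u)) (neg-neg y) (neg-cir B (pos-cir B p))
    -- The negative of this cocircuit is chosen, so compatibility keeps it out of `o ∷ O`. It
    -- follows `O` on the other elements, hence has direction `not o` at `zero`.
    not-in : ¬ InO (o ∷ O) (- z' ∷ y)
    not-in i' = pos-neg B (kB _ cy i') (subst (Pos B) (sym eq) p)
    ay : Arc (- z' ∷ y) zero (not o)
    ay = pick (trit B cy zero) λ h → not-in λ { zero c a → h c a ; (suc f) c a → i f c a }
      where
      pick : ∀ {z} → Trit z → ¬ (∀ c → z ≡ sg c → o ≡ c) → z ≡ sg (not o)
      pick nil     h = ⊥-elim (h λ c a → ⊥-elim (sg≢0 {c} (sym a)))
      pick (sgn d) h with d Bool.≟ o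
      ... | yes refl = ⊥-elim (h λ c a → sg-inj a)
      ... | no q     = cong sg (≢⇒not q)
    inO : InO (not o ∷ O) (- z' ∷ y)
    inO zero    c a = sg-inj (trans (sym ay) a)
    inO (suc f) c a = i f c a

  -- Two obstructions would be an orthogonal circuit and cocircuit sharing an arc of `not o ∷ O`. A
  -- tree giving the wrong direction makes `not o ∷ O` compatible, against an obstruction on the
  -- other side. Two trees both giving the wrong direction have the same orientation but differ at
  -- `zero`, against `tree-unique`. In every remaining case some tree gives `o`.
  tree-step : ∀ {A B : Signed (suc n)} → Dual A B → ∀ O → Compat A O → Compat B O → Σ (Vec Bool (suc n)) λ T → Tree A B true T O
  tree-step {A} {B} M (o ∷ O) kA kB
    with tree-or-obstruction M true o O kA kB | tree-or-obstruction (swap M) false o O kB kA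
  ... | inj₂ (y , cy , iy , _ , ay) | inj₂ (x , cx , ix , _ , ax) =
    ⊥-elim (conformal-disjoint {O = not o ∷ O} {x} {y} (trit A cx) (trit B cy) ix iy (orth M cx cy) ax ay)
  ... | inj₁ (T , c , t) | inj₂ (x , cx , ix , nx , _) with c Bool.≟ o
  ... | yes refl = _ , t
  ... | no q with ≢⇒not q
  ... | refl = ⊥-elim (pos-neg A (tree-compat M t x cx ix) nx)
  tree-step {A} {B} M (o ∷ O) kA kB | inj₂ (y , cy , iy , ny , _) | inj₁ (T , c , t) with c Bool.≟ o
  ... | yes refl = _ , swapTree t
  ... | no q with ≢⇒not q
  ... | refl = ⊥-elim (pos-neg B (tree-compat (swap M) t y cy iy) ny)
  tree-step {A} {B} M (o ∷ O) kA kB | inj₁ (T₁ , c₁ , t₁) | inj₁ (T₂ , c₂ , t₂) with c₁ Bool.≟ o | c₂ Bool.≟ o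
  ... | yes refl | _        = _ , t₁
  ... | no _     | yes refl = _ , swapTree t₂
  ... | no q₁    | no q₂ with ≢⇒not q₁ | ≢⇒not q₂
  ... | refl | refl with tree-unique M t₁ (swapTree t₂) (λ _ _ → refl)
  ... | ()

tree-exists : ∀ n → HasTree n
tree-exists zero {A} {B} M v [] kA kB = [] , tree (λ x cx _ → none A cx) (λ x cx _ → none B cx) (λ ()) (λ ())
  where
  none : ∀ (A : Signed 0) {x} → Cir A x → ⊥
  none A cx with nonzero A cx
  ... | () , _
tree-exists (suc n) M true  O kA kB = tree-step (tree-exists n) M O kA kB
tree-exists (suc n) M false O kA kB with tree-step (tree-exists n) (swap M) O kB kA
... | T , t = T , swapTree t

-- Comparing flows carried by two orientations.

positive-trit : ∀ c {z} → Trit z → 0ℤ < sg c * z → z ≡ sg c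
positive-trit true  nil         (ℤ.+<+ ())
positive-trit false nil         (ℤ.+<+ ())
positive-trit true  (sgn true)  _ = refl
positive-trit true  (sgn false) ()
positive-trit false (sgn true)  ()
positive-trit false (sgn false) _ = refl

entry : Bool → Bool → ℤ
entry k a = if a then sg k else 0ℤ

-- Entries have absolute value at most 1, so a nonzero difference takes the sign of its first entry
-- as soon as that entry is nonzero; the hypothesis excludes that only the second one is.
difference-sign : ∀ c a k b l → (a ≡ false → b ≡ false) → 0ℤ < sg c * (entry k a + - entry l b) → k ≡ c
difference-sign c     false k     true  l     h lt with h refl
... | ()
difference-sign true  false k     false l     h (ℤ.+<+ ())
difference-sign false false k     false l     h (ℤ.+<+ ())
difference-sign true  true  true  b     l     h lt = refl
difference-sign false true  false b     l     h lt = refl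
difference-sign true  true  false false l     h ()
difference-sign true  true  false true  true  h ()
difference-sign true  true  false true  false h (ℤ.+<+ ())
difference-sign false true  true  false l     h ()
difference-sign false true  true  true  true  h (ℤ.+<+ ())
difference-sign false true  true  true  false h ()

-- Equal entries cancel, so exactly one of the two is present. It gives the sign of the difference,
-- and the direction on the other side is opposite.
difference-signs : ∀ c a k b l → (a ≡ true → b ≡ false → l ≡ not k) → (b ≡ true → a ≡ false → k ≡ not l) →
  (a ≡ true → b ≡ true → k ≡ l) → 0ℤ < sg c * (entry k a + - entry l b) → k ≡ c × l ≡ not c
difference-signs true  false k     false l     _ _ _ (ℤ.+<+ ())
difference-signs false false k     false l     _ _ _ (ℤ.+<+ ())
difference-signs c     true  k     true  l     _ _ h lt with h refl refl
difference-signs true  true  true  true  true  _ _ h (ℤ.+<+ ()) | refl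
difference-signs true  true  false true  false _ _ h (ℤ.+<+ ()) | refl
difference-signs false true  true  true  true  _ _ h (ℤ.+<+ ()) | refl
difference-signs false true  false true  false _ _ h (ℤ.+<+ ()) | refl
difference-signs true  true  true  false l     h _ _ lt = refl , h refl refl
difference-signs false true  false false l     h _ _ lt = refl , h refl refl
difference-signs true  true  false false l     h _ _ ()
difference-signs false true  true  false l     h _ _ ()
difference-signs true  false k     true  true  _ _ _ ()
difference-signs true  false k     true  false _ h _ lt = h refl refl , refl
difference-signs false false k     true  true  _ h _ lt = h refl refl , refl
difference-signs false false k     true  false _ _ _ ()

sg-difference-flip : ∀ c u w → sg c * (u + - w) ≡ sg (not c) * (w + - u)
sg-difference-flip c u w = trans (sym (ℤ.neg-involutive _)) (trans (cong -_ (ℤ.neg-distribʳ-* (sg c) (u + - w)))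
  (trans (ℤ.neg-distribˡ-* (sg c) _) (cong₂ _*_ (-sg c)
    (trans (ℤ.neg-distrib-+ u (- w)) (trans (cong (- u +_) (ℤ.neg-involutive w)) (ℤ.+-comm (- u) w))))))

module _ {n : ℕ} where
  on-difference-at : ∀ (K₁ P₁ K₂ P₂ : Vec Bool n) e → lookup (on K₁ P₁ ⊕ neg (on K₂ P₂)) e ≡
    entry (lookup K₁ e) (lookup P₁ e) + - entry (lookup K₂ e) (lookup P₂ e)
  on-difference-at K₁ P₁ K₂ P₂ e = trans (⊕-at (on K₁ P₁) _ e)
    (cong₂ _+_ (on-at K₁ P₁ e) (trans (neg-at (on K₂ P₂) e) (cong -_ (on-at K₂ P₂ e))))

  record SameArcs (K₁ P₁ K₂ P₂ : Vec Bool n) : Set where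
    field
      same-set : ∀ e → lookup P₁ e ≡ lookup P₂ e
      same-dir : ∀ e → lookup P₁ e ≡ true → lookup K₁ e ≡ lookup K₂ e

  open SameArcs

  difference-zero⇒same : ∀ K₁ P₁ K₂ P₂ → (∀ e → lookup (on K₁ P₁ ⊕ neg (on K₂ P₂)) e ≡ 0ℤ) → SameArcs K₁ P₁ K₂ P₂
  difference-zero⇒same K₁ P₁ K₂ P₂ z = record { same-set = λ e → proj₁ (at e) ; same-dir = λ e → proj₂ (at e) }
    where
    entries : ∀ k a l b → entry k a + - entry l b ≡ 0ℤ → a ≡ b × (a ≡ true → k ≡ l)
    entries k     false l     false _ = refl , λ ()
    entries k     false true  true  ()
    entries k     false false true  ()
    entries true  true  l     false ()
    entries false true  l     false ()
    entries true  true  true  true  _ = refl , λ _ → refl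
    entries false true  false true  _ = refl , λ _ → refl
    entries true  true  false true  ()
    entries false true  true  true  ()
    at : ∀ e → lookup P₁ e ≡ lookup P₂ e × (lookup P₁ e ≡ true → lookup K₁ e ≡ lookup K₂ e)
    at e = entries (lookup K₁ e) (lookup P₁ e) (lookup K₂ e) (lookup P₂ e)
      (trans (sym (on-difference-at K₁ P₁ K₂ P₂ e)) (z e))

module _ {n : ℕ} {A B : Signed n} (M : Dual A B) where
  -- A circuit conformal to `p` through a common arc would lie in `O` together with `q`, and be
  -- orthogonal to it.
  flows-disjoint : ∀ O p q → Flow B p → Flow A q → AllTrit p → AllTrit q → InO O p → InO O q →
    ∀ {e b c} → Arc p e b → Arc q e c → ⊥
  flows-disjoint O p q fp fq tp tq ip iq {e} {b} {c} ap aq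
    with conformal-circuit M p fp e (λ z → sg≢0 {b} (trans (sym ap) z))
  ... | x , cx , (d , ax) , cf = conformal-disjoint {O = O} {x} {q} (trit A cx) tq
          (λ f c a → ip f c (positive-trit c (tp f) (cf f c a))) iq (trans (dot-comm x q) (fq x cx)) ax aq

  on-flows-disjoint : ∀ K P Q → Flow B (on K P) → Flow A (on K Q) → ∀ e → lookup P e ≡ true → lookup Q e ≡ false
  on-flows-disjoint K P Q fp fq e eP with lookup Q e in eQ
  ... | false = refl
  ... | true  = ⊥-elim (flows-disjoint K (on K P) (on K Q) fp fq (on-trit K P) (on-trit K Q) (on-InO K P) (on-InO K Q)
                  (on-in K P e eP) (on-in K Q e eQ))

  private
    difference-flow : ∀ K₁ P₁ K₂ P₂ → Flow B (on K₁ P₁) → Flow B (on K₂ P₂) → Flow B (on K₁ P₁ ⊕ neg (on K₂ P₂))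
    difference-flow K₁ P₁ K₂ P₂ f₁ f₂ = flow-⊕ {B = B} {on K₁ P₁} {neg (on K₂ P₂)} f₁ (flow-neg {B = B} {on K₂ P₂} f₂)

  -- Take a circuit conformal to the difference of the two flows. Off `T₁` it follows `K₁` and off
  -- `T₂` its reverse follows `K₂`, so it would be a separating circuit.
  flow-determined-off-tree : ∀ {v T₁ K₁ T₂ K₂} P₁ P₂ → Tree A B v T₁ K₁ → Tree A B v T₂ K₂ →
    Flow B (on K₁ P₁) → Flow B (on K₂ P₂) →
    (∀ e → lookup T₁ e ≡ not v → lookup P₁ e ≡ false → lookup P₂ e ≡ false) →
    (∀ e → lookup T₂ e ≡ not v → lookup P₂ e ≡ false → lookup P₁ e ≡ false) → SameArcs K₁ P₁ K₂ P₂
  flow-determined-off-tree {v} {T₁} {K₁} {T₂} {K₂} P₁ P₂ t₁ t₂ f₁ f₂ h₁₂ h₂₁ =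
    difference-zero⇒same K₁ P₁ K₂ P₂ (flow-zero M (on K₁ P₁ ⊕ neg (on K₂ P₂)) (difference-flow K₁ P₁ K₂ P₂ f₁ f₂) λ x cx cf →
      no-separating-circuit M t₁ t₂ cx
        (λ e b nT a → difference-sign b (lookup P₁ e) (lookup K₁ e) (lookup P₂ e) (lookup K₂ e) (h₁₂ e nT)
          (subst (λ z → 0ℤ < sg b * z) (on-difference-at K₁ P₁ K₂ P₂ e) (cf e b a)))
        (λ e b nT a → difference-sign (not b) (lookup P₂ e) (lookup K₂ e) (lookup P₁ e) (lookup K₁ e) (h₂₁ e nT)
          (subst (0ℤ <_) (trans (cong (sg b *_) (on-difference-at K₁ P₁ K₂ P₂ e))
            (sg-difference-flip b (entry (lookup K₁ e) (lookup P₁ e)) (entry (lookup K₂ e) (lookup P₂ e)))) (cf e b a))))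

  -- The three hypotheses are what two reversals leading to one orientation satisfy: opposite
  -- directions where only one of them reverses, equal ones where both do.
  flow-determined-by-reversal : ∀ K₁ P₁ K₂ P₂ → Compat A K₁ → Compat A K₂ → Flow B (on K₁ P₁) → Flow B (on K₂ P₂) →
    (∀ e → lookup P₁ e ≡ true → lookup P₂ e ≡ false → lookup K₂ e ≡ not (lookup K₁ e)) →
    (∀ e → lookup P₂ e ≡ true → lookup P₁ e ≡ false → lookup K₁ e ≡ not (lookup K₂ e)) →
    (∀ e → lookup P₁ e ≡ true → lookup P₂ e ≡ true → lookup K₁ e ≡ lookup K₂ e) → SameArcs K₁ P₁ K₂ P₂
  flow-determined-by-reversal K₁ P₁ K₂ P₂ k₁ k₂ f₁ f₂ h₁₂ h₂₁ h =
    difference-zero⇒same K₁ P₁ K₂ P₂ (flow-zero M (on K₁ P₁ ⊕ neg (on K₂ P₂)) (difference-flow K₁ P₁ K₂ P₂ f₁ f₂) no-circuit)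
    where
    no-circuit : ∀ x → Cir A x → (∀ e b → Arc x e b → 0ℤ < sg b * lookup (on K₁ P₁ ⊕ neg (on K₂ P₂)) e) → ⊥
    no-circuit x cx cf = pos-neg A
        (k₁ x cx (λ e b a → proj₁ (signs e b a)))
        (k₂ (neg x) (neg-cir A cx) (λ e b a → trans (proj₂ (signs e (not b) (Arc-neg⁻ x e b a))) (Bool.not-involutive b)))
      where
      signs : ∀ e b → Arc x e b → lookup K₁ e ≡ b × lookup K₂ e ≡ not b
      signs e b a = difference-signs b (lookup P₁ e) (lookup K₁ e) (lookup P₂ e) (lookup K₂ e) (h₁₂ e) (h₂₁ e) (h e)
        (subst (λ z → 0ℤ < sg b * z) (on-difference-at K₁ P₁ K₂ P₂ e) (cf e b a))

  tree-orientation-unique : ∀ {v T O₁ O₂} → Tree A B v T O₁ → Tree A B v T O₂ → O₁ ≡ O₂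
  tree-orientation-unique {v} {T} {O₁} {O₂} t₁ t₂ = ext at
    where
    at : ∀ e → lookup O₁ e ≡ lookup O₂ e
    at e with lookup T e Bool.≟ v
    ... | no q with fundamental M T v (indepB t₁) e (≢⇒not q)
    ... | x , b , px , ax , fx = trans (outerA t₁ e x b (≢⇒not q) px fx ax) (sym (outerA t₂ e x b (≢⇒not q) px fx ax))
    at e | yes q with trans q (sym (Bool.not-involutive v))
    ... | q' with fundamental (swap M) T (not v) (λ x cx h → indepA t₁ x cx λ f d a → trans (h f d a) (Bool.not-involutive v)) e q'
    ... | x , b , px , ax , fx = trans (outerB t₁ e x b q' px fx ax) (sym (outerB t₂ e x b q' px fx ax))

-- Representations of an orientation: injectivity and well-definedness of φ.

rev : ∀ {n} → Vec Bool n → Vec Bool n → Vec Bool n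
rev P O = zipWith _xor_ P O

_∪_ _∖_ : ∀ {n} → Vec Bool n → Vec Bool n → Vec Bool n
X ∪ Y = zipWith _∨_ X Y
X ∖ Y = zipWith (λ a b → a ∧ not b) X Y

-- `Decomp` up to the choice of the lists: `P` and `Q` are the unions, and being a disjoint union of
-- directed circuits becomes being a flow. Compatibility of `K` follows from `isTree`, and
-- disjointness of `P` and `Q` from orthogonality.
record Config {n} (A B : Signed n) (O : Vec Bool n) : Set where
  field
    {K T}   : Vec Bool n
    P Q     : Vec Bool n
    isTree  : Tree A B true T K
    flowP   : Flow B (on K P)
    flowQ   : Flow A (on K Q)
    reverse : O ≡ rev (P ∪ Q) K

  image : Vec Bool n
  image = (T ∪ P) ∖ Q

  O-at : ∀ e → lookup O e ≡ (lookup P e ∨ lookup Q e) xor lookup K e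
  O-at e = trans (cong (λ X → lookup X e) reverse)
    (trans (lookup-zipWith _xor_ e (P ∪ Q) K) (cong (_xor lookup K e) (lookup-zipWith _∨_ e P Q)))

  image-at : ∀ e → lookup image e ≡ (lookup T e ∨ lookup P e) ∧ not (lookup Q e)
  image-at e = trans (lookup-zipWith _ e (T ∪ P) Q) (cong (_∧ not (lookup Q e)) (lookup-zipWith _∨_ e T P))

module _ {n : ℕ} {A B : Signed n} (M : Dual A B) where
  open Config
  open SameArcs

  config-disjoint : ∀ {O} (c : Config A B O) e → lookup (P c) e ≡ true → lookup (Q c) e ≡ false
  config-disjoint c = on-flows-disjoint M (K c) (P c) (Q c) (flowP c) (flowQ c)

  config-reversed-P : ∀ {O} (c : Config A B O) e → lookup (P c) e ≡ true → lookup O e ≡ not (lookup (K c) e)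
  config-reversed-P c e p = trans (O-at c e) (cong (λ a → (a ∨ lookup (Q c) e) xor lookup (K c) e) p)

  config-reversed-Q : ∀ {O} (c : Config A B O) e → lookup (Q c) e ≡ true → lookup O e ≡ not (lookup (K c) e)
  config-reversed-Q c e q = trans (O-at c e) (cong (_xor lookup (K c) e) (trans (cong (lookup (P c) e ∨_) q) (Bool.∨-zeroʳ _)))

  config-kept : ∀ {O} (c : Config A B O) e → lookup (P c) e ≡ false → lookup (Q c) e ≡ false → lookup O e ≡ lookup (K c) e
  config-kept c e p q = trans (O-at c e) (cong₂ (λ a b → (a ∨ b) xor lookup (K c) e) p q)

  -- An element outside `T₁` and `P₁` is outside the image. It cannot lie in `P₂`, since `P₂` avoids
  -- `Q₂` and is contained in the image. An element of `T₁` outside `Q₁` is in the image, hence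
  -- outside `Q₂`. These are the hypotheses of `flow-determined-off-tree` and of its dual.
  config-injective : ∀ {O₁ O₂} (c₁ : Config A B O₁) (c₂ : Config A B O₂) → image c₁ ≡ image c₂ → O₁ ≡ O₂
  config-injective {O₁} {O₂} c₁ c₂ eq = finish (tree-unique M (isTree c₁) (isTree c₂) same)
    where
    im : ∀ e → (lookup (T c₁) e ∨ lookup (P c₁) e) ∧ not (lookup (Q c₁) e) ≡ (lookup (T c₂) e ∨ lookup (P c₂) e) ∧ not (lookup (Q c₂) e)
    im e = trans (sym (image-at c₁ e)) (trans (cong (λ X → lookup X e) eq) (image-at c₂ e))
    outside : ∀ t₁ p₁ q₁ t₂ p₂ q₂ → (t₁ ∨ p₁) ∧ not q₁ ≡ (t₂ ∨ p₂) ∧ not q₂ → (p₂ ≡ true → q₂ ≡ false) →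
      t₁ ≡ false → p₁ ≡ false → p₂ ≡ false
    outside _ _ _ t₂ false q₂ _ _ refl refl = refl
    outside _ _ _ t₂ true  q₂ e d refl refl with d refl
    outside _ _ _ true  true _ () d refl refl | refl
    outside _ _ _ false true _ () d refl refl | refl
    inside : ∀ t₁ p₁ q₁ t₂ p₂ q₂ → (t₁ ∨ p₁) ∧ not q₁ ≡ (t₂ ∨ p₂) ∧ not q₂ → t₁ ≡ true → q₁ ≡ false → q₂ ≡ false
    inside _ _ _ t₂ p₂ false _ refl refl = refl
    inside _ _ _ t₂ p₂ true  e refl refl with trans e (Bool.∧-zeroʳ (t₂ ∨ p₂))
    ... | ()
    sameP : SameArcs (K c₁) (P c₁) (K c₂) (P c₂)
    sameP = flow-determined-off-tree M (P c₁) (P c₂) (isTree c₁) (isTree c₂) (flowP c₁) (flowP c₂)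
      (λ e → outside _ _ _ _ _ _ (im e) (config-disjoint c₂ e))
      (λ e → outside _ _ _ _ _ _ (sym (im e)) (config-disjoint c₁ e))
    sameQ : SameArcs (K c₁) (Q c₁) (K c₂) (Q c₂)
    sameQ = flow-determined-off-tree (swap M) (Q c₁) (Q c₂) (swapTree (isTree c₁)) (swapTree (isTree c₂)) (flowQ c₁) (flowQ c₂)
      (λ e → inside (lookup (T c₁) e) (lookup (P c₁) e) _ (lookup (T c₂) e) (lookup (P c₂) e) _ (im e))
      (λ e → inside (lookup (T c₂) e) (lookup (P c₂) e) _ (lookup (T c₁) e) (lookup (P c₁) e) _ (sym (im e)))
    -- Equal images allow the trees to differ only on `P` or `Q`, where the directions are already
    -- known to agree.
    same : ∀ e → lookup (T c₁) e ≢ lookup (T c₂) e → lookup (K c₁) e ≡ lookup (K c₂) e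
    same e ne with lookup (P c₁) e in p₁ | lookup (Q c₁) e in q₁
    ... | true  | _     = same-dir sameP e p₁
    ... | false | true  = same-dir sameQ e q₁
    ... | false | false = ⊥-elim (ne (trans (sym (simp _ _ _ p₁ q₁)) (trans (im e)
                            (simp _ _ _ (trans (sym (same-set sameP e)) p₁) (trans (sym (same-set sameQ e)) q₁)))))
      where
      simp : ∀ t p q → p ≡ false → q ≡ false → (t ∨ p) ∧ not q ≡ t
      simp t _ _ refl refl = trans (Bool.∧-identityʳ _) (Bool.∨-identityʳ t)
    sameO : K c₁ ≡ K c₂ → O₁ ≡ O₂
    sameO k = trans (reverse c₁) (trans (cong₂ rev (cong₂ _∪_ (ext (same-set sameP)) (ext (same-set sameQ))) k) (sym (reverse c₂)))
    finish : T c₁ ≡ T c₂ → O₁ ≡ O₂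
    finish t = sameO (tree-orientation-unique M (subst (λ X → Tree A B true X (K c₁)) t (isTree c₁)) (isTree c₂))

  config-functional : ∀ {O} (c₁ c₂ : Config A B O) → image c₁ ≡ image c₂
  config-functional {O} c₁ c₂ = cong₂ _∖_ (cong₂ _∪_ (tree-unique M (isTree c₁) (isTree c₂) λ e _ → sameK e) (ext (same-set sameP)))
                                  (ext (same-set sameQ))
    where
    -- After the reversal both kinds of arcs lie in the common orientation O.
    reversed-InO : ∀ K P → (∀ e → lookup P e ≡ true → lookup O e ≡ not (lookup K e)) → InO O (neg (on K P))
    reversed-InO K P r e b a with on-arc K P e (not b) (Arc-neg⁻ (on K P) e b a)
    ... | p , k = trans (r e p) (trans (cong not k) (Bool.not-involutive b))
    cross : ∀ (c c' : Config A B O) e → lookup (P c) e ≡ true → lookup (Q c') e ≡ true → ⊥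
    cross c c' e p q = flows-disjoint M O (neg (on (K c) (P c))) (neg (on (K c') (Q c')))
      (flow-neg {B = B} {on (K c) (P c)} (flowP c)) (flow-neg {B = A} {on (K c') (Q c')} (flowQ c'))
      (neg-trit (on (K c) (P c)) (on-trit (K c) (P c))) (neg-trit (on (K c') (Q c')) (on-trit (K c') (Q c')))
      (reversed-InO (K c) (P c) (config-reversed-P c)) (reversed-InO (K c') (Q c') (config-reversed-Q c'))
      (Arc-neg (on (K c) (P c)) e _ (on-in (K c) (P c) e p)) (Arc-neg (on (K c') (Q c')) e _ (on-in (K c') (Q c') e q))
    -- By `cross` the element is outside `Q c'` too, so `c'` keeps its direction while `c` reverses
    -- it.
    onlyP : ∀ (c c' : Config A B O) e → lookup (P c) e ≡ true → lookup (P c') e ≡ false → lookup (K c') e ≡ not (lookup (K c) e)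
    onlyP c c' e p p' = trans (sym (config-kept c' e p' (Bool.¬-not λ q → cross c c' e p q))) (config-reversed-P c e p)
    onlyQ : ∀ (c c' : Config A B O) e → lookup (Q c) e ≡ true → lookup (Q c') e ≡ false → lookup (K c') e ≡ not (lookup (K c) e)
    onlyQ c c' e q q' = trans (sym (config-kept c' e (Bool.¬-not λ p → cross c' c e p q) q')) (config-reversed-Q c e q)
    sameP : SameArcs (K c₁) (P c₁) (K c₂) (P c₂)
    sameP = flow-determined-by-reversal M (K c₁) (P c₁) (K c₂) (P c₂) (tree-compat M (isTree c₁)) (tree-compat M (isTree c₂))
      (flowP c₁) (flowP c₂) (onlyP c₁ c₂) (onlyP c₂ c₁)
      (λ e p q → Bool.not-injective (trans (sym (config-reversed-P c₁ e p)) (config-reversed-P c₂ e q)))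
    sameQ : SameArcs (K c₁) (Q c₁) (K c₂) (Q c₂)
    sameQ = flow-determined-by-reversal (swap M) (K c₁) (Q c₁) (K c₂) (Q c₂)
      (tree-compat (swap M) (swapTree (isTree c₁))) (tree-compat (swap M) (swapTree (isTree c₂)))
      (flowQ c₁) (flowQ c₂) (onlyQ c₁ c₂) (onlyQ c₂ c₁)
      (λ e p q → Bool.not-injective (trans (sym (config-reversed-Q c₁ e p)) (config-reversed-Q c₂ e q)))
    sameK : ∀ e → lookup (K c₁) e ≡ lookup (K c₂) e
    sameK e with lookup (P c₁) e in p | lookup (Q c₁) e in q
    ... | true  | _     = same-dir sameP e p
    ... | false | true  = same-dir sameQ e q
    ... | false | false = trans (sym (config-kept c₁ e p q))
                            (config-kept c₂ e (trans (sym (same-set sameP e)) p) (trans (sym (same-set sameQ e)) q))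

-- Counting Boolean vectors.

code : ∀ {n} → Vec Bool n → Fin (2 ℕ.^ n)
code []          = zero
code (false ∷ X) = combine {2} zero (code X)
code (true  ∷ X) = combine {2} (suc zero) (code X)

code-injective : ∀ {n} (X Y : Vec Bool n) → code X ≡ code Y → X ≡ Y
code-injective []          []          _ = refl
code-injective (false ∷ X) (false ∷ Y) p = cong (false ∷_) (code-injective X Y (Fin.combine-injectiveʳ {2} zero (code X) zero (code Y) p))
code-injective (true  ∷ X) (true  ∷ Y) p = cong (true ∷_) (code-injective X Y (Fin.combine-injectiveʳ {2} (suc zero) (code X) (suc zero) (code Y) p))
code-injective (false ∷ X) (true  ∷ Y) p with Fin.combine-injectiveˡ {2} zero (code X) (suc zero) (code Y) p
... | ()
code-injective (true  ∷ X) (false ∷ Y) p with Fin.combine-injectiveˡ {2} (suc zero) (code X) zero (code Y) p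
... | ()

unique-lookup : ∀ {X : Set} {xs : List X} → Unique xs → ∀ i j → L.lookup xs i ≡ L.lookup xs j → i ≡ j
unique-lookup (_ ∷ _)  zero    zero    _ = refl
unique-lookup {xs = x ∷ xs} (ne ∷ _) zero    (suc j) p = ⊥-elim (All.lookup ne (∈-lookup {xs = xs} j) p)
unique-lookup {xs = x ∷ xs} (ne ∷ _) (suc i) zero    p = ⊥-elim (All.lookup ne (∈-lookup {xs = xs} i) (sym p))
unique-lookup (_ ∷ u)  (suc i) (suc j) p = cong suc (unique-lookup u i j p)

unique-length : ∀ {X : Set} {m} (f : X → Fin m) → (∀ x y → f x ≡ f y → x ≡ y) → ∀ {xs} → Unique xs → L.length xs ℕ.≤ m
unique-length f inj {xs} u = Fin.injective⇒≤ {f = λ i → f (L.lookup xs i)} λ {i} {j} p → unique-lookup u i j (inj _ _ p)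

vectors : ∀ n → List (Vec Bool n)
vectors zero    = [] ∷ []
vectors (suc n) = L.map (true ∷_) (vectors n) ++ L.map (false ∷_) (vectors n)

vectors-unique : ∀ n → Unique (vectors n)
vectors-unique zero    = [] ∷ []
vectors-unique (suc n) = Unique.++⁺ (Unique.map⁺ (λ { refl → refl }) (vectors-unique n)) (Unique.map⁺ (λ { refl → refl }) (vectors-unique n))
  λ (p , q) → disjoint (∈-map⁻ (true ∷_) p) (∈-map⁻ (false ∷_) q)
  where
  disjoint : ∀ {X : Vec Bool (suc n)} → (∃ λ Y → Y ∈ vectors n × X ≡ true ∷ Y) → (∃ λ Y → Y ∈ vectors n × X ≡ false ∷ Y) → ⊥
  disjoint (_ , _ , refl) (_ , _ , ())

vectors-length : ∀ n → L.length (vectors n) ≡ 2 ℕ.^ n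
vectors-length zero    = refl
vectors-length (suc n) = trans (L.length-++ (L.map (true ∷_) (vectors n)))
  (cong₂ ℕ._+_ (trans (L.length-map (true ∷_) (vectors n)) (vectors-length n))
    (trans (trans (L.length-map (false ∷_) (vectors n)) (vectors-length n)) (sym (ℕ.+-identityʳ _))))

-- A missed value, added to the list of all values of `f`, would give more than `2 ^ n` distinct
-- vectors.
injective⇒surjective : ∀ {n} (f : Vec Bool n → Vec Bool n) → (∀ X Y → f X ≡ f Y → X ≡ Y) → ∀ Y → Σ (Vec Bool n) λ X → f X ≡ Y
injective⇒surjective {n} f inj Y with search (λ X → Vec.≡-dec Bool._≟_ (f X) Y)
... | yes p = p
... | no np = ⊥-elim (ℕ.1+n≰n (subst (λ k → suc k ℕ.≤ 2 ℕ.^ n) (trans (L.length-map f (vectors n)) (vectors-length n))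
        (unique-length code code-injective (All.map⁺ (All.tabulate λ {X} _ p → np (X , sym p)) ∷ Unique.map⁺ (inj _ _) (vectors-unique n)))))

-- Reaching a compatible orientation by reversals.

module _ {n : ℕ} where
  ⊕-fixed : ∀ (x y : Vec ℤ n) → x ≡ x ⊕ y → y ≡ zeros
  ⊕-fixed x y p = trans (sym (⊕-cancel x y)) (trans (sym (⊕-assoc x y (neg x))) (trans (cong (_⊕ neg x) (sym p)) (⊕-inv x)))

  rev-at : ∀ (P O : Vec Bool n) e → lookup (rev P O) e ≡ lookup P e xor lookup O e
  rev-at P O e = lookup-zipWith _xor_ e P O

  -- Outside `P` the circuit follows `O` and its arcs are added; on `P` it runs against `O` and
  -- cancels the entry already there.
  on-rev : ∀ O P x → AllTrit x → InO (rev P O) x → on O (rev P (supp x)) ≡ on O P ⊕ x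
  on-rev O P x t i = ext λ e → trans (on-at O (rev P (supp x)) e)
    (trans (cong (entry (lookup O e)) (rev-at P (supp x) e)) (trans (at e) (sym (⊕-at (on O P) x e))))
    where
    toggle : ∀ p o → entry o (p xor true) ≡ entry o p + sg (p xor o)
    toggle true  true  = refl
    toggle true  false = refl
    toggle false true  = refl
    toggle false false = refl
    xor-false : ∀ p → p xor false ≡ p
    xor-false true  = refl
    xor-false false = refl
    at : ∀ e → entry (lookup O e) (lookup P e xor lookup (supp x) e) ≡ lookup (on O P) e + lookup x e
    at e with lookup (supp x) e in eq
    ... | true with supp-arc⁻ x t e eq
    ... | b , a = trans (toggle (lookup P e) (lookup O e)) (cong₂ _+_ (sym (on-at O P e))
                    (trans (cong sg (trans (sym (rev-at P O e)) (i e b a))) (sym a)))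
    at e | false = trans (cong (entry (lookup O e)) (xor-false (lookup P e)))
                     (trans (sym (on-at O P e)) (sym (trans (cong (lookup (on O P) e +_) (supp-0⁻ x t e eq)) (ℤ.+-identityʳ _))))

module _ {n : ℕ} {A B : Signed n} (M : Dual A B) where
  -- The state is the set `P` of elements reversed so far. Reversing a bad `x` adds `x` to `on O P`,
  -- and `neg x` is chosen, so each earlier state is the current one plus a nonempty sum of chosen
  -- circuits. Hence no state recurs, and since `k` plus the length of the history is `2 ^ n`,
  -- running out of `k` would give too many distinct sets.
  reversal-to-compat : ∀ O → Σ (Vec Bool n) λ P → Flow B (on O P) × Compat A (rev P O)
  reversal-to-compat O = run (2 ℕ.^ n) (replicate n false) []
    (subst (Flow B) (sym none) (flow-zeros {B = B})) ([] ∷ []) [] (ℕ.+-identityʳ _)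
    where
    none : on O (replicate n false) ≡ zeros
    none = ext λ e → trans (on-out O (replicate n false) e (lookup-replicate e false)) (sym (zeros-at e))
    Reaches : Vec Bool n → Vec Bool n → Set
    Reaches P P' = Σ (List (Vec ℤ n)) λ xs → xs ≢ [] × All (Pos A) xs × on O P' ≡ on O P ⊕ Σv xs
    run : ∀ k P hist → Flow B (on O P) → Unique (P ∷ hist) → All (Reaches P) hist → k ℕ.+ L.length hist ≡ 2 ℕ.^ n →
      Σ (Vec Bool n) λ P → Flow B (on O P) × Compat A (rev P O)
    run zero P hist fp u _ len = ⊥-elim (ℕ.1+n≰n (subst (λ k → suc k ℕ.≤ 2 ℕ.^ n) len (unique-length code code-injective u)))
    run (suc k) P hist fp u reach len with compat? A (rev P O)
    ... | inj₁ kP = P , fp , kP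
    ... | inj₂ (x , cx , ix , nx) = run k P' (P ∷ hist) (subst (Flow B) (sym on') (flow-⊕ {B = B} {on O P} {x} fp (cir-flow M cx)))
            (All.map (λ {P''} r → fresh P'' r) reach' ∷ u) reach' (trans (ℕ.+-suc k (L.length hist)) len)
      where
      P' = rev P (supp x)
      on' : on O P' ≡ on O P ⊕ x
      on' = on-rev O P x (trit A cx) ix
      back : on O P ≡ on O P' ⊕ neg x
      back = trans (sym (trans (⊕-assoc (on O P) x (neg x)) (trans (cong (on O P ⊕_) (⊕-inv x)) (⊕-idʳ (on O P)))))
               (cong (_⊕ neg x) (sym on'))
      extend : ∀ {P''} → Reaches P P'' → Reaches P' P''
      extend (xs , _ , pxs , eq) = neg x ∷ xs , (λ ()) , nx ∷ pxs ,
        trans eq (trans (cong (_⊕ Σv xs) back) (⊕-assoc (on O P') (neg x) (Σv xs)))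
      reach' : All (Reaches P') (P ∷ hist)
      reach' = (neg x ∷ [] , (λ ()) , nx ∷ [] , trans back (cong (on O P' ⊕_) (sym (⊕-idʳ (neg x))))) ∷ All.map extend reach
      fresh : ∀ P'' → Reaches P' P'' → P' ≢ P''
      fresh _ (xs , ne , pxs , eq) refl = ne (acyclic A pxs (⊕-fixed (on O P') (Σv xs) eq))

-- Circuits are repaired first, then cocircuits. The second round spoils nothing, because the sets
-- `P` and `Q` are disjoint.
config-exists : ∀ {n} {A B : Signed n} → Dual A B → ∀ O → Config A B O
config-exists {n} {A} {B} M O with reversal-to-compat M O
... | P , fP , kA with reversal-to-compat (swap M) (rev P O)
... | Q , fQ , kB = record { P = P ; Q = Q ; isTree = proj₂ (tree-exists n M true K kA' kB) ; flowP = flowP ; flowQ = flowQ ; reverse = ext O-eq }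
  where
  K₁ K : Vec Bool n
  K₁ = rev P O
  K  = rev Q K₁
  on-flip : ∀ O R → on (rev R O) R ≡ neg (on O R)
  on-flip O R = ext λ e → trans (on-at (rev R O) R e) (trans (at e (lookup R e) refl) (sym (trans (neg-at (on O R) e) (cong -_ (on-at O R e)))))
    where
    at : ∀ e a → lookup R e ≡ a → entry (lookup (rev R O) e) a ≡ - entry (lookup O e) a
    at e false _ = refl
    at e true  p = trans (cong sg (trans (rev-at R O e) (cong (_xor lookup O e) p))) (sym (-sg (lookup O e)))
  fP₁ : Flow B (on K₁ P)
  fP₁ = subst (Flow B) (sym (on-flip O P)) (flow-neg {B = B} {on O P} fP)
  flowQ : Flow A (on K Q)
  flowQ = subst (Flow A) (sym (on-flip K₁ Q)) (flow-neg {B = A} {on K₁ Q} fQ)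
  disj : ∀ e → lookup P e ≡ true → lookup Q e ≡ false
  disj = on-flows-disjoint M K₁ P Q fP₁ fQ
  K-off : ∀ e → lookup Q e ≡ false → lookup K e ≡ lookup K₁ e
  K-off e q = trans (rev-at Q K₁ e) (cong (_xor lookup K₁ e) q)
  flowP : Flow B (on K P)
  flowP = subst (Flow B) (ext {x = on K₁ P} {on K P} λ e → trans (on-at K₁ P e) (trans (at e (lookup P e) refl) (sym (on-at K P e)))) fP₁
    where
    at : ∀ e a → lookup P e ≡ a → entry (lookup K₁ e) a ≡ entry (lookup K e) a
    at e false _ = refl
    at e true  p = cong sg (sym (K-off e (disj e p)))
  kA' : Compat A K
  -- A circuit of `K` shares no arc with the flow on `Q`, so it is already a circuit of `K₁`.
  kA' x cx i = kA x cx λ e b a → trans (sym (K-off e (off e b a))) (i e b a)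
    where
    off : ∀ e b → Arc x e b → lookup Q e ≡ false
    off e b a with lookup Q e in q
    ... | false = refl
    ... | true  = ⊥-elim (flows-disjoint M K x (on K Q) (cir-flow M cx) flowQ (trit A cx) (on-trit K Q) i (on-InO K Q) a (on-in K Q e q))
  O-eq : ∀ e → lookup O e ≡ lookup (rev (P ∪ Q) K) e
  O-eq e = sym (trans (rev-at (P ∪ Q) K e) (trans (cong₂ _xor_ (lookup-zipWith _∨_ e P Q)
    (trans (rev-at Q K₁ e) (cong (lookup Q e xor_) (rev-at P O e)))) (bool (lookup P e) (lookup Q e) (lookup O e) (disj e))))
    where
    bool : ∀ p q o → (p ≡ true → q ≡ false) → (p ∨ q) xor (q xor (p xor o)) ≡ o
    bool true  true  o d with d refl
    ... | ()
    bool true  false o _ = Bool.not-involutive o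
    bool false true  o _ = Bool.not-involutive o
    bool false false o _ = refl

-- Splitting a flow into disjoint circuits.

size : ∀ {n} → Vec Bool n → ℕ
size []          = 0
size (true  ∷ X) = suc (size X)
size (false ∷ X) = size X

size-mono : ∀ {n} (X Y : Vec Bool n) → (∀ e → lookup X e ≡ true → lookup Y e ≡ true) → size X ℕ.≤ size Y
size-mono []          []          _ = ℕ.z≤n
size-mono (true  ∷ X) (true  ∷ Y) h = ℕ.s≤s (size-mono X Y λ e → h (suc e))
size-mono (true  ∷ X) (false ∷ Y) h with h zero refl
... | ()
size-mono (false ∷ X) (true  ∷ Y) h = ℕ.m≤n⇒m≤1+n (size-mono X Y λ e → h (suc e))
size-mono (false ∷ X) (false ∷ Y) h = size-mono X Y λ e → h (suc e)

size-strict : ∀ {n} (X Y : Vec Bool n) → (∀ e → lookup X e ≡ true → lookup Y e ≡ true) →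
  ∀ e → lookup X e ≡ false → lookup Y e ≡ true → size X ℕ.< size Y
size-strict (false ∷ X) (true  ∷ Y) h zero    _ _ = ℕ.s≤s (size-mono X Y λ e → h (suc e))
size-strict (true  ∷ X) (true  ∷ Y) h (suc e) p q = ℕ.s≤s (size-strict X Y (λ e → h (suc e)) e p q)
size-strict (true  ∷ X) (false ∷ Y) h (suc e) p q with h zero refl
... | ()
size-strict (false ∷ X) (true  ∷ Y) h (suc e) p q = ℕ.m≤n⇒m≤1+n (size-strict X Y (λ e → h (suc e)) e p q)
size-strict (false ∷ X) (false ∷ Y) h (suc e) p q = size-strict X Y (λ e → h (suc e)) e p q

module _ {n : ℕ} where
  Disjoint : Vec ℤ n → Vec ℤ n → Set
  Disjoint x y = ∀ e → lookup (supp x) e ≡ true → lookup (supp y) e ≡ false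

  ⋃ : List (Vec ℤ n) → Vec Bool n
  ⋃ = foldr (λ x X → supp x ∪ X) (replicate n false)

  ⋃-at : ∀ x xs e → lookup (⋃ (x ∷ xs)) e ≡ lookup (supp x) e ∨ lookup (⋃ xs) e
  ⋃-at x xs e = lookup-zipWith _∨_ e (supp x) (⋃ xs)

  ⋃-⊇ : ∀ x xs → x ∈ xs → ∀ e → lookup (supp x) e ≡ true → lookup (⋃ xs) e ≡ true
  ⋃-⊇ x (y ∷ xs) (here refl) e p = trans (⋃-at y xs e) (cong (_∨ lookup (⋃ xs) e) p)
  ⋃-⊇ x (y ∷ xs) (there x∈) e p = trans (⋃-at y xs e) (trans (cong (lookup (supp y) e ∨_) (⋃-⊇ x xs x∈ e p)) (Bool.∨-zeroʳ _))

  ⋃-++ : ∀ xs ys → ⋃ (xs ++ ys) ≡ ⋃ xs ∪ ⋃ ys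
  ⋃-++ []       ys = ext λ e → sym (trans (lookup-zipWith _∨_ e (replicate n false) (⋃ ys)) (cong (_∨ lookup (⋃ ys) e) (lookup-replicate e false)))
  ⋃-++ (x ∷ xs) ys = trans (cong (supp x ∪_) (⋃-++ xs ys)) (sym (zipWith-assoc Bool.∨-assoc (supp x) (⋃ xs) (⋃ ys)))

  on-disjoint-∪ : ∀ (K : Vec Bool n) (x : Vec ℤ n) R → AllTrit x → InO K x → (∀ e → lookup (supp x) e ≡ true → lookup R e ≡ false) →
    on K (supp x ∪ R) ≡ x ⊕ on K R
  on-disjoint-∪ K x R t i d = ext λ e → trans (on-at K (supp x ∪ R) e) (trans (cong (entry (lookup K e)) (lookup-zipWith _∨_ e (supp x) R))
    (trans (at e) (sym (⊕-at x (on K R) e))))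
    where
    at : ∀ e → entry (lookup K e) (lookup (supp x) e ∨ lookup R e) ≡ lookup x e + lookup (on K R) e
    at e with lookup (supp x) e in eq
    ... | false = trans (sym (on-at K R e)) (sym (trans (cong (_+ lookup (on K R) e) (supp-0⁻ x t e eq)) (ℤ.+-identityˡ _)))
    ... | true with supp-arc⁻ x t e eq
    ... | b , a = trans (trans (cong sg (i e b a)) (sym a)) (sym (trans (cong (lookup x e +_) (on-out K R e (d e eq))) (ℤ.+-identityʳ _)))

  ⋃-disjoint : ∀ x xs → All (Disjoint x) xs → ∀ e → lookup (supp x) e ≡ true → lookup (⋃ xs) e ≡ false
  ⋃-disjoint x [] [] e p = lookup-replicate e false
  ⋃-disjoint x (y ∷ xs) (d ∷ ds) e p = trans (⋃-at y xs e) (cong₂ _∨_ (d e p) (⋃-disjoint x xs ds e p))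

module _ {n : ℕ} {A B : Signed n} (M : Dual A B) where
  circuits-flow : ∀ K xs → All (λ x → Cir A x × InO K x) xs → AllPairs Disjoint xs → Flow B (on K (⋃ xs))
  circuits-flow K [] [] [] = subst (Flow B) (ext {x = zeros} {on K (replicate n false)} λ e → trans (zeros-at e) (sym (on-out K (replicate n false) e (lookup-replicate e false)))) (flow-zeros {B = B})
  circuits-flow K (x ∷ xs) ((cx , ix) ∷ cs) (d ∷ ds) =
    subst (Flow B) (sym (on-disjoint-∪ K x (⋃ xs) (trit A cx) ix (⋃-disjoint x xs d)))
      (flow-⊕ {B = B} {x} {on K (⋃ xs)} (cir-flow M cx) (circuits-flow K xs cs ds))

  -- A circuit conformal to `on K P` lies in `K` with support inside `P`. Removing it leaves a flow
  -- on a strictly smaller set.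
  decompose : ∀ K P → Flow B (on K P) →
    Σ (List (Vec ℤ n)) λ xs → All (λ x → Cir A x × InO K x) xs × AllPairs Disjoint xs × ⋃ xs ≡ P
  decompose K P = go (suc (size P)) P ℕ.≤-refl
    where
    go : ∀ k P → size P ℕ.< k → Flow B (on K P) →
      Σ (List (Vec ℤ n)) λ xs → All (λ x → Cir A x × InO K x) xs × AllPairs Disjoint xs × ⋃ xs ≡ P
    go (suc k) P (ℕ.s≤s le) fP with Fin.any? (λ e → lookup P e Bool.≟ true)
    ... | no none = [] , [] , [] , ext λ e → trans (lookup-replicate e false) (sym (Bool.¬-not λ p → none (e , p)))
    ... | yes (e , p) with conformal-circuit M (on K P) fP e (λ z → sg≢0 {lookup K e} (trans (sym (on-in K P e p)) z))
    ... | x , cx , (b , a) , cf = result (go k P' (ℕ.<-≤-trans P'<P le) flow')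
      where
      P' = P ∖ supp x
      P'-at : ∀ f → lookup P' f ≡ lookup P f ∧ not (lookup (supp x) f)
      P'-at f = lookup-zipWith _ f P (supp x)
      arc : ∀ f c → Arc x f c → lookup P f ≡ true × lookup K f ≡ c
      arc f c af = on-arc K P f c (positive-trit c (on-trit K P f) (cf f c af))
      P'⊆ : ∀ f → lookup P' f ≡ true → lookup P f ≡ true
      P'⊆ f q with lookup P f | P'-at f
      ... | true  | _ = refl
      ... | false | r = trans (sym r) q
      disj : ∀ f → lookup (supp x) f ≡ true → lookup P' f ≡ false
      disj f q = trans (P'-at f) (trans (cong (λ s → lookup P f ∧ not s) q) (Bool.∧-zeroʳ _))
      P'<P : size P' ℕ.< size P
      P'<P = size-strict P' P P'⊆ e (disj e (supp-arc x e b a)) p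
      split : supp x ∪ P' ≡ P
      split = ext λ f → trans (lookup-zipWith _∨_ f (supp x) P') (trans (cong (lookup (supp x) f ∨_) (P'-at f))
        (bool (lookup (supp x) f) (lookup P f) λ q → let (c , af) = supp-arc⁻ x (trit A cx) f q in proj₁ (arc f c af)))
        where
        bool : ∀ s p → (s ≡ true → p ≡ true) → s ∨ (p ∧ not s) ≡ p
        bool true  p h = sym (h refl)
        bool false p h = Bool.∧-identityʳ p
      ix : InO K x
      ix f c af = proj₂ (arc f c af)
      flow' : Flow B (on K P')
      flow' = subst (Flow B) (⊕-move x (on K P) (on K P') (trans (cong (on K) (sym split)) (on-disjoint-∪ K x P' (trit A cx) ix disj)))
                (flow-⊕ {B = B} {on K P} {neg x} fP (flow-neg {B = B} {x} (cir-flow M cx)))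
        where
        ⊕-move : ∀ x y z → y ≡ x ⊕ z → y ⊕ neg x ≡ z
        ⊕-move x y z refl = trans (⊕-assoc x z (neg x)) (⊕-cancel x z)
      result : (Σ (List (Vec ℤ n)) λ xs → All (λ x → Cir A x × InO K x) xs × AllPairs Disjoint xs × ⋃ xs ≡ P') →
        Σ (List (Vec ℤ n)) λ xs → All (λ x → Cir A x × InO K x) xs × AllPairs Disjoint xs × ⋃ xs ≡ P
      result (xs , cs , ds , eq) = x ∷ xs , (cx , ix) ∷ cs , All.tabulate apart ∷ ds , trans (cong (supp x ∪_) eq) split
        where
        apart : ∀ {y} → y ∈ xs → Disjoint x y
        apart {y} y∈ f q = Bool.¬-not λ r → Bool.not-¬ (trans (cong (λ X → lookup X f) (sym eq)) (⋃-⊇ y xs y∈ f r) ) (disj f q)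

-- Directed cycles of a graph as signed vectors.

Unique-resp-↭ : ∀ {X : Set} {xs ys : List X} → xs ↭ ys → Unique xs → Unique ys
Unique-resp-↭ Perm.refl         u = u
Unique-resp-↭ (Perm.prep x p)   (n ∷ u) = All-resp-↭ p n ∷ Unique-resp-↭ p u
Unique-resp-↭ (Perm.swap x y p) ((x≢y ∷ nx) ∷ ny ∷ u) =
  ((λ e → x≢y (sym e)) ∷ All-resp-↭ p ny) ∷ All-resp-↭ p nx ∷ Unique-resp-↭ p u
Unique-resp-↭ (Perm.trans p q)  u = Unique-resp-↭ q (Unique-resp-↭ p u)

⊕-comm : ∀ {n} (x y : Vec ℤ n) → x ⊕ y ≡ y ⊕ x
⊕-comm x y = ext λ e → trans (⊕-at x y e) (trans (ℤ.+-comm (lookup x e) _) (sym (⊕-at y x e)))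

Σv-↭ : ∀ {n} {xs ys : List (Vec ℤ n)} → xs ↭ ys → Σv xs ≡ Σv ys
Σv-↭ Perm.refl         = refl
Σv-↭ (Perm.prep x p)   = cong (x ⊕_) (Σv-↭ p)
Σv-↭ (Perm.swap {xs} {ys} x y p) = trans (sym (⊕-assoc x y (Σv xs)))
  (trans (cong₂ _⊕_ (⊕-comm x y) (Σv-↭ p)) (⊕-assoc y x (Σv ys)))
Σv-↭ (Perm.trans p q)  = trans (Σv-↭ p) (Σv-↭ q)

Σv-neg : ∀ {n} (xs : List (Vec ℤ n)) → Σv (L.map neg xs) ≡ neg (Σv xs)
Σv-neg []       = ext λ e → trans (zeros-at e) (sym (trans (neg-at zeros e) (cong -_ (zeros-at e))))
Σv-neg (x ∷ xs) = trans (cong (neg x ⊕_) (Σv-neg xs)) (ext λ e → trans (⊕-at (neg x) (neg (Σv xs)) e)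
  (trans (cong₂ _+_ (neg-at x e) (neg-at (Σv xs) e)) (trans (sym (ℤ.neg-distrib-+ (lookup x e) _))
    (sym (trans (neg-at (x ⊕ Σv xs) e) (cong -_ (⊕-at x (Σv xs) e)))))))

search-lists : ∀ {n} {P : List (Fin n × Bool) → Set} → (∀ ds → Dec (P ds)) → ∀ k → Dec (Σ (List (Fin n × Bool)) λ ds → L.length ds ℕ.≤ k × P ds)
search-lists {n} {P} P? zero with P? []
... | yes p = yes ([] , ℕ.z≤n , p)
... | no np = no λ { ([] , _ , p) → np p }
search-lists {n} {P} P? (suc k) with P? []
... | yes p = yes ([] , ℕ.z≤n , p)
... | no np with Fin.any? (λ e → search-lists (λ ds → P? ((e , true) ∷ ds)) k ⊎-dec search-lists (λ ds → P? ((e , false) ∷ ds)) k)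
... | yes (e , inj₁ (ds , le , p)) = yes (_ , ℕ.s≤s le , p)
... | yes (e , inj₂ (ds , le , p)) = yes (_ , ℕ.s≤s le , p)
... | no none = no λ { ([] , _ , p) → np p
                     ; ((e , true)  ∷ ds , ℕ.s≤s le , p) → none (e , inj₁ (ds , le , p))
                     ; ((e , false) ∷ ds , ℕ.s≤s le , p) → none (e , inj₂ (ds , le , p)) }

module _ (G : Graph) where
  open Graph G

  private
    D : Set
    D = Dart G

  flip : D → D
  flip (e , b) = e , not b

  start-flip : ∀ d → start G (flip d) ≡ end G d
  start-flip (e , true)  = refl
  start-flip (e , false) = refl

  end-flip : ∀ d → end G (flip d) ≡ start G d
  end-flip (e , true)  = refl
  end-flip (e , false) = refl

  walk-++ : ∀ {u v w} ds ds' → IsWalk G u ds v → IsWalk G v ds' w → IsWalk G u (ds ++ ds') w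
  walk-++ []       ds' refl    q = q
  walk-++ (d ∷ ds) ds' (s , p) q = s , walk-++ ds ds' p q

  reverse-walk : List D → List D
  reverse-walk ds = L.reverse (L.map flip ds)

  walk-reverse : ∀ {u v} ds → IsWalk G u ds v → IsWalk G v (reverse-walk ds) u
  walk-reverse []       refl = refl
  walk-reverse {u} {v} (d ∷ ds) (s , p) = subst (λ xs → IsWalk G v xs u) (sym (L.unfold-reverse (flip d) (L.map flip ds)))
    (walk-++ (reverse-walk ds) (flip d ∷ []) (walk-reverse ds p) (start-flip d , trans (end-flip d) s))

  -- The vertex sequence read in two ways. For a closed walk it makes the ends a rearrangement of
  -- the starts, so the reversed walk again repeats no vertex.
  walk-ends : ∀ {u v} ds → IsWalk G u ds v → u ∷ L.map (end G) ds ≡ L.map (start G) ds ++ v ∷ []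
  walk-ends []       refl       = refl
  walk-ends (d ∷ ds) (refl , p) = cong (start G d ∷_) (walk-ends ds p)

  unit : D → Vec ℤ nE
  unit (e , b) = tabulate λ f → if ⌊ e ≟ f ⌋ then sg b else 0ℤ

  unit-at : ∀ e b → lookup (unit (e , b)) e ≡ sg b
  unit-at e b = trans (lookup∘tabulate _ e) lem
    where
    lem : (if ⌊ e ≟ e ⌋ then sg b else 0ℤ) ≡ sg b
    lem with e ≟ e
    ... | yes _ = refl
    ... | no ne = ⊥-elim (ne refl)

  unit-off : ∀ e b f → e ≢ f → lookup (unit (e , b)) f ≡ 0ℤ
  unit-off e b f ne = trans (lookup∘tabulate _ f) lem
    where
    lem : (if ⌊ e ≟ f ⌋ then sg b else 0ℤ) ≡ 0ℤ
    lem with e ≟ f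
    ... | yes p = ⊥-elim (ne p)
    ... | no _ = refl

  -- As a sum of unit vectors the walk can be permuted, negated dart by dart, and paired with a cut
  -- term by term.
  dvecOf-Σ : ∀ ds → dvecOf G ds ≡ Σv (L.map unit ds)
  dvecOf-Σ []       = ext λ e → trans (lookup∘tabulate _ e) (sym (zeros-at e))
  dvecOf-Σ ((e , b) ∷ ds) = ext λ f → trans (lookup∘tabulate _ f) (trans (step f)
    (sym (trans (⊕-at (unit (e , b)) _ f) (cong₂ _+_ (lookup∘tabulate _ f)
      (trans (cong (λ x → lookup x f) (sym (dvecOf-Σ ds))) (lookup∘tabulate _ f))))))
    where
    sum : Fin nE → ℤ
    sum f = foldr (λ d acc → if ⌊ proj₁ d ≟ f ⌋ then ((if proj₂ d then ℤ.+ 1 else - (ℤ.+ 1)) + acc) else acc) (ℤ.+ 0) ds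
    sign : ∀ b → (if b then ℤ.+ 1 else - (ℤ.+ 1)) ≡ sg b
    sign true  = refl
    sign false = refl
    step : ∀ f → (if ⌊ e ≟ f ⌋ then ((if b then ℤ.+ 1 else - (ℤ.+ 1)) + sum f) else sum f)
               ≡ (if ⌊ e ≟ f ⌋ then sg b else 0ℤ) + sum f
    step f with ⌊ e ≟ f ⌋
    ... | true  = cong (_+ sum f) (sign b)
    ... | false = sym (ℤ.+-identityˡ (sum f))

  unit-flip : ∀ d → unit (flip d) ≡ neg (unit d)
  unit-flip (e , b) = ext at
    where
    at : ∀ f → lookup (unit (e , not b)) f ≡ lookup (neg (unit (e , b))) f
    at f with e ≟ f
    ... | yes refl = trans (unit-at e (not b)) (sym (trans (neg-at (unit (e , b)) e) (trans (cong -_ (unit-at e b)) (-sg b))))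
    ... | no ne = trans (unit-off e (not b) f ne) (sym (trans (neg-at (unit (e , b)) f) (cong -_ (unit-off e b f ne))))

  dvecOf-reverse : ∀ ds → dvecOf G (reverse-walk ds) ≡ neg (dvecOf G ds)
  dvecOf-reverse ds = trans (dvecOf-Σ (reverse-walk ds)) (trans (cong Σv (L.reverse-map unit (L.map flip ds)))
    (trans (Σv-↭ (↭-reverse (L.map unit (L.map flip ds)))) (trans (cong Σv (flips ds)) (trans (Σv-neg (L.map unit ds)) (cong neg (sym (dvecOf-Σ ds)))))))
    where
    flips : ∀ ds → L.map unit (L.map flip ds) ≡ L.map neg (L.map unit ds)
    flips []       = refl
    flips (d ∷ ds) = cong₂ _∷_ (unit-flip d) (flips ds)

  map-reverse-walk : ∀ {X : Set} (f g : D → X) → (∀ d → f (flip d) ≡ g d) → ∀ ds → L.map f (reverse-walk ds) ↭ L.map g ds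
  map-reverse-walk f g h ds = ↭-trans (↭-reflexive (L.reverse-map f (L.map flip ds)))
    (↭-trans (↭-reverse (L.map f (L.map flip ds))) (↭-reflexive (trans (sym (L.map-∘ ds)) (L.map-cong h ds))))

  neg-dirCycle : ∀ {x} → IsDirCycle G x → IsDirCycle G (neg x)
  neg-dirCycle (ds , (ne , (v , w) , us , ue) , refl) = reverse-walk ds ,
    (ne' , (v , walk-reverse ds w) , Unique-resp-↭ (↭-sym starts) us , Unique-resp-↭ (↭-sym edges) ue) , dvecOf-reverse ds
    where
    edges : L.map proj₁ (reverse-walk ds) ↭ L.map proj₁ ds
    edges = map-reverse-walk proj₁ proj₁ (λ _ → refl) ds
    starts : L.map (start G) (reverse-walk ds) ↭ L.map (start G) ds
    starts = ↭-trans (map-reverse-walk (start G) (end G) start-flip ds)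
      (drop-∷ (↭-trans (↭-reflexive (walk-ends ds w)) (++-comm (L.map (start G) ds) (v ∷ []))))
    ne' : reverse-walk ds ≢ []
    ne' p = ne (L.map-injective {f = flip} flip-injective (L.reverse-injective p))
      where
      flip-injective : ∀ {c d} → flip c ≡ flip d → c ≡ d
      flip-injective {e , true}  {_ , true}  refl = refl
      flip-injective {e , false} {_ , false} refl = refl

  dvecOf-off : ∀ ds e → e ∉ L.map proj₁ ds → lookup (dvecOf G ds) e ≡ 0ℤ
  dvecOf-off ds e e∉ = trans (cong (λ x → lookup x e) (dvecOf-Σ ds)) (go ds e∉)
    where
    go : ∀ ds → e ∉ L.map proj₁ ds → lookup (Σv (L.map unit ds)) e ≡ 0ℤ
    go []       _  = zeros-at e
    go ((f , b) ∷ ds) e∉ = trans (⊕-at (unit (f , b)) _ e)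
      (cong₂ _+_ (unit-off f b e λ p → e∉ (here (sym p))) (go ds λ e∈ → e∉ (there e∈)))

  dvecOf-on : ∀ ds → Unique (L.map proj₁ ds) → ∀ {e b} → (e , b) ∈ ds → Arc (dvecOf G ds) e b
  dvecOf-on ((e , b) ∷ ds) (n ∷ u) (here refl) = trans (cong (λ x → lookup x e) (dvecOf-Σ ((e , b) ∷ ds)))
    (trans (⊕-at (unit (e , b)) _ e) (trans (cong₂ _+_ (unit-at e b)
      (trans (cong (λ x → lookup x e) (sym (dvecOf-Σ ds))) (dvecOf-off ds e λ e∈ → All.lookup n e∈ refl))) (ℤ.+-identityʳ (sg b))))
  dvecOf-on ((f , c) ∷ ds) (n ∷ u) {e} {b} (there p) = trans (cong (λ x → lookup x e) (dvecOf-Σ ((f , c) ∷ ds)))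
    (trans (⊕-at (unit (f , c)) _ e) (trans (cong₂ _+_ (unit-off f c e (All.lookup n (∈-map⁺ proj₁ p)))
      (trans (cong (λ x → lookup x e) (sym (dvecOf-Σ ds))) (dvecOf-on ds u p))) (ℤ.+-identityˡ (sg b))))

  private
    member? : ∀ e (es : List (Fin nE)) → Dec (e ∈ es)
    member? = mem? _≟_

    edge-dart : ∀ (ds : List D) {e : Fin nE} → e ∈ L.map proj₁ ds → Σ Bool λ b → (e , b) ∈ ds
    edge-dart ((e , b) ∷ ds) (here refl) = b , here refl
    edge-dart (_ ∷ ds) (there p) = let (b , q) = edge-dart ds p in b , there q

  dvecOf-arc : ∀ ds → Unique (L.map proj₁ ds) → ∀ {e b} → Arc (dvecOf G ds) e b → (e , b) ∈ ds
  dvecOf-arc ds u {e} {b} a with member? e (L.map proj₁ ds)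
  ... | no e∉ = ⊥-elim (sg≢0 {b} (trans (sym a) (dvecOf-off ds e e∉)))
  ... | yes e∈ with edge-dart ds e∈
  ... | c , p = subst (λ b → (e , b) ∈ ds) (sg-inj (trans (sym (dvecOf-on ds u p)) a)) p

  dvecOf-trit : ∀ ds → Unique (L.map proj₁ ds) → AllTrit (dvecOf G ds)
  dvecOf-trit ds u e with member? e (L.map proj₁ ds)
  ... | no e∉ = subst Trit (sym (dvecOf-off ds e e∉)) nil
  ... | yes e∈ with edge-dart ds e∈
  ... | c , p = subst Trit (sym (dvecOf-on ds u p)) (sgn c)

  dirCycle-trit : ∀ {x} → IsDirCycle G x → AllTrit x
  dirCycle-trit (ds , (_ , _ , _ , ue) , refl) = dvecOf-trit ds ue

  dirCycle-nonzero : ∀ {x} → IsDirCycle G x → Σ (Fin nE) λ e → Σ Bool λ b → Arc x e b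
  dirCycle-nonzero ([] , (ne , _) , _) = ⊥-elim (ne refl)
  dirCycle-nonzero ((e , b) ∷ ds , (_ , _ , _ , ue) , refl) = e , b , dvecOf-on ((e , b) ∷ ds) ue (here refl)

  -- A simple closed walk repeats no edge, so walks of length at most `nE` suffice.
  dirCycle? : ∀ x → Dec (IsDirCycle G x)
  dirCycle? x = map′ (λ (ds , _ , p) → ds , p) (λ (ds , p) → ds , short ds p , p) (search-lists P? nE)
    where
    walk? : ∀ u ds v → Dec (IsWalk G u ds v)
    walk? u []       v = u ≟ v
    walk? u (d ∷ ds) v = (start G d ≟ u) ×-dec walk? (end G d) ds v
    nonempty? : (ds : List D) → Dec (ds ≢ [])
    nonempty? []      = no λ ne → ne refl
    nonempty? (_ ∷ _) = yes λ ()
    P? : ∀ ds → Dec (SimpleClosedWalk G ds × dvecOf G ds ≡ x)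
    P? ds = (nonempty? ds ×-dec Fin.any? (λ v → walk? v ds v) ×-dec DecUnique.unique? _≟_ (L.map (start G) ds)
      ×-dec DecUnique.unique? _≟_ (L.map proj₁ ds)) ×-dec Vec.≡-dec ℤ._≟_ (dvecOf G ds) x
    short : ∀ ds → SimpleClosedWalk G ds × dvecOf G ds ≡ x → L.length ds ℕ.≤ nE
    short ds ((_ , _ , _ , ue) , _) = subst (ℕ._≤ nE) (L.length-map proj₁ ds) (unique-length (λ e → e) (λ _ _ p → p) ue)

  -- Directed cuts and their orthogonality to cycles.

  cut-at : ∀ W e → lookup (cut G W) e ≡ lookup W (src e) xor lookup W (tgt e)
  cut-at W e = lookup∘tabulate _ e

  private
    crossing : Bool → Bool → ℤ
    crossing s t = if s ∧ not t then ℤ.+ 1 else if t ∧ not s then - (ℤ.+ 1) else ℤ.+ 0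

  dcut-at : ∀ W e → lookup (dcut G W) e ≡ crossing (lookup W (src e)) (lookup W (tgt e))
  dcut-at W e = lookup∘tabulate _ e

  dcut-trit : ∀ W → AllTrit (dcut G W)
  dcut-trit W e = subst Trit (sym (dcut-at W e)) (lem (lookup W (src e)) (lookup W (tgt e)))
    where
    lem : ∀ s t → Trit (crossing s t)
    lem true  true  = nil
    lem true  false = sgn true
    lem false true  = sgn false
    lem false false = nil

  dcut-arc : ∀ W e b → Arc (dcut G W) e b → lookup W (start G (e , b)) ≡ true × lookup W (end G (e , b)) ≡ false
  dcut-arc W e b a with lookup W (src e) in s | lookup W (tgt e) in t | trans (sym (dcut-at W e)) a
  dcut-arc W e true  a | true  | false | _ = s , t
  dcut-arc W e false a | false | true  | _ = t , s
  dcut-arc W e true  a | true  | true  | ()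
  dcut-arc W e true  a | false | true  | ()
  dcut-arc W e true  a | false | false | ()
  dcut-arc W e false a | true  | true  | ()
  dcut-arc W e false a | true  | false | ()
  dcut-arc W e false a | false | false | ()

  dcut-arc⁻ : ∀ W e b → lookup W (start G (e , b)) ≡ true → lookup W (end G (e , b)) ≡ false → Arc (dcut G W) e b
  dcut-arc⁻ W e true  s t = trans (dcut-at W e) (cong₂ crossing s t)
  dcut-arc⁻ W e false s t = trans (dcut-at W e) (cong₂ crossing t s)

  supp-dcut : ∀ W → supp (dcut G W) ≡ cut G W
  supp-dcut W = ext λ e → trans (lookup-map e _ (dcut G W)) (trans (cong (λ z → not ⌊ z ℤ.≟ 0ℤ ⌋) (dcut-at W e))
    (trans (lem (lookup W (src e)) (lookup W (tgt e))) (sym (cut-at W e))))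
    where
    lem : ∀ s t → not ⌊ crossing s t ℤ.≟ 0ℤ ⌋ ≡ s xor t
    lem true  true  = refl
    lem true  false = refl
    lem false true  = refl
    lem false false = refl

  cut-compl : ∀ W → cut G (map not W) ≡ cut G W
  cut-compl W = ext λ e → trans (cut-at (map not W) e) (trans (cong₂ _xor_ (lookup-map (src e) not W) (lookup-map (tgt e) not W))
    (trans (lem (lookup W (src e)) (lookup W (tgt e))) (sym (cut-at W e))))
    where
    lem : ∀ s t → not s xor not t ≡ s xor t
    lem true  true  = refl
    lem true  false = refl
    lem false true  = refl
    lem false false = refl

  dcut-compl : ∀ W → dcut G (map not W) ≡ neg (dcut G W)
  dcut-compl W = ext λ e → trans (dcut-at (map not W) e) (trans (cong₂ crossing (lookup-map (src e) not W) (lookup-map (tgt e) not W))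
    (trans (lem (lookup W (src e)) (lookup W (tgt e))) (sym (trans (neg-at (dcut G W) e) (cong -_ (dcut-at W e))))))
    where
    lem : ∀ s t → crossing (not s) (not t) ≡ - crossing s t
    lem true  true  = refl
    lem true  false = refl
    lem false true  = refl
    lem false false = refl

  dirCocycle-trit : ∀ {x} → IsDirCocycle G x → AllTrit x
  dirCocycle-trit (W , _ , refl) = dcut-trit W

  dirCocycle-nonzero : ∀ {x} → IsDirCocycle G x → Σ (Fin nE) λ e → Σ Bool λ b → Arc x e b
  dirCocycle-nonzero (W , (_ , _ , (e , p) , _) , refl) =
    e , supp-arc⁻ (dcut G W) (dcut-trit W) e (trans (cong (λ X → lookup X e) (supp-dcut W)) p)

  neg-dirCocycle : ∀ {x} → IsDirCocycle G x → IsDirCocycle G (neg x)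
  neg-dirCocycle (W , c , refl) = map not W , subst (IsCocycle G) (sym (cut-compl W)) c , dcut-compl W

  dirCocycle? : ∀ x → Dec (IsDirCocycle G x)
  dirCocycle? x = search λ W → cocycle? (cut G W) ×-dec Vec.≡-dec ℤ._≟_ (dcut G W) x
    where
    nonEmpty? : ∀ X → Dec (NonEmpty G X)
    nonEmpty? X = Fin.any? λ e → lookup X e Bool.≟ true
    ⊆? : ∀ X Y → Dec (_⊆ₛ_ G X Y)
    ⊆? X Y = Fin.all? λ e → imp (lookup X e) (lookup Y e)
      where
      imp : ∀ a b → Dec (a ≡ true → b ≡ true)
      imp _     true  = yes λ _ → refl
      imp false false = yes λ ()
      imp true  false = no λ h → Bool.not-¬ {false} refl (h refl)
    minimal? : ∀ X → Dec (∀ W → NonEmpty G (cut G W) → _⊆ₛ_ G (cut G W) X → cut G W ≡ X)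
    minimal? X with search (λ W → nonEmpty? (cut G W) ×-dec ⊆? (cut G W) X ×-dec ¬? (Vec.≡-dec Bool._≟_ (cut G W) X))
    ... | yes (W , ne , sub , neq) = no λ h → neq (h W ne sub)
    ... | no none = yes λ W ne sub → decide W ne sub
      where
      decide : ∀ W → NonEmpty G (cut G W) → _⊆ₛ_ G (cut G W) X → cut G W ≡ X
      decide W ne sub with Vec.≡-dec Bool._≟_ (cut G W) X
      ... | yes p = p
      ... | no np = ⊥-elim (none (W , ne , sub , np))
    cocycle? : ∀ X → Dec (IsCocycle G X)
    cocycle? X = search λ W → Vec.≡-dec Bool._≟_ X (cut G W) ×-dec nonEmpty? X ×-dec minimal? X

  private
    side : Bool → ℤ
    side b = if b then 1ℤ else 0ℤ

  dot-unit : ∀ d y → dot (unit d) y ≡ sg (proj₂ d) * lookup y (proj₁ d)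
  dot-unit (e , b) y = go e y
    where
    tab-0 : ∀ {n} (f : Fin n → ℤ) → (∀ i → f i ≡ 0ℤ) → ∀ y → dot (tabulate f) y ≡ 0ℤ
    tab-0 f z []       = refl
    tab-0 f z (y ∷ ys) = cong₂ _+_ (trans (cong (_* y) (z zero)) (ℤ.*-zeroˡ y)) (tab-0 (λ i → f (suc i)) (λ i → z (suc i)) ys)
    single-dot : ∀ {n} (f : Fin n → ℤ) e → (∀ i → e ≢ i → f i ≡ 0ℤ) → ∀ y → dot (tabulate f) y ≡ f e * lookup y e
    single-dot f zero    z (y ∷ ys) = trans (cong (f zero * y +_) (tab-0 (λ i → f (suc i)) (λ i → z (suc i) λ ()) ys)) (ℤ.+-identityʳ _)
    single-dot f (suc e) z (y ∷ ys) = trans (cong₂ _+_ (trans (cong (_* y) (z zero λ ())) (ℤ.*-zeroˡ y))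
      (single-dot (λ i → f (suc i)) e (λ i ne → z (suc i) λ { refl → ne refl }) ys)) (ℤ.+-identityˡ _)
    go : ∀ e y → dot (unit (e , b)) y ≡ sg b * lookup y e
    go e y = trans (single-dot _ e (λ i ne → trans (sym (lookup∘tabulate _ i)) (unit-off e b i ne)) y)
      (cong (_* lookup y e) (trans (sym (lookup∘tabulate _ e)) (unit-at e b)))

  dart-crossing : ∀ W d → sg (proj₂ d) * lookup (dcut G W) (proj₁ d) ≡ side (lookup W (start G d)) + - side (lookup W (end G d))
  dart-crossing W (e , b) = trans (cong (sg b *_) (dcut-at W e)) (lem b)
    where
    both : ∀ s t → crossing s t ≡ side s + - side t
    both true  true  = refl
    both true  false = refl
    both false true  = refl
    both false false = refl
    both' : ∀ s t → - crossing s t ≡ side t + - side s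
    both' true  true  = refl
    both' true  false = refl
    both' false true  = refl
    both' false false = refl
    lem : ∀ b → sg b * crossing (lookup W (src e)) (lookup W (tgt e)) ≡
      side (lookup W (start G (e , b))) + - side (lookup W (end G (e , b)))
    lem true  = trans (ℤ.*-identityˡ _) (both (lookup W (src e)) (lookup W (tgt e)))
    lem false = trans (ℤ.-1*i≡-i _) (both' (lookup W (src e)) (lookup W (tgt e)))

  -- `dcut G W` is the coboundary of the indicator of `W`, so the pairing telescopes along the walk;
  -- on a closed walk it vanishes.
  walk-crossing : ∀ W {u v} ds → IsWalk G u ds v → dot (Σv (L.map unit ds)) (dcut G W) ≡ side (lookup W u) + - side (lookup W v)
  walk-crossing W {u} []       refl       = trans (dot-zeros (dcut G W)) (sym (ℤ.+-inverseʳ (side (lookup W u))))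
  walk-crossing W {u} {v} (d ∷ ds) (refl , p) = trans (dot-⊕ (unit d) _ (dcut G W))
    (trans (cong₂ _+_ (trans (dot-unit d (dcut G W)) (dart-crossing W d)) (walk-crossing W ds p))
      (telescope (side (lookup W (start G d))) (side (lookup W (end G d))) (side (lookup W v))))
    where
    telescope : ∀ a b c → (a + - b) + (b + - c) ≡ a + - c
    telescope a b c = trans (ℤ.+-assoc a (- b) _) (cong (a +_) (trans (sym (ℤ.+-assoc (- b) b (- c)))
      (trans (cong (_+ - c) (ℤ.+-inverseˡ b)) (ℤ.+-identityˡ _))))

  cycle-cocycle-orth : ∀ {x y} → IsDirCycle G x → IsDirCocycle G y → dot x y ≡ 0ℤ
  cycle-cocycle-orth (ds , (_ , (v , w) , _) , refl) (W , _ , refl) = trans (cong (λ x → dot x (dcut G W)) (dvecOf-Σ ds))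
    (trans (walk-crossing W ds w) (ℤ.+-inverseʳ (side (lookup W v))))

-- Reachability, and the painting property of graphs.

module _ (G : Graph) where
  open Graph G

  const-along-walk : ∀ (f : Fin nV → Bool) {u v} ds → IsWalk G u ds v →
    All (λ d → f (start G d) ≡ f (end G d)) ds → f u ≡ f v
  const-along-walk f []       refl       []       = refl
  const-along-walk f (d ∷ ds) (refl , w) (p ∷ ps) = trans p (const-along-walk f ds w ps)

  -- `simple` lists `t` separately because the starts omit the last vertex. `inside` is what makes
  -- extension possible: a new start outside the set differs from every vertex already on the path.
  record Path (ok : Dart G → Bool) (R : VertexSet G) (t u : Fin nV) : Set where
    field
      darts   : List (Dart G)
      isWalk  : IsWalk G u darts t
      allowed : All (λ d → ok d ≡ true) darts
      simple  : Unique (t ∷ L.map (start G) darts)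
      inside  : All (λ v → lookup R v ≡ true) (L.map (start G) darts)

  open Path

  record CoReachable (ok : Dart G → Bool) (t : Fin nV) : Set where
    field
      set    : VertexSet G
      target : lookup set t ≡ true
      closed : ∀ d → ok d ≡ true → lookup set (end G d) ≡ true → lookup set (start G d) ≡ true
      path   : ∀ u → lookup set u ≡ true → Path ok set t u

  open CoReachable

  saturate : ∀ ok t → CoReachable ok t
  saturate ok t = grow (suc (size (map not R₀))) R₀ ℕ.≤-refl R₀-t λ u p → subst (Path ok R₀ t) (sym (R₀-only u p))
      (record { darts = [] ; isWalk = refl ; allowed = [] ; simple = [] ∷ [] ; inside = [] })
    where
    ∅ : VertexSet G
    ∅ = replicate nV false
    R₀ = ∅ [ t ]≔ true
    R₀-t : lookup R₀ t ≡ true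
    R₀-t = Vec.lookup∘update t ∅ true
    R₀-only : ∀ u → lookup R₀ u ≡ true → u ≡ t
    R₀-only u p with u ≟ t
    ... | yes q = q
    ... | no ne with trans (sym p) (trans (Vec.lookup∘update′ ne ∅ true) (lookup-replicate u false))
    ... | ()
    Exit : VertexSet G → Dart G → Set
    Exit R d = ok d ≡ true × lookup R (end G d) ≡ true × lookup R (start G d) ≡ false
    exit? : ∀ R d → Dec (Exit R d)
    exit? R d = (ok d Bool.≟ true) ×-dec (lookup R (end G d) Bool.≟ true) ×-dec (lookup R (start G d) Bool.≟ false)
    grow : ∀ k R → size (map not R) ℕ.< k → lookup R t ≡ true → (∀ u → lookup R u ≡ true → Path ok R t u) → CoReachable ok t
    grow (suc k) R (ℕ.s≤s le) tR paths with Fin.any? (λ e → exit? R (e , true) ⊎-dec exit? R (e , false))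
    ... | no none = record { set = R ; target = tR ; closed = λ d o p → Bool.¬-not λ q → stuck d (o , p , q) ; path = paths }
      where
      stuck : ∀ d → ¬ Exit R d
      stuck (e , true)  x = none (e , inj₁ x)
      stuck (e , false) x = none (e , inj₂ x)
    ... | yes (e , exits) = extend (dart exits)
      where
      dart : Exit R (e , true) ⊎ Exit R (e , false) → Σ (Dart G) (Exit R)
      dart (inj₁ x) = _ , x
      dart (inj₂ x) = _ , x
      extend : Σ (Dart G) (Exit R) → CoReachable ok t
      extend (d , o , eR , sR) = grow k R' (ℕ.<-≤-trans smaller le) (mono t tR) paths'
        where
        s = start G d
        R' = R [ s ]≔ true
        s∈R' : lookup R' s ≡ true
        s∈R' = Vec.lookup∘update s R true
        mono : ∀ u → lookup R u ≡ true → lookup R' u ≡ true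
        mono u p with u ≟ s
        ... | yes refl = s∈R'
        ... | no ne = trans (Vec.lookup∘update′ ne R true) p
        smaller : size (map not R') ℕ.< size (map not R)
        smaller = size-strict (map not R') (map not R)
          (λ u p → trans (lookup-map u not R) (cong not (Bool.¬-not λ q → Bool.not-¬ (mono u q) (Bool.not-injective (trans (sym (lookup-map u not R')) p)))))
          s (trans (lookup-map s not R') (cong not s∈R')) (trans (lookup-map s not R) (cong not sR))
        outside : ∀ {u} → lookup R u ≡ true → s ≢ u
        outside p refl = Bool.not-¬ sR p
        paths' : ∀ u → lookup R' u ≡ true → Path ok R' t u
        paths' u p with u ≟ s
        ... | no ne = let P = paths u (trans (sym (Vec.lookup∘update′ ne R true)) p) in record
              { darts = darts P ; isWalk = isWalk P ; allowed = allowed P ; simple = simple P ; inside = All.map (mono _) (inside P) }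
        ... | yes refl with paths (end G d) eR
        ... | P with simple P
        ... | n ∷ u = record { darts = d ∷ darts P ; isWalk = refl , isWalk P ; allowed = o ∷ allowed P
                             ; simple = ((λ q → outside tR (sym q)) ∷ n) ∷ All.map outside (inside P) ∷ u
                             ; inside = s∈R' ∷ All.map (mono _) (inside P) }

  -- Keeping the search opaque stops with-abstraction from unfolding it.
  abstract
    coReachable : ∀ ok t → CoReachable ok t
    coReachable = saturate

  -- A repeated edge of a simple path would have to be traversed back and forth,
  -- and so would revisit a vertex.
  simple-path-edges : ∀ {t u} ds → IsWalk G u ds t → Unique (t ∷ L.map (start G) ds) → Unique (L.map proj₁ ds)
  simple-path-edges [] _ _ = []
  simple-path-edges {t} (d ∷ ds) (refl , w) ((t≢s ∷ t∉) ∷ s∉ ∷ us) =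
    All.map⁺ (All.tabulate λ {d'} d'∈ eq → repeated d' d'∈ eq) ∷ simple-path-edges ds w (t∉ ∷ us)
    where
    back : ∀ ds → IsWalk G (end G d) ds t → Unique (L.map (start G) ds) → (∀ {v} → v ∈ L.map (start G) ds → start G d ≢ v) →
      ∀ d' → d' ∈ ds → start G d' ≡ end G d → end G d' ≡ start G d → ⊥
    back (c ∷ [])     (p , refl) _ _ .c (here refl) _ q = t≢s q
    back (c ∷ c' ∷ _) (p , p' , _) _ f .c (here refl) _ q = f (there (here refl)) (sym (trans p' q))
    back (c ∷ ds)     (p , _) (n ∷ _) f d' (there d'∈) s _ = All.lookup n (∈-map⁺ (start G) d'∈) (trans p (sym s))
    repeated : ∀ d' → d' ∈ ds → proj₁ d ≡ proj₁ d' → ⊥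
    repeated (e , b') d'∈ refl with proj₂ d Bool.≟ b'
    ... | yes refl = All.lookup s∉ (∈-map⁺ (start G) d'∈) refl
    ... | no ne with ≢⇒not (λ q → ne (sym q))
    ... | refl = back ds w us (All.lookup s∉) (flip G d) d'∈ (start-flip G d) (end-flip G d)

  module _ (conn : ConnectedSub G (fullSet G)) where
    -- The cocycle is obtained from the cut of W by passing to the component A of
    -- its tail side and then to the component B of the complement of A.
    cut⊇cocycle : ∀ W e b → Arc (dcut G W) e b →
      Σ (Vec ℤ nE) λ y → IsDirCocycle G y × Arc y e b × (∀ f c → Arc y f c → Arc (dcut G W) f c)
    cut⊇cocycle W e b a = dcut G X , (X , cocycle , refl) , dcut-arc⁻ G X e b p∈X q∉X , X⇒W
      where
      p q : Fin nV
      p = start G (e , b)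
      q = end G (e , b)
      xor⇒≡ : ∀ {x y} → x xor y ≡ false → x ≡ y
      xor⇒≡ {true}  {true}  _ = refl
      xor⇒≡ {false} {false} _ = refl
      okA : Dart G → Bool
      okA d = not (lookup (cut G W) (proj₁ d))
      okA⇒same : ∀ W' (d : Dart G) → lookup (cut G W') (proj₁ d) ≡ false → lookup W' (start G d) ≡ lookup W' (end G d)
      okA⇒same W' (f , true)  r = xor⇒≡ (trans (sym (cut-at G W' f)) r)
      okA⇒same W' (f , false) r = sym (xor⇒≡ (trans (sym (cut-at G W' f)) r))
      same⇒okA : ∀ (d : Dart G) → lookup W (start G d) ≡ lookup W (end G d) → okA d ≡ true
      same⇒okA (f , b) r = cong not (trans (cut-at G W f) (lem b r))
        where
        lem : ∀ b → lookup W (start G (f , b)) ≡ lookup W (end G (f , b)) → lookup W (src f) xor lookup W (tgt f) ≡ false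
        lem true  r = trans (cong (_xor lookup W (tgt f)) r) (Bool.xor-same (lookup W (tgt f)))
        lem false r = trans (cong (lookup W (src f) xor_) r) (Bool.xor-same (lookup W (src f)))
      ra = coReachable okA p
      A = set ra
      A⊆W : ∀ v → lookup A v ≡ true → lookup W v ≡ true
      A⊆W v v∈ = let P = path ra v v∈ in trans
        (const-along-walk (lookup W) (darts P) (isWalk P) (All.map (λ {d} o → okA⇒same W d (Bool.not-injective o)) (allowed P)))
        (proj₁ (dcut-arc G W e b a))
      A⇒W : ∀ (d : Dart G) → lookup A (start G d) ≡ true → lookup A (end G d) ≡ false → lookup W (end G d) ≡ false
      A⇒W d s∈ t∉ = Bool.¬-not λ t∈W → Bool.not-¬ t∉ (subst (λ v → lookup A v ≡ true) (start-flip G d)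
        (closed ra (flip G d) (same⇒okA (flip G d) (trans (cong (lookup W) (start-flip G d))
          (trans t∈W (trans (sym (A⊆W _ s∈)) (sym (cong (lookup W) (end-flip G d)))))))
          (trans (cong (lookup A) (end-flip G d)) s∈)))
      okB : Dart G → Bool
      okB d = not (lookup A (start G d)) ∧ not (lookup A (end G d))
      okB⁺ : ∀ d → lookup A (start G d) ≡ false → lookup A (end G d) ≡ false → okB d ≡ true
      okB⁺ d s t = cong₂ (λ x y → not x ∧ not y) s t
      okB⁻ : ∀ d → okB d ≡ true → lookup A (start G d) ≡ false × lookup A (end G d) ≡ false
      okB⁻ d o with lookup A (start G d) | lookup A (end G d)
      okB⁻ d o  | false | false = refl , refl
      okB⁻ d () | true  | _
      okB⁻ d () | false | true
      rb = coReachable okB q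
      B X : VertexSet G
      B = set rb
      X = map not B
      X-at : ∀ v → lookup X v ≡ not (lookup B v)
      X-at v = lookup-map v not B
      q∉A : lookup A q ≡ false
      q∉A = Bool.¬-not λ q∈ → Bool.not-¬ (proj₂ (dcut-arc G W e b a)) (A⊆W q q∈)
      B∩A : ∀ v → lookup B v ≡ true → lookup A v ≡ false
      B∩A v v∈ with path rb v v∈
      ... | record { darts = [] ; isWalk = refl } = q∉A
      ... | record { darts = d ∷ _ ; isWalk = refl , _ ; allowed = o ∷ _ } = proj₁ (okB⁻ d o)
      p∈X : lookup X p ≡ true
      p∈X = trans (X-at p) (cong not (Bool.¬-not λ p∈B → Bool.not-¬ (B∩A p p∈B) (target ra)))
      q∉X : lookup X q ≡ false
      q∉X = trans (X-at q) (cong not (target rb))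
      X⇒A : ∀ (d : Dart G) → lookup B (start G d) ≡ false → lookup B (end G d) ≡ true → lookup A (start G d) ≡ true
      X⇒A d s∉ t∈ = Bool.¬-not λ s∉A → Bool.not-¬ s∉ (closed rb d (okB⁺ d s∉A (B∩A _ t∈)) t∈)
      -- An arc leaving `X` ends in `B`, so it starts in `A`, since `B` is closed among the vertices
      -- outside `A`. Leaving `A`, it crosses the cut of `W` from the side containing `A`.
      X⇒W : ∀ f c → Arc (dcut G X) f c → Arc (dcut G W) f c
      X⇒W f c r with dcut-arc G X f c r
      ... | s , t = dcut-arc⁻ G W f c (A⊆W _ s∈A) (A⇒W (f , c) s∈A (B∩A _ t∈B))
        where
        t∈B : lookup B (end G (f , c)) ≡ true
        t∈B = Bool.not-injective (trans (sym (X-at _)) t)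
        s∈A : lookup A (start G (f , c)) ≡ true
        s∈A = X⇒A (f , c) (Bool.not-injective (trans (sym (X-at _)) s)) t∈B
      cutX⇒arc : ∀ f → lookup (cut G X) f ≡ true → Σ Bool λ c → Arc (dcut G X) f c
      cutX⇒arc f r = supp-arc⁻ (dcut G X) (dcut-trit G X) f (trans (cong (λ Y → lookup Y f) (supp-dcut G X)) r)
      cocycle : IsCocycle G (cut G X)
      cocycle = X , refl , (e , trans (cong (λ Y → lookup Y e) (sym (supp-dcut G X))) (supp-arc (dcut G X) e b (dcut-arc⁻ G X e b p∈X q∉X))) , minimal
        where
        -- `W'` is constant along edges outside the cut of `X`, hence constant on `B` and on its
        -- complement. Its own cut being nonempty, the two values differ, so it has the same cut as
        -- `X`.
        minimal : ∀ W' → NonEmpty G (cut G W') → _⊆ₛ_ G (cut G W') (cut G X) → cut G W' ≡ cut G X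
        minimal W' (f₀ , f₀∈) sub = ext λ f → trans (cut-at G W' f) (trans (cong₂ _xor_ (value (src f)) (value (tgt f)))
            (trans (bool (lookup B (src f)) (lookup B (tgt f))) (trans (sym (cong₂ _xor_ (X-at (src f)) (X-at (tgt f)))) (sym (cut-at G X f)))))
          where
          not-cut : ∀ f → (∀ c → ¬ Arc (dcut G X) f c) → lookup (cut G W') f ≡ false
          not-cut f h = Bool.¬-not λ r → let (c , s) = cutX⇒arc f (sub f r) in h c s
          onA : ∀ v → lookup A v ≡ true → lookup W' v ≡ lookup W' p
          onA v v∈ = let P = path ra v v∈ in const-along-walk (lookup W') (darts P) (isWalk P)
            (All.map (λ {d} o → okA⇒same W' d (not-cut (proj₁ d) λ c r → Bool.not-¬ (supp-arc (dcut G W) (proj₁ d) c (X⇒W _ c r))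
              (trans (cong (λ Y → lookup Y (proj₁ d)) (supp-dcut G W)) (Bool.not-injective o)))) (allowed P))
          tail-in-A : ∀ f c → Arc (dcut G X) f c → lookup A (start G (f , c)) ≡ true
          tail-in-A f c r with dcut-arc G X f c r
          ... | s , t = X⇒A (f , c) (Bool.not-injective (trans (sym (X-at _)) s)) (Bool.not-injective (trans (sym (X-at _)) t))
          avoids-A : ∀ (d : Dart G) → okB d ≡ true → ∀ c → lookup A (start G (proj₁ d , c)) ≡ false
          avoids-A (f , true)  o true  = proj₁ (okB⁻ (f , true) o)
          avoids-A (f , true)  o false = proj₂ (okB⁻ (f , true) o)
          avoids-A (f , false) o true  = proj₂ (okB⁻ (f , false) o)
          avoids-A (f , false) o false = proj₁ (okB⁻ (f , false) o)
          onB : ∀ v → lookup B v ≡ true → lookup W' v ≡ lookup W' q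
          onB v v∈ = let P = path rb v v∈ in const-along-walk (lookup W') (darts P) (isWalk P)
            (All.map (λ {d} o → okA⇒same W' d (not-cut (proj₁ d) λ c r → Bool.not-¬ (avoids-A d o c) (tail-in-A _ c r))) (allowed P))
          -- Follow a walk towards `p`, which lies in `A`. Until it first meets `A` it cannot enter
          -- `B` and crosses no edge of the cut of `X`; on `A` the value is known.
          offB : ∀ ds {v} → IsWalk G v ds p → lookup B v ≡ false → lookup W' v ≡ lookup W' p
          offB [] refl _ = refl
          offB (d ∷ ds) (refl , w) v∉ with lookup A (start G d) in sA
          ... | true = onA _ sA
          ... | false with lookup B (end G d) in tB
          ... | true = ⊥-elim (Bool.not-¬ v∉ (closed rb d (okB⁺ d sA (B∩A _ tB)) tB))
          ... | false = trans (okA⇒same W' d (not-cut (proj₁ d) (uncrossed d v∉ tB))) (offB ds w tB)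
            where
            uncrossed : ∀ (d : Dart G) → lookup B (start G d) ≡ false → lookup B (end G d) ≡ false → ∀ c → ¬ Arc (dcut G X) (proj₁ d) c
            uncrossed d@(f , b) s t c r with Bool.not-injective (trans (sym (X-at _)) (proj₂ (dcut-arc G X f c r)))
            uncrossed (f , true)  s t true  r | t' = Bool.not-¬ t t'
            uncrossed (f , true)  s t false r | t' = Bool.not-¬ s t'
            uncrossed (f , false) s t true  r | t' = Bool.not-¬ s t'
            uncrossed (f , false) s t false r | t' = Bool.not-¬ t t'
          constant : ∀ v → lookup B v ≡ false → lookup W' v ≡ lookup W' p
          constant v v∉ = let (ds , w , _) = conn v p in offB ds w v∉
          p≢q : lookup W' p ≢ lookup W' q
          p≢q r = Bool.not-¬ (trans (cut-at G W' f₀) (trans (cong₂ _xor_ (all (src f₀)) (all (tgt f₀))) (Bool.xor-same (lookup W' p)))) f₀∈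
            where
            all : ∀ v → lookup W' v ≡ lookup W' p
            all v with lookup B v in vB
            ... | true  = trans (onB v vB) (sym r)
            ... | false = constant v vB
          value : ∀ v → lookup W' v ≡ lookup B v xor lookup W' p
          value v with lookup B v in vB
          ... | false = constant v vB
          ... | true  = trans (onB v vB) (≢⇒not λ r → p≢q (sym r))
          bool : ∀ x y {z} → (x xor z) xor (y xor z) ≡ not x xor not y
          bool true  true  {true}  = refl
          bool true  true  {false} = refl
          bool true  false {true}  = refl
          bool true  false {false} = refl
          bool false true  {true}  = refl
          bool false true  {false} = refl
          bool false false {true}  = refl
          bool false false {false} = refl

    -- Let `R` be the set of vertices from which the start of `e` is reachable along permitted
    -- darts. If the end of `e` is in `R`, a path back closes up to a cycle. Otherwise `e` leaves
    -- `R` and no permitted dart off `e` enters it; a cocycle inside this directed cut serves.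
    painting : ∀ (ok : Fin nE → Bool → Bool) e b →
      (Σ (Vec ℤ nE) λ x → IsDirCycle G x × Arc x e b × (∀ f c → f ≢ e → Arc x f c → ok f c ≡ true)) ⊎
      (Σ (Vec ℤ nE) λ y → IsDirCocycle G y × Arc y e b × (∀ f c → f ≢ e → Arc y f c → ok f (not c) ≡ false))
    painting ok e b = split (lookup R (end G d₀) Bool.≟ true)
      where
      d₀ : Dart G
      d₀ = e , b
      -- `e` is excluded so that closing the path with `d₀` repeats no edge.
      okd : Dart G → Bool
      okd (f , c) = ok f c ∧ not ⌊ f ≟ e ⌋
      okd⁻ : ∀ f c → okd (f , c) ≡ true → ok f c ≡ true × f ≢ e
      okd⁻ f c o with ok f c | f ≟ e
      okd⁻ f c o  | true  | no ne = refl , ne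
      okd⁻ f c () | true  | yes _
      okd⁻ f c () | false | _
      okd⁺ : ∀ f c → ok f c ≡ true → f ≢ e → okd (f , c) ≡ true
      okd⁺ f c o ne with f ≟ e
      ... | yes q = ⊥-elim (ne q)
      ... | no _  = trans (Bool.∧-identityʳ _) o
      r = coReachable okd (start G d₀)
      R = set r
      split : Dec (lookup R (end G d₀) ≡ true) → _
      -- The target of `P` is the start of `d₀`, so `simple P` is exactly the vertex condition for
      -- the closed walk.
      split (yes t∈) = inj₁ (dvecOf G ds , (ds , ((λ ()) , (start G d₀ , refl , isWalk P) , simple P , edges) , refl) ,
          dvecOf-on G ds edges (here refl) , only)
        where
        P = path r (end G d₀) t∈
        ds : List (Dart G)
        ds = d₀ ∷ darts P
        edges : Unique (L.map proj₁ ds)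
        edges = All.map⁺ (All.map (λ {d} o q → proj₂ (okd⁻ (proj₁ d) (proj₂ d) o) (sym q)) (allowed P))
          ∷ simple-path-edges (darts P) (isWalk P) (simple P)
        only : ∀ f c → f ≢ e → Arc (dvecOf G ds) f c → ok f c ≡ true
        only f c f≢e ar with dvecOf-arc G ds edges ar
        ... | here refl = ⊥-elim (f≢e refl)
        ... | there d∈ = proj₁ (okd⁻ f c (All.lookup (allowed P) d∈))
      split (no t∉) with cut⊇cocycle R e b (dcut-arc⁻ G R e b (target r) (Bool.¬-not t∉))
      ... | y , cy , ay , sub = inj₂ (y , cy , ay , only)
        where
        only : ∀ f c → f ≢ e → Arc y f c → ok f (not c) ≡ false
        only f c f≢e ar with dcut-arc G R f c (sub f c ar)
        ... | s∈ , t∉ = Bool.¬-not λ o → Bool.not-¬ t∉ (subst (λ v → lookup R v ≡ true) (start-flip G (f , c))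
                          (closed r (f , not c) (okd⁺ f (not c) o f≢e) (trans (cong (lookup R) (end-flip G (f , c))) s∈)))

-- Compatibility in terms of the reversed sets.

module _ {n : ℕ} {A B : Signed n} (M : Dual A B) where
  no-circuit⇒empty : ∀ K P → Flow B (on K P) → (∀ x → Cir A x → InO K x → (∀ e b → Arc x e b → lookup P e ≡ true) → ⊥) →
    ∀ e → lookup P e ≡ false
  no-circuit⇒empty K P fP h e = Bool.¬-not λ p → sg≢0 {lookup K e} (trans (sym (on-in K P e p))
    (flow-zero M (on K P) fP (λ x cx cf → let arc = λ f c a → on-arc K P f c (positive-trit c (on-trit K P f) (cf f c a)) in
      h x cx (λ f c a → proj₂ (arc f c a)) (λ f c a → proj₁ (arc f c a))) e))

  -- A circuit of `K` inside `P` would be chosen through `K`, and its negative through `O`.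
  compat⇒no-reversal : ∀ K P O → Compat A K → Compat A O → Flow B (on K P) →
    (∀ e → lookup P e ≡ true → lookup O e ≡ not (lookup K e)) → ∀ e → lookup P e ≡ false
  compat⇒no-reversal K P O kK kO fP r = no-circuit⇒empty K P fP λ x cx ix inP → pos-neg A (kK x cx ix)
    (kO (neg x) (neg-cir A cx) λ e b a → let a' = Arc-neg⁻ x e b a in
      trans (r e (inP e (not b) a')) (trans (cong not (ix e (not b) a')) (Bool.not-involutive b)))

  -- The reversed cocircuits lie in `O`, so circuits of `O` avoid `Q`. There `O` and `K` agree,
  -- hence these are circuits of `K`.
  cut-reversal-compat : ∀ K Q O → Compat A K → Flow A (on K Q) → (∀ e → lookup Q e ≡ true → lookup O e ≡ not (lookup K e)) →
    (∀ e → lookup Q e ≡ false → lookup O e ≡ lookup K e) → Compat A O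
  cut-reversal-compat K Q O kK fQ r k x cx ix = kK x cx λ e b a → trans (sym (k e (off e b a))) (ix e b a)
    where
    ineg : InO O (neg (on K Q))
    ineg e b a with on-arc K Q e (not b) (Arc-neg⁻ (on K Q) e b a)
    ... | q , s = trans (r e q) (trans (cong not s) (Bool.not-involutive b))
    off : ∀ e b → Arc x e b → lookup Q e ≡ false
    off e b a = Bool.¬-not λ q → flows-disjoint M O x (neg (on K Q)) (cir-flow M cx) (flow-neg {B = A} {on K Q} fQ)
      (trit A cx) (neg-trit (on K Q) (on-trit K Q)) ix ineg a (Arc-neg (on K Q) e _ (on-in K Q e q))

  open Config

  config-compatA : ∀ {O} (c : Config A B O) → (∀ e → lookup (P c) e ≡ false) → Compat A O
  config-compatA {O} c p = cut-reversal-compat (K c) (Q c) O (tree-compat M (isTree c)) (flowQ c)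
    (config-reversed-Q M c) (λ e → config-kept M c e (p e))

config-compatB : ∀ {n} {A B : Signed n} (M : Dual A B) {O} (c : Config A B O) → (∀ e → lookup (Config.Q c) e ≡ false) → Compat B O
config-compatB M {O} c q = cut-reversal-compat (swap M) (K c) (P c) O (tree-compat (swap M) (swapTree (isTree c))) (flowP c)
  (config-reversed-P M c) (λ e p → config-kept M c e p (q e))
  where open Config

-- From graphs to dual pairs and back; the three bijections.

supp-neg : ∀ {n} (x : Vec ℤ n) → supp (neg x) ≡ supp x
supp-neg x = ext λ e → trans (lookup-map e _ (neg x)) (trans (cong (λ z → not ⌊ z ℤ.≟ 0ℤ ⌋) (neg-at x e))
  (trans (lem (lookup x e)) (sym (lookup-map e _ x))))
  where
  lem : ∀ z → not ⌊ - z ℤ.≟ 0ℤ ⌋ ≡ not ⌊ z ℤ.≟ 0ℤ ⌋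
  lem (ℤ.+ zero)  = refl
  lem ℤ.+[1+ _ ] = refl
  lem ℤ.-[1+ _ ] = refl

module _ (G : Graph) where
  open Graph G

  InO⇒InOrient : ∀ {O x} → InO O x → InOrient G O x
  InO⇒InOrient i e = i e true , i e false

  InOrient⇒InO : ∀ {O x} → InOrient G O x → InO O x
  InOrient⇒InO i e true  = proj₁ (i e)
  InOrient⇒InO i e false = proj₂ (i e)

  -- Shared by cycles and cocycles. A signature is a function of supports, so `Pos` singles out the
  -- vectors it returns on their own support.
  signed : (C : Vec ℤ nE → Set) (S : EdgeSet G → Set) → (∀ {x} → C x → S (supp x)) →
    (∀ x → Dec (C x)) → (∀ {x} → C x → AllTrit x) → (∀ {x} → C x → Σ (Fin nE) λ e → Σ Bool λ b → Arc x e b) →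
    (∀ {x} → C x → C (neg x)) → (σ : EdgeSet G → DVec G) → (∀ x → C x → σ (supp x) ≡ x ⊎ σ (supp x) ≡ neg x) →
    (∀ Xs → All S Xs → sumV G (L.map σ Xs) ≡ zeroV G → Xs ≡ []) → Signed nE
  signed C S supp-S C? tri nz ng σ sig acyc = record
    { Cir = C ; Pos = λ x → C x × x ≡ σ (supp x) ; cir? = C? ; trit = tri ; nonzero = nz ; neg-cir = ng ; pos-cir = proj₁
    ; total = λ {x} cx → choose x cx (sig x cx)
    ; acyclic = λ {xs} ps eq → empty xs (acyc (L.map supp xs) (All.map⁺ (All.map (λ p → supp-S (proj₁ p)) ps))
                  (trans (cong Σv (chosen xs ps)) eq)) }
    where
    choose : ∀ x → C x → σ (supp x) ≡ x ⊎ σ (supp x) ≡ neg x → (C x × x ≡ σ (supp x)) ⊎ (C (neg x) × neg x ≡ σ (supp (neg x)))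
    choose x cx (inj₁ p) = inj₁ (cx , sym p)
    choose x cx (inj₂ p) = inj₂ (ng cx , trans (sym p) (cong σ (sym (supp-neg x))))
    chosen : ∀ xs → All (λ x → C x × x ≡ σ (supp x)) xs → L.map σ (L.map supp xs) ≡ xs
    chosen [] [] = refl
    chosen (x ∷ xs) ((_ , p) ∷ ps) = cong₂ _∷_ (sym p) (chosen xs ps)
    empty : ∀ xs → L.map supp xs ≡ [] → xs ≡ []
    empty [] _ = refl

  crossing-dart : ∀ (f : Fin nV → Bool) {u v} ds → IsWalk G u ds v → f u ≢ f v → Σ (Dart G) λ d → f (start G d) ≢ f (end G d)
  crossing-dart f []       refl       ne = ⊥-elim (ne refl)
  crossing-dart f {u} {v} (d ∷ ds) (refl , w) ne with f (start G d) Bool.≟ f (end G d)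
  ... | no p  = d , p
  ... | yes p = crossing-dart f ds w λ q → ne (trans p q)

  module _ (conn : ConnectedSub G (fullSet G)) (σ σ* : EdgeSet G → DVec G)
    (sig : IsCycleSignature G σ) (acy : AcyclicCycleSig G σ)
    (sig* : IsCocycleSignature G σ*) (acy* : AcyclicCocycleSig G σ*) where

    cycles cocycles : Signed nE
    cycles   = signed (IsDirCycle G) (IsCycle G) (λ {x} c → x , c , refl)
                 (dirCycle? G) (dirCycle-trit G) (dirCycle-nonzero G) (neg-dirCycle G) σ sig acy
    cocycles = signed (IsDirCocycle G) (IsCocycle G) (λ { (W , c , refl) → subst (IsCocycle G) (sym (supp-dcut G W)) c })
                 (dirCocycle? G) (dirCocycle-trit G) (dirCocycle-nonzero G) (neg-dirCocycle G) σ* sig* acy*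

    abstract
      duality : Dual cycles cocycles
      duality = record { orth = cycle-cocycle-orth G ; paint = painting G conn }

    cycleCompatible⇒compat : ∀ {O} → CycleCompatible G σ O → Compat cycles O
    cycleCompatible⇒compat {O} k x cx i = cx , k x cx (InO⇒InOrient {O} {x} i)

    compat⇒cycleCompatible : ∀ {O} → Compat cycles O → CycleCompatible G σ O
    compat⇒cycleCompatible {O} k x cx i = proj₂ (k x cx (InOrient⇒InO {O} {x} i))

    cocycleCompatible⇒compat : ∀ {O} → CocycleCompatible G σ* O → Compat cocycles O
    cocycleCompatible⇒compat {O} k x cx i = cx , k x cx (InO⇒InOrient {O} {x} i)

    compat⇒cocycleCompatible : ∀ {O} → Compat cocycles O → CocycleCompatible G σ* O
    compat⇒cocycleCompatible {O} k x cx i = proj₂ (k x cx (InOrient⇒InO {O} {x} i))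

    forest⇒indep : ∀ {S} → Forest G S → Indep cycles S true
    forest⇒indep F x cx h = F (supp x) (x , cx , refl) λ e p → let (b , a) = supp-arc⁻ x (dirCycle-trit G cx) e p in h e b a

    indep⇒forest : ∀ {S} → Indep cycles S true → Forest G S
    indep⇒forest ind _ (x , cx , refl) sub = ind x cx λ e b a → sub e (supp-arc x e b a)

    -- If `S` avoided the cocycle, the side of `W` would be constant along a walk in `S` joining the
    -- two ends of one of its arcs.
    connected⇒indep : ∀ {S} → ConnectedSub G S → Indep cocycles S false
    connected⇒indep {S} con y cy@(W , _ , refl) h with dirCocycle-nonzero G cy
    ... | e , b , a with dcut-arc G W e b a
    ... | s∈ , t∉ with con (start G (e , b)) (end G (e , b))
    ... | ds , w , inS = Bool.not-¬ {false} refl (trans (sym t∉) (trans (sym (const-along-walk G (lookup W) ds w (All.map (λ {d} p → same d p) inS))) s∈))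
      where
      same : ∀ d → lookup S (proj₁ d) ≡ true → lookup W (start G d) ≡ lookup W (end G d)
      same (f , c) p with lookup W (start G (f , c)) in s | lookup W (end G (f , c)) in t
      ... | true  | true  = refl
      ... | false | false = refl
      ... | true  | false = ⊥-elim (Bool.not-¬ (h f c (dcut-arc⁻ G W f c s t)) p)
      ... | false | true  = ⊥-elim (Bool.not-¬ (h f (not c) (dcut-arc⁻ G W f (not c)
                              (trans (cong (lookup W) (start-flip G (f , c))) t) (trans (cong (lookup W) (end-flip G (f , c))) s))) p)

    -- If `u` cannot reach `v` inside `S`, a walk of `G` from `u` to `v` crosses the cut of the set
    -- of vertices that can, and a cocycle inside this cut avoids `S`.
    indep⇒connected : ∀ {S} → Indep cocycles S false → ConnectedSub G S
    indep⇒connected {S} ind u v = split (lookup R u Bool.≟ true)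
      where
      r = coReachable G (λ d → lookup S (proj₁ d)) v
      R = CoReachable.set r
      split : Dec (lookup R u ≡ true) → Σ (List (Dart G)) λ ds → IsWalk G u ds v × All (λ d → lookup S (proj₁ d) ≡ true) ds
      split (yes u∈) = let P = CoReachable.path r u u∈ in Path.darts P , Path.isWalk P , Path.allowed P
      split (no u∉) = ⊥-elim (separated (proj₂ arc))
        where
        dart : Σ (Dart G) λ d → lookup R (start G d) ≢ lookup R (end G d)
        dart = let (ds , w , _) = conn u v in crossing-dart (lookup R) ds w λ q → u∉ (trans q (CoReachable.target r))
        arc : Σ (Dart G) λ (e , b) → Arc (dcut G R) e b
        arc with dart
        ... | (e , b) , ne with lookup R (start G (e , b)) in s | lookup R (end G (e , b)) in t
        ... | true  | true  = ⊥-elim (ne refl)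
        ... | false | false = ⊥-elim (ne refl)
        ... | true  | false = (e , b) , dcut-arc⁻ G R e b s t
        ... | false | true  = (e , not b) , dcut-arc⁻ G R e (not b) (trans (cong (lookup R) (start-flip G (e , b))) t)
                                (trans (cong (lookup R) (end-flip G (e , b))) s)
        separated : ∀ {e b} → Arc (dcut G R) e b → ⊥
        separated {e} {b} a with cut⊇cocycle G conn R e b a
        ... | y , cy , _ , sub = ind y cy λ f c af → outside f c (dcut-arc G R f c (sub f c af))
          where
          outside : ∀ f c → lookup R (start G (f , c)) ≡ true × lookup R (end G (f , c)) ≡ false → lookup S f ≡ false
          outside f c (s∈ , t∉) = Bool.¬-not λ p → Bool.not-¬ t∉ (subst (λ v → lookup R v ≡ true) (start-flip G (f , c))
            (CoReachable.closed r (f , not c) p (trans (cong (lookup R) (end-flip G (f , c))) s∈)))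

    private
      ∪-single-at : ∀ X e f → lookup (_∪ₛ_ G X (single G e)) f ≡ lookup X f ∨ ⌊ f ≟ e ⌋
      ∪-single-at X e f = trans (lookup-zipWith _∨_ f X (single G e)) (cong (lookup X f ∨_) (lookup∘tabulate _ f))

      ∪-single⁻ : ∀ X e f → f ≢ e → lookup (_∪ₛ_ G X (single G e)) f ≡ true → lookup X f ≡ true
      ∪-single⁻ X e f ne p with f ≟ e | ∪-single-at X e f
      ... | yes q | _ = ⊥-elim (ne q)
      ... | no _  | r = trans (sym (Bool.∨-identityʳ _)) (trans (sym r) p)

      ∪-single⁺ : ∀ X e f → (f ≢ e → lookup X f ≡ true) → lookup (_∪ₛ_ G X (single G e)) f ≡ true
      ∪-single⁺ X e f h with f ≟ e | ∪-single-at X e f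
      ... | yes _ | r = trans r (Bool.∨-zeroʳ _)
      ... | no ne | r = trans r (trans (Bool.∨-identityʳ _) (h ne))

      fund-supp : ∀ X e x → AllTrit x → (∀ f c → f ≢ e → Arc x f c → lookup X f ≡ true) → _⊆ₛ_ G (supp x) (_∪ₛ_ G X (single G e))
      fund-supp X e x t h f p = let (c , a) = supp-arc⁻ x t f p in ∪-single⁺ X e f λ ne → h f c ne a

      supp-fund : ∀ X e x → _⊆ₛ_ G (supp x) (_∪ₛ_ G X (single G e)) → ∀ f c → f ≢ e → Arc x f c → lookup X f ≡ true
      supp-fund X e x h f c ne a = ∪-single⁻ X e f ne (h f (supp-arc x f c a))

      agrees : ∀ {O x e b} → AgreesAt G O x e → Arc x e b → lookup O e ≡ b
      agrees {b = true}  (p , _) a = p a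
      agrees {b = false} (_ , q) a = q a

      compl-true : ∀ {T f} → lookup T f ≡ false → lookup (compl G T) f ≡ true
      compl-true {T} {f} p = trans (lookup-map f not T) (cong not p)

      compl-false : ∀ {T f} → lookup (compl G T) f ≡ true → lookup T f ≡ false
      compl-false {T} {f} p = Bool.not-injective (trans (sym (lookup-map f not T)) p)

    spanningTree⇒tree : ∀ {T O} → SpanningTree G T → IsG G σ σ* T O → Tree cycles cocycles true T O
    spanningTree⇒tree {T} {O} (F , C) g = tree (forest⇒indep {T} F) (connected⇒indep {T} C) outA outB
      where
      outA : Outer cycles T true O
      outA e x b e∉ (cx , eq) fx a = agrees {O} {x} {e} (subst (λ y → AgreesAt G O y e) (sym eq)
        (proj₁ (g e) e∉ (supp x) (x , cx , refl) (fund-supp T e x (dirCycle-trit G cx) fx))) a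
      outB : Outer cocycles T false O
      outB e x b e∈ (cx , eq) fx a = agrees {O} {x} {e} (subst (λ y → AgreesAt G O y e) (sym eq)
        (proj₂ (g e) e∈ (supp x) (isC cx)
          (fund-supp (compl G T) e x (dirCocycle-trit G cx) (λ f c ne af → compl-true {T} {f} (fx f c ne af))) (supp-arc x e b a))) a
        where
        isC : ∀ {x} → IsDirCocycle G x → IsCocycle G (supp x)
        isC (W , c , refl) = subst (IsCocycle G) (sym (supp-dcut G W)) c

    -- `IsG` speaks of undirected sets: of the two directions of `C` the chosen one is picked by
    -- `total`, and `Outer` applies to it.
    tree⇒spanningTree : ∀ {T O} → Tree cycles cocycles true T O → SpanningTree G T × IsG G σ σ* T O
    tree⇒spanningTree {T} {O} t = (indep⇒forest {T} (indepA t) , indep⇒connected {T} (indepB t)) , λ e → cyc e , λ e∈ C cC sub _ → coc e e∈ C cC sub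
      where
      at : ∀ {x y : DVec G} {e} → x ≡ y → (∀ b → Arc x e b → lookup O e ≡ b) → AgreesAt G O y e
      at refl h = h true , h false
      cyc : ∀ e → lookup T e ≡ false → ∀ C → IsCycle G C → _⊆ₛ_ G C (_∪ₛ_ G T (single G e)) → AgreesAt G O (σ C) e
      cyc e e∉ _ (x , cx , refl) sub with total cycles cx
      ... | inj₁ p@(_ , eq) = at {x} {σ (supp x)} {e} eq λ b a → outerA t e x b e∉ p (supp-fund T e x sub) a
      ... | inj₂ p@(_ , eq) = at {neg x} {σ (supp x)} {e} (trans eq (cong σ (supp-neg x))) λ b a → outerA t e (neg x) b e∉ p
              (supp-fund T e (neg x) (subst (λ X → _⊆ₛ_ G X (_∪ₛ_ G T (single G e))) (sym (supp-neg x)) sub)) a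
      coc : ∀ e → lookup T e ≡ true → ∀ C → IsCocycle G C → _⊆ₛ_ G C (_∪ₛ_ G (compl G T) (single G e)) → AgreesAt G O (σ* C) e
      coc e e∈ C (W , refl , c) sub = subst (λ X → AgreesAt G O (σ* X) e) (supp-dcut G W)
          (go (dcut G W) (W , (W , refl , c) , refl) (subst (λ X → _⊆ₛ_ G X (_∪ₛ_ G (compl G T) (single G e))) (sym (supp-dcut G W)) sub))
        where
        go : ∀ x → IsDirCocycle G x → _⊆ₛ_ G (supp x) (_∪ₛ_ G (compl G T) (single G e)) → AgreesAt G O (σ* (supp x)) e
        go x cx sub with total cocycles cx
        ... | inj₁ p@(_ , eq) = at {x} {σ* (supp x)} {e} eq λ b a → outerB t e x b e∈ p
                (λ f c ne af → compl-false {T} {f} (supp-fund (compl G T) e x sub f c ne af)) a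
        ... | inj₂ p@(_ , eq) = at {neg x} {σ* (supp x)} {e} (trans eq (cong σ* (supp-neg x))) λ b a → outerB t e (neg x) b e∈ p
                (λ f c ne af → compl-false {T} {f} (supp-fund (compl G T) e (neg x)
                  (subst (λ X → _⊆ₛ_ G X (_∪ₛ_ G (compl G T) (single G e))) (sym (supp-neg x)) sub) f c ne af)) a

    module _ {O : Orientation G} where
      private
        allPairs-++ : ∀ {R : DVec G → DVec G → Set} xs {ys} → AllPairs R (xs ++ ys) → AllPairs R xs × AllPairs R ys
        allPairs-++ []       ps       = [] , ps
        allPairs-++ (x ∷ xs) (p ∷ ps) = let (a , b) = allPairs-++ xs ps in All.++⁻ˡ xs p ∷ a , b

      config : Decomp G σ σ* O → Config cycles cocycles O
      config d = record
        { P = ⋃ cyc ; Q = ⋃ coc ; isTree = spanningTree⇒tree {T} {Ocp} isTree gT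
        ; flowP = circuits-flow duality Ocp cyc (All.map (λ {x} (c , i) → c , InOrient⇒InO {Ocp} {x} i) cycOK) (proj₁ (allPairs-++ cyc disjoint))
        ; flowQ = circuits-flow (swap duality) Ocp coc (All.map (λ {x} (c , i) → c , InOrient⇒InO {Ocp} {x} i) cocOK) (proj₂ (allPairs-++ cyc disjoint))
        ; reverse = trans reversal (cong (λ X → rev X Ocp) (⋃-++ cyc coc)) }
        where open Decomp d

      -- The lists that `Decomp` requires are recovered by splitting both flows; cycles and cocycles
      -- are mutually disjoint because `P` and `Q` are.
      decomp : (c : Config cycles cocycles O) → Phi G σ σ* O (Config.image c)
      decomp c = build (decompose duality K P flowP) (decompose (swap duality) K Q flowQ) (tree⇒spanningTree {T} {K} isTree)
        where
        open Config c
        build : (Σ (List (DVec G)) λ xs → All (λ x → IsDirCycle G x × InO K x) xs × AllPairs Disjoint xs × ⋃ xs ≡ P) →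
          (Σ (List (DVec G)) λ ys → All (λ y → IsDirCocycle G y × InO K y) ys × AllPairs Disjoint ys × ⋃ ys ≡ Q) →
          SpanningTree G T × IsG G σ σ* T K → Phi G σ σ* O image
        build (xs , cx , dx , px) (ys , cy , dy , qy) (sp , g) = record
          { Ocp = K ; cpCyc = compat⇒cycleCompatible {K} (tree-compat duality isTree)
          ; cpCoc = compat⇒cocycleCompatible {K} (tree-compat (swap duality) (swapTree isTree))
          ; T = T ; isTree = sp ; gT = g ; cyc = xs ; cycOK = All.map (λ {x} (c , i) → c , InO⇒InOrient {K} {x} i) cx
          ; coc = ys ; cocOK = All.map (λ {x} (c , i) → c , InO⇒InOrient {K} {x} i) cy
          ; disjoint = AllPairs.++⁺ dx dy (All.tabulate λ {x} x∈ → All.tabulate λ {y} y∈ → apart x y x∈ y∈)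
          ; reversal = trans reverse (cong (λ X → rev X K) (trans (cong₂ _∪_ (sym px) (sym qy)) (sym (⋃-++ xs ys)))) }
          , cong₂ (λ X Y → (T ∪ X) ∖ Y) px qy
          where
          apart : ∀ x y → x ∈ xs → y ∈ ys → Disjoint x y
          apart x y x∈ y∈ e p = Bool.¬-not λ q → Bool.not-¬
            (config-disjoint duality c e (trans (cong (λ X → lookup X e) (sym px)) (⋃-⊇ x xs x∈ e p)))
            (trans (cong (λ X → lookup X e) (sym qy)) (⋃-⊇ y ys y∈ e q))

    abstract
      φ-total : ∀ O → Σ (EdgeSet G) (Phi G σ σ* O)
      φ-total O = _ , decomp (config-exists duality O)

    φ-functional : ∀ O S S' → Phi G σ σ* O S → Phi G σ σ* O S' → S ≡ S'
    φ-functional O _ _ (d , refl) (d' , refl) = config-functional duality (config d) (config d')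

    φ-injective : ∀ O O' S → Phi G σ σ* O S → Phi G σ σ* O' S → O ≡ O'
    φ-injective O O' S (d , p) (d' , p') = config-injective duality (config d) (config d') (trans p (sym p'))

    φ-surjective : ∀ S → Σ (Orientation G) λ O → Phi G σ σ* O S
    φ-surjective S = let (O , p) = injective⇒surjective f f-injective S in O , subst (Phi G σ σ* O) p (proj₂ (φ-total O))
      where
      f : Orientation G → EdgeSet G
      f O = proj₁ (φ-total O)
      f-injective : ∀ O O' → f O ≡ f O' → O ≡ O'
      f-injective O O' p = φ-injective O O' _ (proj₂ (φ-total O)) (subst (Phi G σ σ* O') (sym p) (proj₂ (φ-total O')))

    open Config

    no-cycles : ∀ {O} → CycleCompatible G σ O → (c : Config cycles cocycles O) → ∀ e → lookup (P c) e ≡ false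
    no-cycles {O} k c = compat⇒no-reversal duality (K c) (P c) O (tree-compat duality (isTree c)) (cycleCompatible⇒compat {O} k)
      (flowP c) (config-reversed-P duality c)

    no-cocycles : ∀ {O} → CocycleCompatible G σ* O → (c : Config cycles cocycles O) → ∀ e → lookup (Q c) e ≡ false
    no-cocycles {O} k c = compat⇒no-reversal (swap duality) (K c) (Q c) O (tree-compat (swap duality) (swapTree (isTree c)))
      (cocycleCompatible⇒compat {O} k) (flowQ c) (config-reversed-Q duality c)

    image-no-cycles : ∀ {O} (c : Config cycles cocycles O) → (∀ e → lookup (P c) e ≡ false) → image c ≡ T c ∖ Q c
    image-no-cycles c p = cong (_∖ Q c) (ext λ e → trans (lookup-zipWith _∨_ e (T c) (P c))
      (trans (cong (lookup (T c) e ∨_) (p e)) (Bool.∨-identityʳ _)))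

    image-no-cocycles : ∀ {O} (c : Config cycles cocycles O) → (∀ e → lookup (Q c) e ≡ false) → image c ≡ T c ∪ P c
    image-no-cocycles c q = ext λ e → trans (lookup-zipWith _ e (T c ∪ P c) (Q c))
      (trans (cong (λ a → lookup (T c ∪ P c) e ∧ not a) (q e)) (Bool.∧-identityʳ _))

    image-forest : ∀ {O} (c : Config cycles cocycles O) → (∀ e → lookup (P c) e ≡ false) → Forest G (image c)
    image-forest c p C cC sub = indep⇒forest {T c} (indepA (isTree c)) C cC λ e e∈ →
      ∧-left (trans (sym (lookup-zipWith _ e (T c) (Q c))) (trans (cong (λ X → lookup X e) (sym (image-no-cycles c p))) (sub e e∈)))
      where
      ∧-left : ∀ {a b} → a ∧ b ≡ true → a ≡ true
      ∧-left {true} _ = refl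

    image-connected : ∀ {O} (c : Config cycles cocycles O) → (∀ e → lookup (Q c) e ≡ false) → ConnectedSub G (image c)
    image-connected c q u v with indep⇒connected {T c} (indepB (isTree c)) u v
    ... | ds , w , inT = ds , w , All.map (λ {d} p → trans (cong (λ X → lookup X (proj₁ d)) (image-no-cocycles c q))
            (trans (lookup-zipWith _∨_ (proj₁ d) (T c) (P c)) (cong (_∨ lookup (P c) (proj₁ d)) p))) inT

    -- `P` is disjoint from `Q`, hence contained in the image; were it nonempty, it would contain a
    -- cycle of the forest.
    forest⇒cycleCompatible : ∀ {O} (c : Config cycles cocycles O) → Forest G (image c) → CycleCompatible G σ O
    forest⇒cycleCompatible {O} c F = compat⇒cycleCompatible {O} (config-compatA duality c
      (no-circuit⇒empty duality (K c) (P c) (flowP c) λ x cx _ inP → forest⇒indep {image c} F x cx λ e b a →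
        trans (image-at c e) (cong₂ _∧_ (trans (cong (lookup (T c) e ∨_) (inP e b a)) (Bool.∨-zeroʳ _))
          (cong not (config-disjoint duality c e (inP e b a))))))

    -- The image avoids `Q`, so a nonempty `Q` would contain a cocycle that the connected image does
    -- not meet.
    connected⇒cocycleCompatible : ∀ {O} (c : Config cycles cocycles O) → ConnectedSub G (image c) → CocycleCompatible G σ* O
    connected⇒cocycleCompatible {O} c C = compat⇒cocycleCompatible {O} (config-compatB duality c
      (no-circuit⇒empty (swap duality) (K c) (Q c) (flowQ c) λ x cx _ inQ → connected⇒indep {image c} C x cx λ e b a →
        trans (image-at c e) (trans (cong (λ q → (lookup (T c) e ∨ lookup (P c) e) ∧ not q) (inQ e b a)) (Bool.∧-zeroʳ _))))

    φ-bijection : IsBijectionRel G (λ _ → ⊤) (λ _ → ⊤) (Phi G σ σ*)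
    φ-bijection = (λ O _ → φ-total O) , (λ O S S' _ → φ-functional O S S') , (λ _ _ _ _ → tt) ,
      (λ O O' S _ _ → φ-injective O O' S) , λ S _ → let (O , r) = φ-surjective S in O , tt , r

    -- Surjectivity onto forests comes from the unrestricted φ: an orientation with forest image is
    -- compatible by `forest⇒cycleCompatible`.
    φ-forests : IsBijectionRel G (CycleCompatible G σ) (Forest G) (Phi G σ σ*)
    φ-forests = (λ O _ → φ-total O) , (λ O S S' _ → φ-functional O S S') , forest ,
      (λ O O' S _ _ → φ-injective O O' S) , λ S F → let (O , r) = φ-surjective S in O , compatible O S r F , r
      where
      forest : ∀ O S → CycleCompatible G σ O → Phi G σ σ* O S → Forest G S
      forest O _ k (d , refl) = image-forest (config d) (no-cycles k (config d))
      compatible : ∀ O S → Phi G σ σ* O S → Forest G S → CycleCompatible G σ O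
      compatible O _ (d , refl) = forest⇒cycleCompatible (config d)

    φ-connected : IsBijectionRel G (CocycleCompatible G σ*) (ConnectedSub G) (Phi G σ σ*)
    φ-connected = (λ O _ → φ-total O) , (λ O S S' _ → φ-functional O S S') , connected ,
      (λ O O' S _ _ → φ-injective O O' S) , λ S C → let (O , r) = φ-surjective S in O , compatible O S r C , r
      where
      connected : ∀ O S → CocycleCompatible G σ* O → Phi G σ σ* O S → ConnectedSub G S
      connected O _ k (d , refl) = image-connected (config d) (no-cocycles k (config d))
      compatible : ∀ O S → Phi G σ σ* O S → ConnectedSub G S → CocycleCompatible G σ* O
      compatible O _ (d , refl) = connected⇒cocycleCompatible (config d)

    φ-restricted : IsBijectionRel G (λ _ → ⊤) (λ _ → ⊤) (Phi G σ σ*)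
      × IsBijectionRel G (CycleCompatible G σ) (Forest G) (Phi G σ σ*)
      × (∀ O → CycleCompatible G σ O → (d : Decomp G σ σ* O) →
           phiOf G d ≡ _∖ₛ_ G (Decomp.T d) (unionSupp G (Decomp.coc d)))
      × IsBijectionRel G (CocycleCompatible G σ*) (ConnectedSub G) (Phi G σ σ*)
      × (∀ O → CocycleCompatible G σ* O → (d : Decomp G σ σ* O) →
           phiOf G d ≡ _∪ₛ_ G (Decomp.T d) (unionSupp G (Decomp.cyc d)))
    φ-restricted = φ-bijection , φ-forests , (λ O k d → image-no-cycles (config d) (no-cycles k (config d))) ,
      φ-connected , λ O k d → image-no-cocycles (config d) (no-cocycles k (config d))

theorem1p2 : (G : Graph) → ConnectedSub G (fullSet G) →
    (σ σ* : EdgeSet G → DVec G) →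
    IsCycleSignature G σ → AcyclicCycleSig G σ →
    IsCocycleSignature G σ* → AcyclicCocycleSig G σ* →
    -- (1) bijection from all orientations to all spanning subgraphs
    IsBijectionRel G (λ _ → ⊤) (λ _ → ⊤) (Phi G σ σ*)
    -- (2) restriction: σ-compatible orientations ↔ spanning forests,
    --     with φ(O) = T ∖ ⋃ C*_j
    × IsBijectionRel G (CycleCompatible G σ) (Forest G) (Phi G σ σ*)
    × (∀ O → CycleCompatible G σ O → (d : Decomp G σ σ* O) →
         phiOf G d ≡ _∖ₛ_ G (Decomp.T d) (unionSupp G (Decomp.coc d)))
    -- (3) restriction: σ*-compatible orientations ↔ connected spanning
    --     subgraphs, with φ(O) = T ∪ ⋃ C_i
    × IsBijectionRel G (CocycleCompatible G σ*) (ConnectedSub G) (Phi G σ σ*)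
    × (∀ O → CocycleCompatible G σ* O → (d : Decomp G σ σ* O) →
         phiOf G d ≡ _∪ₛ_ G (Decomp.T d) (unionSupp G (Decomp.cyc d)))
theorem1p2 = φ-restricted
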